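{- Let $M_1,M_2$ be matroids of positive rank on disjoint ground sets $S_1,S_2$, with $S'_1\subseteq S_1$, $S'_2\subseteq S_2$, and let $k$ be an integer with $k\ge r(M_1)+\eta_{M_1}(S'_1)+r(M_2)+\eta_{M_2}(S'_2)$. Let $T_1,T_2$ be sets with $|T_1|=k-r(M_1)-|S'_2|$, $|T_2|=k-r(M_2)-|S'_1|$ such that $T_1,T_2,S_1\cup S_2$ are pairwise disjoint, and let $M=M_k(M_1,S'_1,T_1;M_2,S'_2,T_2)$. Then $M_1$ and $M_2$ are both transversal if and only if $M$ is transversal. The same equivalence holds with "transversal" replaced by "cotransversal", by "bitransversal", and by "a gammoid".
   Context: All matroids are finite. A matroid is cotransversal if its dual is transversal, bitransversal if it is both transversal and cotransversal, and a gammoid if it is a minor of a transversal matroid. A cyclic flat is a flat that is a (possibly empty) union of circuits; for a matroid $N$, $\mathcal{Z}'(N)$ denotes its set of nonempty proper cyclic flats, and $\eta_N(Y)=|Y|-r_N(Y)$ is the nullity. Construction $M_k(N_1,A_1,U_1;N_2,A_2,U_2)$: let $N_1,N_2$ be matroids of positive rank on disjoint ground sets $R_1,R_2$ with rank functions $\rho_1,\rho_2$; let $A_1\subseteq R_1$, $A_2\subseteq R_2$; let $k$ be an integer with $k\ge r(N_1)+\eta_{N_1}(A_1)+r(N_2)+\eta_{N_2}(A_2)$; and let $U_1,U_2$ be sets with $|U_1|=k-r(N_1)-|A_2|$, $|U_2|=k-r(N_2)-|A_1|$, such that $U_1,U_2,R_1\cup R_2$ are pairwise disjoint. Let $E=R_1\cup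 R_2\cup U_1\cup U_2$. Then $M_k(N_1,A_1,U_1;N_2,A_2,U_2)$ is the (existing and unique) matroid on $E$ whose cyclic flats are exactly: $\emptyset$, of rank $0$; $E$, of rank $k$; the sets $F\cup U_1\cup A_2$ for $F\in\mathcal{Z}'(N_1)$, of rank $\rho_1(F)+|U_1|+|A_2|$; and the sets $F\cup U_2\cup A_1$ for $F\in\mathcal{Z}'(N_2)$, of rank $\rho_2(F)+|U_2|+|A_1|$. -}

module Defs where

open import Data.Nat using (ℕ; _+_; _∸_; _≤_; _<_)
open import Data.Fin using (Fin)
open import Data.Fin.Subset using (Subset; _∈_; _∉_; _⊆_; _∪_; _∩_; ∣_∣; ⁅_⁆; ∁; ⊥; ⊤)
open import Data.Vec using (_++_)
open import Data.Product using (Σ; ∃; _×_)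
open import Relation.Binary.PropositionalEquality using (_≡_; _≢_)

record Matroid (n : ℕ) : Set where
  field
    rk       : Subset n → ℕ
    rk-bound : ∀ X → rk X ≤ ∣ X ∣
    rk-mono  : ∀ {X Y} → X ⊆ Y → rk X ≤ rk Y
    rk-submod : ∀ X Y → rk (X ∪ Y) + rk (X ∩ Y) ≤ rk X + rk Y
open Matroid public

rank : ∀ {n} → Matroid n → ℕ
rank M = rk M ⊤

nullity : ∀ {n} → Matroid n → Subset n → ℕ
nullity M Y = ∣ Y ∣ ∸ rk M Y

IndepR : ∀ {n} → (Subset n → ℕ) → Subset n → Set
IndepR r X = r X ≡ ∣ X ∣

Independent : ∀ {n} → Matroid n → Subset n → Set
Independent M = IndepR (rk M)

IsCircuit : ∀ {n} → Matroid n → Subset n → Set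
IsCircuit M C = (rk M C < ∣ C ∣) × (∀ Y → Y ⊆ C → Y ≢ C → Independent M Y)

IsFlat : ∀ {n} → Matroid n → Subset n → Set
IsFlat M Z = ∀ x → x ∉ Z → rk M Z < rk M (Z ∪ ⁅ x ⁆)

IsCyclic : ∀ {n} → Matroid n → Subset n → Set
IsCyclic M Z = ∀ x → x ∈ Z → Σ (Subset _) λ C → IsCircuit M C × C ⊆ Z × x ∈ C

IsCyclicFlat : ∀ {n} → Matroid n → Subset n → Set
IsCyclicFlat M Z = IsFlat M Z × IsCyclic M Z

IsNPCyclicFlat : ∀ {n} → Matroid n → Subset n → Set
IsNPCyclicFlat M Z = IsCyclicFlat M Z × Z ≢ ⊥ × Z ≢ ⊤

IsPartialTransversal : ∀ {n m} → (Fin m → Subset n) → Subset n → Set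
IsPartialTransversal {n} {m} A X =
  Σ ((x : Fin n) → x ∈ X → Fin m) λ f →
    (∀ x y (px : x ∈ X) (py : y ∈ X) → f x px ≡ f y py → x ≡ y) ×
    (∀ x (px : x ∈ X) → x ∈ A (f x px))

IsTransversalR : ∀ {n} → (Subset n → ℕ) → Set
IsTransversalR {n} r =
  Σ ℕ λ m → Σ (Fin m → Subset n) λ A →
    ∀ X → (IndepR r X → IsPartialTransversal A X) × (IsPartialTransversal A X → IndepR r X)

IsTransversal : ∀ {n} → Matroid n → Set
IsTransversal M = IsTransversalR (rk M)

dualRk : ∀ {n} → Matroid n → Subset n → ℕ
dualRk M X = (∣ X ∣ + rk M (∁ X)) ∸ rk M ⊤

IsCotransversal : ∀ {n} → Matroid n → Set
IsCotransversal M = IsTransversalR (dualRk M)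

IsBitransversal : ∀ {n} → Matroid n → Set
IsBitransversal M = IsTransversal M × IsCotransversal M

-- gammoid: a minor of a transversal matroid.  The transversal matroid N lives
-- on Fin (n + m), the first n elements being the ground set of M; among the
-- extra m elements the set C is contracted and the rest deleted:
-- r_M(X) = r_N(X ∪ C) - r_N(C).
IsGammoid : ∀ {n} → Matroid n → Set
IsGammoid {n} M =
  Σ ℕ λ m → Σ (Matroid (n + m)) λ N → Σ (Subset m) λ C →
    IsTransversal N × (∀ X → rk M X ≡ rk N (X ++ C) ∸ rk N (⊥ ++ C))

join : ∀ {n₁ n₂ t₁ t₂} → Subset n₁ → Subset n₂ → Subset t₁ → Subset t₂ →
       Subset (n₁ + (n₂ + (t₁ + t₂)))
join F G H K = F ++ (G ++ (H ++ K))

-- M is (a copy of) M_k(N₁,A₁,U₁;N₂,A₂,U₂) on E = R₁ ⊔ R₂ ⊔ U₁ ⊔ U₂, where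
-- R₁ = Fin n₁, R₂ = Fin n₂, U₁ = Fin t₁, U₂ = Fin t₂: its cyclic flats and
-- their ranks are exactly those prescribed (this determines M uniquely).
IsMk : ∀ {n₁ n₂ t₁ t₂} → ℕ → (N₁ : Matroid n₁) → Subset n₁ →
       (N₂ : Matroid n₂) → Subset n₂ → Matroid (n₁ + (n₂ + (t₁ + t₂))) → Set
IsMk {n₁} {n₂} {t₁} {t₂} k N₁ A₁ N₂ A₂ M =
  (∀ Z → (IsCyclicFlat M Z →
            (Z ≡ ⊥) Data.Sum.⊎ (Z ≡ ⊤) Data.Sum.⊎
            (Σ (Subset n₁) λ F → IsNPCyclicFlat N₁ F × Z ≡ join F A₂ (⊤ {t₁}) (⊥ {t₂})) Data.Sum.⊎
            (Σ (Subset n₂) λ F → IsNPCyclicFlat N₂ F × Z ≡ join A₁ F (⊥ {t₁}) (⊤ {t₂})))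
       × ((Z ≡ ⊥) Data.Sum.⊎ (Z ≡ ⊤) Data.Sum.⊎
            (Σ (Subset n₁) λ F → IsNPCyclicFlat N₁ F × Z ≡ join F A₂ (⊤ {t₁}) (⊥ {t₂})) Data.Sum.⊎
            (Σ (Subset n₂) λ F → IsNPCyclicFlat N₂ F × Z ≡ join A₁ F (⊥ {t₁}) (⊤ {t₂}))
          → IsCyclicFlat M Z))
  × rk M ⊥ ≡ 0
  × rk M ⊤ ≡ k
  × (∀ F → IsNPCyclicFlat N₁ F → rk M (join F A₂ (⊤ {t₁}) (⊥ {t₂})) ≡ rk N₁ F + t₁ + ∣ A₂ ∣)
  × (∀ F → IsNPCyclicFlat N₂ F → rk M (join A₁ F (⊥ {t₁}) (⊤ {t₂})) ≡ rk N₂ F + t₂ + ∣ A₁ ∣)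
  where import Data.Sum

{-# OPTIONS --safe #-}

-- Every rank function is the minimum of ρ(Z) + |X - Z| over its cyclic flats Z.
-- For M = M_k(N₁,A₁,U₁;N₂,A₂,U₂) this says that the rank of X is the least of |X|, k,
--   r₁(X ∩ R₁) + |U₁| + |A₂ ∪ (X ∩ R₂)| + |X ∩ U₂|   and
--   r₂(X ∩ R₂) + |U₂| + |A₁ ∪ (X ∩ R₁)| + |X ∩ U₁|,
-- a formula which is preserved by duality, complementing A₁, A₂ and exchanging U₁, U₂.
--
-- Transversal: presentations of N₁ and N₂ by r(N₁) and r(N₂) sets combine to a
-- presentation of M.  Conversely N₁ = (M / (U₁ ∪ A₂)) | R₁, and it is presented by the
-- members of a presentation of M that avoid U₁ ∪ A₂ together with copies of R₁,
-- because U₁ ∪ A₂ completes each circuit of N₁ to a circuit of M.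
-- Cotransversal: apply this to the dual.
-- Gammoid: N₁ and N₂ are minors of M; conversely, if N_i = T_i / C_i then M is a
-- contraction of the same construction applied to T₁ and T₂.
module Submission where

open import Defs
open import Algebra.Properties.CommutativeSemigroup using (interchange)
open import Data.Bool using (Bool; true; false; _∧_; _∨_; not; T; if_then_else_)
open import Data.Bool.Properties using (T-∧; T-∨) renaming (_≟_ to _≟ᵇ_)
open import Data.Fin using (Fin; zero; suc; punchOut)
open import Data.Fin.Properties using (any?; punchOut-injective; punchIn-punchOut)
  renaming (_≟_ to _≟ᶠ_; suc-injective to sucᶠ-injective)
open import Data.Fin.Subset using (Subset; _∈_; _∉_; _⊆_; _∩_; _∪_; ∁; ⊥; ⊤; ∣_∣; ⁅_⁆; Empty; Nonempty)
open import Data.Fin.Subset.Properties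
open import Data.List using (List; []; _∷_; length; lookup; map; replicate; tabulate) renaming (_++_ to _++ˡ_)
open import Data.List.Properties using (length-map; length-++; length-replicate; tabulate-lookup)
open import Data.Nat
open import Data.Nat.Induction using (<-rec)
open import Data.Nat.Properties
open import Data.Product using (Σ; ∃; _×_; _,_; proj₁; proj₂)
open import Data.Sum using (_⊎_; inj₁; inj₂)
open import Data.Unit using (tt)
open import Data.Vec using ([]; _∷_; _++_; drop; head; tail; take; there)
open import Data.Vec.Properties using (≡-dec; map-++; take++drop≡id; zipWith-++; ++-injectiveˡ; ++-injectiveʳ)
open import Data.Vec.Properties.WithK using ([]=-irrelevant)
open import Function using (_∘_; id)
open import Function.Bundles using (_⇔_; mk⇔; module Equivalence)
open import Relation.Binary.PropositionalEquality
open import Relation.Nullary using (Dec; yes; no; contradiction)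
open import Relation.Nullary.Decidable using (_×-dec_)

-- Linear inequalities between natural numbers and cardinalities of Boolean
-- combinations of sets, decided by comparing coefficients after splitting every
-- cardinality into Venn regions.  Sets carry the index s of their ground set.

-- Both sides of the argument are minimum formulas. The rank of X in a transversal matroid is the
-- minimum over W of |X - W| plus the number of members meeting W, so a presentation of M is
-- verified by comparing the terms of two minima, without following individual matchings. The
-- nullity hypothesis enters twice: it makes the number k - r(N₁) - r(N₂) of copies of E
-- nonnegative, and it makes A₁ ∪ A₂ independent, which is what the sets W inside A₁ ∪ A₂ require of
-- the presentation. The delicate direction is from M to N₁. A contraction of a transversal matroid
-- is a gammoid but need not be transversal, so being a minor of M settles only the gammoid case.
-- The circuits through U₁ ∪ A₂ are what confines a violator of Hall's condition. For gammoids the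
-- contracted sets C_i are first made independent. Then ranks and cardinalities both drop by |C_i|
-- under contraction, and all four terms of the rank formula shift by the same amount; for a
-- dependent C_i they would shift differently.

infix  10 #_
infixr 9 _⋒_
infixr 8 _⋓_
infixl 7 _⊕_
infix  6 _≲_ _≈_ _⊑_ _≐_
infix  4 _⊢_

data SetExp (s : ℕ) : Set where
  set     : ℕ → SetExp s
  _⋒_ _⋓_ : SetExp s → SetExp s → SetExp s
  ∁′      : SetExp s → SetExp s
  ⊤′ ⊥′   : SetExp s

data NumExp : Set where
  num  : ℕ → NumExp
  lit  : ℕ → NumExp
  _⊕_  : NumExp → NumExp → NumExp
  #_   : ∀ {s} → SetExp s → NumExp

data Formula : Set where
  _≲_ _≈_ : NumExp → NumExp → Formula
  _⊑_ _≐_ : ∀ {s} → SetExp s → SetExp s → Formula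

data Sequent : Set where
  _⊢_ : List Formula → Formula → Sequent

SetEnv : Set
SetEnv = List (Σ ℕ λ n → List (Subset n))

nth : ∀ {a} {A : Set a} → A → List A → ℕ → A
nth d []       _       = d
nth d (x ∷ xs) zero    = x
nth d (x ∷ xs) (suc i) = nth d xs i

⟦_⟧ˢ : ∀ {s n} → SetExp s → List (Subset n) → Subset n
⟦ set i ⟧ˢ ρ = nth ⊥ ρ i
⟦ e ⋒ f ⟧ˢ ρ = ⟦ e ⟧ˢ ρ ∩ ⟦ f ⟧ˢ ρ
⟦ e ⋓ f ⟧ˢ ρ = ⟦ e ⟧ˢ ρ ∪ ⟦ f ⟧ˢ ρ
⟦ ∁′ e ⟧ˢ  ρ = ∁ (⟦ e ⟧ˢ ρ)
⟦ ⊤′ ⟧ˢ    ρ = ⊤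
⟦ ⊥′ ⟧ˢ    ρ = ⊥

ground : SetEnv → ℕ → Σ ℕ λ n → List (Subset n)
ground = nth (0 , [])

⟦_⟧ : NumExp → List ℕ → SetEnv → ℕ
⟦ num i ⟧      xs ρ = nth 0 xs i
⟦ lit n ⟧      xs ρ = n
⟦ e ⊕ f ⟧      xs ρ = ⟦ e ⟧ xs ρ + ⟦ f ⟧ xs ρ
⟦ #_ {s} e ⟧   xs ρ = ∣ ⟦ e ⟧ˢ (proj₂ (ground ρ s)) ∣

Holds : Formula → List ℕ → SetEnv → Set
Holds (e ≲ f)       xs ρ = ⟦ e ⟧ xs ρ ≤ ⟦ f ⟧ xs ρ
Holds (e ≈ f)       xs ρ = ⟦ e ⟧ xs ρ ≡ ⟦ f ⟧ xs ρ
Holds (_⊑_ {s} e f) xs ρ = ⟦ e ⟧ˢ (proj₂ (ground ρ s)) ⊆ ⟦ f ⟧ˢ (proj₂ (ground ρ s))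
Holds (_≐_ {s} e f) xs ρ = ⟦ e ⟧ˢ (proj₂ (ground ρ s)) ≡ ⟦ f ⟧ˢ (proj₂ (ground ρ s))

bit : Bool → ℕ
bit b = if b then 1 else 0

⟦_⟧ᵇ : ∀ {s} → SetExp s → List Bool → Bool
⟦ set i ⟧ᵇ p = nth false p i
⟦ e ⋒ f ⟧ᵇ p = ⟦ e ⟧ᵇ p ∧ ⟦ f ⟧ᵇ p
⟦ e ⋓ f ⟧ᵇ p = ⟦ e ⟧ᵇ p ∨ ⟦ f ⟧ᵇ p
⟦ ∁′ e ⟧ᵇ  p = not (⟦ e ⟧ᵇ p)
⟦ ⊤′ ⟧ᵇ    p = true
⟦ ⊥′ ⟧ᵇ    p = false

-- A point of the ground set matters only through its membership pattern in the listed sets.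
-- Cardinalities become sums over points, and an inequality that holds for every pattern holds for
-- the sums.
sumPts : ∀ {n} → List (Subset n) → (List Bool → ℕ) → ℕ
sumPts {zero}  ρ f = 0
sumPts {suc n} ρ f = f (map head ρ) + sumPts (map tail ρ) f

eval-∷ : ∀ {s n} (e : SetExp s) (ρ : List (Subset (suc n))) →
         ⟦ e ⟧ˢ ρ ≡ ⟦ e ⟧ᵇ (map head ρ) ∷ ⟦ e ⟧ˢ (map tail ρ)
eval-∷ (set i) [] = refl
eval-∷ (set zero) ((_ ∷ _) ∷ ρ) = refl
eval-∷ {s} (set (suc i)) (_ ∷ ρ) = eval-∷ {s} (set i) ρ
eval-∷ (e ⋒ f) ρ = cong₂ _∩_ (eval-∷ e ρ) (eval-∷ f ρ)
eval-∷ (e ⋓ f) ρ = cong₂ _∪_ (eval-∷ e ρ) (eval-∷ f ρ)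
eval-∷ (∁′ e)  ρ = cong ∁ (eval-∷ e ρ)
eval-∷ ⊤′      ρ = refl
eval-∷ ⊥′      ρ = refl

∣∷∣ : ∀ {n} b (X : Subset n) → ∣ b ∷ X ∣ ≡ bit b + ∣ X ∣
∣∷∣ true  X = refl
∣∷∣ false X = refl

card-pts : ∀ {s n} (e : SetExp s) (ρ : List (Subset n)) →
           ∣ ⟦ e ⟧ˢ ρ ∣ ≡ sumPts ρ (bit ∘ ⟦ e ⟧ᵇ)
card-pts {n = zero}  e ρ with ⟦ e ⟧ˢ ρ
... | [] = refl
card-pts {n = suc n} e ρ = trans (cong ∣_∣ (eval-∷ e ρ))
  (trans (∣∷∣ (⟦ e ⟧ᵇ (map head ρ)) (⟦ e ⟧ˢ (map tail ρ))) (cong (bit (⟦ e ⟧ᵇ (map head ρ)) +_) (card-pts e (map tail ρ))))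

sumPts-0 : ∀ {n} (ρ : List (Subset n)) → sumPts ρ (λ _ → 0) ≡ 0
sumPts-0 {zero}  ρ = refl
sumPts-0 {suc n} ρ = sumPts-0 (map tail ρ)

sumPts-+ : ∀ {n} (ρ : List (Subset n)) f g →
           sumPts ρ (λ p → f p + g p) ≡ sumPts ρ f + sumPts ρ g
sumPts-+ {zero}  ρ f g = refl
sumPts-+ {suc n} ρ f g = trans (cong (f (map head ρ) + g (map head ρ) +_) (sumPts-+ (map tail ρ) f g))
  (interchange +-commutativeSemigroup (f (map head ρ)) (g (map head ρ)) _ _)

everywhere : ℕ → (List Bool → Bool) → Bool
everywhere zero    t = t []
everywhere (suc k) t = everywhere k (t ∘ (true ∷_)) ∧ everywhere k (t ∘ (false ∷_))

everywhere-sound : ∀ {n} k t → T (everywhere k t) → (ρ : List (Subset (suc n))) → length ρ ≡ k →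
                   T (t (map head ρ))
everywhere-sound zero t ok [] eq = ok
everywhere-sound (suc k) t ok ((true ∷ _) ∷ ρ) eq =
  everywhere-sound k _ (proj₁ (Equivalence.to T-∧ ok)) ρ (suc-injective eq)
everywhere-sound (suc k) t ok ((false ∷ _) ∷ ρ) eq =
  everywhere-sound k _ (proj₂ (Equivalence.to (T-∧ {everywhere k (t ∘ (true ∷_))}) ok)) ρ (suc-injective eq)

length-tail : ∀ {n} (ρ : List (Subset (suc n))) → length (map tail ρ) ≡ length ρ
length-tail []      = refl
length-tail (_ ∷ ρ) = cong suc (length-tail ρ)

sumPts-mono : ∀ {n} k (ρ : List (Subset n)) f g → length ρ ≡ k →
              T (everywhere k (λ p → f p ≤ᵇ g p)) → sumPts ρ f ≤ sumPts ρ g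
sumPts-mono {zero}  k ρ f g eq ok = z≤n
sumPts-mono {suc n} k ρ f g eq ok =
  +-mono-≤ (≤ᵇ⇒≤ _ _ (everywhere-sound k _ ok ρ eq))
           (sumPts-mono k (map tail ρ) f g (trans (length-tail ρ) eq) ok)

sumSets : SetEnv → (ℕ → List Bool → ℕ) → ℕ
sumSets []            f = 0
sumSets ((_ , ρ) ∷ σ) f = sumPts ρ (f 0) + sumSets σ (f ∘ suc)

sumNums : List ℕ → (ℕ → ℕ) → ℕ
sumNums []       f = 0
sumNums (x ∷ xs) f = f 0 * x + sumNums xs (f ∘ suc)

constant : NumExp → ℕ
constant (num i) = 0
constant (lit n) = n
constant (e ⊕ f) = constant e + constant f
constant (# e)   = 0

numCoeff : NumExp → ℕ → ℕ
numCoeff (num i) j = bit (i ≡ᵇ j)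
numCoeff (lit n) j = 0
numCoeff (e ⊕ f) j = numCoeff e j + numCoeff f j
numCoeff (# e)   j = 0

region : NumExp → ℕ → List Bool → ℕ
region (num i)    s p = 0
region (lit n)    s p = 0
region (e ⊕ f)    s p = region e s p + region f s p
region (#_ {t} e) s p = if t ≡ᵇ s then bit (⟦ e ⟧ᵇ p) else 0

sumSets-0 : ∀ σ → sumSets σ (λ _ _ → 0) ≡ 0
sumSets-0 []            = refl
sumSets-0 ((_ , ρ) ∷ σ) = cong₂ _+_ (sumPts-0 ρ) (sumSets-0 σ)

sumSets-+ : ∀ σ f g → sumSets σ (λ s p → f s p + g s p) ≡ sumSets σ f + sumSets σ g
sumSets-+ []            f g = refl
sumSets-+ ((_ , ρ) ∷ σ) f g = trans (cong₂ _+_ (sumPts-+ ρ (f 0) (g 0)) (sumSets-+ σ (f ∘ suc) (g ∘ suc)))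
  (interchange +-commutativeSemigroup (sumPts ρ (f 0)) (sumPts ρ (g 0)) _ _)

sumSets-# : ∀ {s} t (e : SetExp s) σ →
  ∣ ⟦ e ⟧ˢ (proj₂ (ground σ t)) ∣ ≡ sumSets σ (λ u p → if t ≡ᵇ u then bit (⟦ e ⟧ᵇ p) else 0)
sumSets-# t e [] with ⟦ e ⟧ˢ (proj₂ (ground [] t))
... | [] = refl
sumSets-# zero e ((_ , ρ) ∷ σ) = trans (card-pts e ρ)
  (sym (trans (cong (sumPts ρ _ +_) (sumSets-0 σ)) (+-identityʳ _)))
sumSets-# (suc t) e ((_ , ρ) ∷ σ) = trans (sumSets-# t e σ)
  (cong (_+ sumSets σ (λ u p → if t ≡ᵇ u then bit (⟦ e ⟧ᵇ p) else 0)) (sym (sumPts-0 ρ)))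

sumNums-0 : ∀ xs → sumNums xs (λ _ → 0) ≡ 0
sumNums-0 []       = refl
sumNums-0 (x ∷ xs) = sumNums-0 xs

sumNums-+ : ∀ xs f g → sumNums xs (λ j → f j + g j) ≡ sumNums xs f + sumNums xs g
sumNums-+ []       f g = refl
sumNums-+ (x ∷ xs) f g = trans (cong₂ _+_ (*-distribʳ-+ x (f 0) (g 0)) (sumNums-+ xs (f ∘ suc) (g ∘ suc)))
  (interchange +-commutativeSemigroup (f 0 * x) (g 0 * x) _ _)

sumNums-num : ∀ i xs → nth 0 xs i ≡ sumNums xs (λ j → bit (i ≡ᵇ j))
sumNums-num i       []       = refl
sumNums-num zero    (x ∷ xs) = sym (trans (cong (x + 0 +_) (sumNums-0 xs)) (trans (+-identityʳ _) (+-identityʳ x)))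
sumNums-num (suc i) (x ∷ xs) = sumNums-num i xs

expand : ∀ e xs σ → ⟦ e ⟧ xs σ ≡ constant e + (sumNums xs (numCoeff e) + sumSets σ (region e))
expand (num i) xs σ = trans (sumNums-num i xs)
  (sym (trans (cong (sumNums xs _ +_) (sumSets-0 σ)) (+-identityʳ _)))
expand (lit n) xs σ = sym (trans (cong₂ (λ a b → n + (a + b)) (sumNums-0 xs) (sumSets-0 σ)) (+-identityʳ n))
expand (e ⊕ f) xs σ = trans (cong₂ _+_ (expand e xs σ) (expand f xs σ))
  (trans (interchange +-commutativeSemigroup (constant e) _ (constant f) _)
  (cong (constant e + constant f +_)
    (trans (interchange +-commutativeSemigroup (sumNums xs (numCoeff e)) _ (sumNums xs (numCoeff f)) _)
      (sym (cong₂ _+_ (sumNums-+ xs (numCoeff e) (numCoeff f)) (sumSets-+ σ (region e) (region f)))))))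
expand (#_ {s} e) xs σ = trans (sumSets-# s e σ) (cong (_+ sumSets σ (region (# e))) (sym (sumNums-0 xs)))

numsBelow : ℕ → (ℕ → ℕ) → (ℕ → ℕ) → Bool
numsBelow zero    f g = true
numsBelow (suc v) f g = (f 0 ≤ᵇ g 0) ∧ numsBelow v (f ∘ suc) (g ∘ suc)

numsBelow-sound : ∀ v f g → T (numsBelow v f g) → ∀ xs → length xs ≡ v → sumNums xs f ≤ sumNums xs g
numsBelow-sound zero f g ok [] eq = z≤n
numsBelow-sound (suc v) f g ok (x ∷ xs) eq =
  let ok₁ , ok₂ = Equivalence.to (T-∧ {f 0 ≤ᵇ g 0}) ok in
  +-mono-≤ (*-monoˡ-≤ x (≤ᵇ⇒≤ (f 0) (g 0) ok₁)) (numsBelow-sound v _ _ ok₂ xs (suc-injective eq))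

shape : SetEnv → List ℕ
shape []            = []
shape ((_ , ρ) ∷ σ) = length ρ ∷ shape σ

setsBelow : List ℕ → (ℕ → List Bool → ℕ) → (ℕ → List Bool → ℕ) → Bool
setsBelow []       f g = true
setsBelow (k ∷ ks) f g = everywhere k (λ p → f 0 p ≤ᵇ g 0 p) ∧ setsBelow ks (f ∘ suc) (g ∘ suc)

setsBelow-sound : ∀ ks f g → T (setsBelow ks f g) → ∀ σ → shape σ ≡ ks → sumSets σ f ≤ sumSets σ g
setsBelow-sound .[] f g ok [] refl = z≤n
setsBelow-sound ._ f g ok ((_ , ρ) ∷ σ) refl =
  let ok₁ , ok₂ = Equivalence.to (T-∧ {everywhere (length ρ) (λ p → f 0 p ≤ᵇ g 0 p)}) ok in
  +-mono-≤ (sumPts-mono _ ρ (f 0) (g 0) refl ok₁) (setsBelow-sound _ _ _ ok₂ σ refl)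

-- Number variables and sizes of Venn regions are nonnegative, so domination of each coefficient is
-- sufficient. It is only a sufficient test; the hypotheses have been moved into e and f beforehand.
below : List ℕ → ℕ → NumExp → NumExp → Bool
below ks v e f = (constant e ≤ᵇ constant f) ∧ (numsBelow v (numCoeff e) (numCoeff f) ∧ setsBelow ks (region e) (region f))

below-sound : ∀ ks v e f → T (below ks v e f) → ∀ xs σ → length xs ≡ v → shape σ ≡ ks →
              ⟦ e ⟧ xs σ ≤ ⟦ f ⟧ xs σ
below-sound ks v e f ok xs σ eq eq′ =
  let ok₁ , ok′ = Equivalence.to (T-∧ {constant e ≤ᵇ constant f}) ok
      ok₂ , ok₃ = Equivalence.to (T-∧ {numsBelow v (numCoeff e) (numCoeff f)}) ok′ in
  subst₂ _≤_ (sym (expand e xs σ)) (sym (expand f xs σ))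
    (+-mono-≤ (≤ᵇ⇒≤ (constant e) (constant f) ok₁) (+-mono-≤ (numsBelow-sound v _ _ ok₂ xs eq) (setsBelow-sound ks _ _ ok₃ σ eq′)))

gap symgap : ∀ {s} → SetExp s → SetExp s → NumExp
gap e f    = # (e ⋒ ∁′ f)
symgap e f = # ((e ⋒ ∁′ f) ⋓ (f ⋒ ∁′ e))

-- An inclusion hypothesis says that a cardinality vanishes, so it may be used
-- with any multiplicity.
six : NumExp → NumExp
six e = e ⊕ e ⊕ e ⊕ e ⊕ e ⊕ e

-- A hypothesis l ≤ r is applied by replacing the goal e ≤ f with e + r ≤ f + l, from which the old
-- goal follows by cancelling r. The direction of an equation is found by trying both.
derives : List ℕ → ℕ → List Formula → NumExp → NumExp → Bool
derives ks v []            e f = below ks v e f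
derives ks v (l ≲ r ∷ hs)  e f = derives ks v hs (e ⊕ r) (f ⊕ l)
derives ks v (l ≈ r ∷ hs)  e f = derives ks v hs (e ⊕ r) (f ⊕ l) ∨ derives ks v hs (e ⊕ l) (f ⊕ r)
derives ks v (a ⊑ b ∷ hs)  e f = derives ks v hs (e ⊕ lit 0) (f ⊕ six (gap a b))
derives ks v (a ≐ b ∷ hs)  e f = derives ks v hs (e ⊕ lit 0) (f ⊕ six (symgap a b))

∣X∣≤0⇒∉ : ∀ {n} (X : Subset n) → ∣ X ∣ ≤ 0 → Empty X
∣X∣≤0⇒∉ X le (x , x∈X) = n≮n 0 (≤-trans (subst (_≤ ∣ X ∣) (∣⁅x⁆∣≡1 x)
  (p⊆q⇒∣p∣≤∣q∣ λ y∈ → subst (_∈ X) (sym (x∈⁅y⁆⇒x≡y x y∈)) x∈X)) le)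

gap≤0⇒⊆ : ∀ {n} (X Y : Subset n) → ∣ X ∩ ∁ Y ∣ ≤ 0 → X ⊆ Y
gap≤0⇒⊆ X Y le {x} x∈X with x ∈? Y
... | yes x∈Y = x∈Y
... | no  x∉Y = contradiction (x , x∈p∩q⁺ (x∈X , x∉p⇒x∈∁p x∉Y)) (∣X∣≤0⇒∉ (X ∩ ∁ Y) le)

⊆⇒gap≤0 : ∀ {n} (X Y : Subset n) → X ⊆ Y → ∣ X ∩ ∁ Y ∣ ≤ 0
⊆⇒gap≤0 {n} X Y X⊆Y = ≤-reflexive (trans (cong ∣_∣ (Empty-unique {p = X ∩ ∁ Y}
  λ (x , x∈) → let x∈X , x∈∁Y = x∈p∩q⁻ X (∁ Y) x∈ in x∈∁p⇒x∉p x∈∁Y (X⊆Y x∈X))) (∣⊥∣≡0 n))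

symgap≤0⇒≡ : ∀ {n} (X Y : Subset n) → ∣ (X ∩ ∁ Y) ∪ (Y ∩ ∁ X) ∣ ≤ 0 → X ≡ Y
symgap≤0⇒≡ X Y le = ⊆-antisym
  (gap≤0⇒⊆ X Y (≤-trans (∣p∣≤∣p∪q∣ (X ∩ ∁ Y) (Y ∩ ∁ X)) le))
  (gap≤0⇒⊆ Y X (≤-trans (∣q∣≤∣p∪q∣ (X ∩ ∁ Y) (Y ∩ ∁ X)) le))

≡⇒symgap≤0 : ∀ {n} (X Y : Subset n) → X ≡ Y → ∣ (X ∩ ∁ Y) ∪ (Y ∩ ∁ X) ∣ ≤ 0
≡⇒symgap≤0 X .X refl = ≤-trans (⊆-card (∪-idem (X ∩ ∁ X))) (⊆⇒gap≤0 X X λ x∈ → x∈)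
  where
  ⊆-card : ∀ {Y Z} → Y ≡ Z → ∣ Y ∣ ≤ ∣ Z ∣
  ⊆-card = ≤-reflexive ∘ cong ∣_∣

six≤0 : ∀ {n} → n ≤ 0 → n + n + n + n + n + n ≤ 0
six≤0 z≤n = z≤n

cancel-hyp : ∀ {a b l r} → l ≤ r → a + r ≤ b + l → a ≤ b
cancel-hyp {a} {b} {l} {r} l≤r le = +-cancelʳ-≤ r a b (≤-trans le (+-monoʳ-≤ b l≤r))

Implies : List Formula → Set → List ℕ → SetEnv → Set
Implies []       P xs σ = P
Implies (h ∷ hs) P xs σ = Holds h xs σ → Implies hs P xs σ

map-Implies : ∀ hs {P Q : Set} xs σ → (P → Q) → Implies hs P xs σ → Implies hs Q xs σ
map-Implies []       xs σ f p = f p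
map-Implies (h ∷ hs) xs σ f p = λ hyp → map-Implies hs xs σ f (p hyp)

derives-sound : ∀ ks v hs e f → T (derives ks v hs e f) →
                ∀ xs σ → length xs ≡ v → shape σ ≡ ks →
                Implies hs (⟦ e ⟧ xs σ ≤ ⟦ f ⟧ xs σ) xs σ
derives-sound ks v [] e f ok xs σ eq eq′ = below-sound ks v e f ok xs σ eq eq′
derives-sound ks v (l ≲ r ∷ hs) e f ok xs σ eq eq′ hyp =
  map-Implies hs xs σ (cancel-hyp hyp) (derives-sound ks v hs _ _ ok xs σ eq eq′)
derives-sound ks v (l ≈ r ∷ hs) e f ok xs σ eq eq′ hyp with Equivalence.to (T-∨ {derives ks v hs (e ⊕ r) (f ⊕ l)}) ok
... | inj₁ ok₁ = map-Implies hs xs σ (cancel-hyp (≤-reflexive hyp)) (derives-sound ks v hs _ _ ok₁ xs σ eq eq′)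
... | inj₂ ok₂ = map-Implies hs xs σ (cancel-hyp (≤-reflexive (sym hyp))) (derives-sound ks v hs _ _ ok₂ xs σ eq eq′)
derives-sound ks v (_⊑_ {s} a b ∷ hs) e f ok xs σ eq eq′ hyp =
  map-Implies hs xs σ (cancel-hyp (six≤0 (⊆⇒gap≤0 (⟦ a ⟧ˢ ρ) (⟦ b ⟧ˢ ρ) hyp)))
    (derives-sound ks v hs _ _ ok xs σ eq eq′)
  where ρ = proj₂ (ground σ s)
derives-sound ks v (_≐_ {s} a b ∷ hs) e f ok xs σ eq eq′ hyp =
  map-Implies hs xs σ (cancel-hyp (six≤0 (≡⇒symgap≤0 (⟦ a ⟧ˢ ρ) (⟦ b ⟧ˢ ρ) hyp)))
    (derives-sound ks v hs _ _ ok xs σ eq eq′)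
  where ρ = proj₂ (ground σ s)

provable : List ℕ → ℕ → Sequent → Bool
provable ks v (hs ⊢ e ≲ f) = derives ks v hs e f
provable ks v (hs ⊢ e ≈ f) = derives ks v hs e f ∧ derives ks v hs f e
provable ks v (hs ⊢ a ⊑ b) = derives ks v hs (gap a b) (lit 0)
provable ks v (hs ⊢ a ≐ b) = derives ks v hs (symgap a b) (lit 0)

Valid : Sequent → List ℕ → SetEnv → Set
Valid (hs ⊢ g) xs σ = Implies hs (Holds g xs σ) xs σ

merge-Implies : ∀ hs {P Q R : Set} xs σ → (P → Q → R) → Implies hs P xs σ → Implies hs Q xs σ → Implies hs R xs σ
merge-Implies []       xs σ f p q = f p q
merge-Implies (h ∷ hs) xs σ f p q = λ hyp → merge-Implies hs xs σ f (p hyp) (q hyp)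

provable-sound : ∀ ks v q → T (provable ks v q) →
                 ∀ xs σ → length xs ≡ v → shape σ ≡ ks → Valid q xs σ
provable-sound ks v (hs ⊢ e ≲ f) ok = derives-sound ks v hs e f ok
provable-sound ks v (hs ⊢ e ≈ f) ok xs σ eq eq′ =
  let ok₁ , ok₂ = Equivalence.to (T-∧ {derives ks v hs e f}) ok in
  merge-Implies hs xs σ ≤-antisym (derives-sound ks v hs e f ok₁ xs σ eq eq′) (derives-sound ks v hs f e ok₂ xs σ eq eq′)
provable-sound ks v (hs ⊢ a ⊑ b) ok xs σ eq eq′ =
  map-Implies hs xs σ (λ le {x} → gap≤0⇒⊆ _ _ le {x}) (derives-sound ks v hs (gap a b) (lit 0) ok xs σ eq eq′)
provable-sound ks v (hs ⊢ a ≐ b) ok xs σ eq eq′ =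
  map-Implies hs xs σ (symgap≤0⇒≡ _ _) (derives-sound ks v hs (symgap a b) (lit 0) ok xs σ eq eq′)

-- Sequents with named variables

BindSets : ℕ → ℕ → Set → Set
BindSets s zero    A = A
BindSets s (suc k) A = SetExp s → BindSets s k A

BindNums : ℕ → Set → Set
BindNums zero    A = A
BindNums (suc v) A = NumExp → BindNums v A

-- Variables are bound by functions so that each use can name them; `name` then feeds in consecutive
-- indices, with a fresh index s for each ground set.
Bind : ℕ → List ℕ → ℕ → Set
Bind s []       v = BindNums v Sequent
Bind s (k ∷ ks) v = BindSets s k (Bind (suc s) ks v)

nameSets : ∀ s i k {A} → BindSets s k A → A
nameSets s i zero    f = f
nameSets s i (suc k) f = nameSets s (suc i) k (f (set i))

nameNums : ∀ i v {A} → BindNums v A → A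
nameNums i zero    f = f
nameNums i (suc v) f = nameNums (suc i) v (f (num i))

name : ∀ s ks v → Bind s ks v → Sequent
name s []       v f = nameNums 0 v f
name s (k ∷ ks) v f = name (suc s) ks v (nameSets s 0 k f)

∀Nums : ℕ → (List ℕ → Set) → Set
∀Nums zero    P = P []
∀Nums (suc v) P = (x : ℕ) → ∀Nums v (P ∘ (x ∷_))

∀Sets : ∀ {n} → ℕ → (List (Subset n) → Set) → Set
∀Sets     zero    P = P []
∀Sets {n} (suc k) P = (X : Subset n) → ∀Sets k (P ∘ (X ∷_))

∀Env : List ℕ → (SetEnv → Set) → Set
∀Env []       P = P []
∀Env (k ∷ ks) P = ∀ {n} → ∀Sets {n} k λ ρ → ∀Env ks λ σ → P ((n , ρ) ∷ σ)

∀Nums-intro : ∀ v P → (∀ xs → length xs ≡ v → P xs) → ∀Nums v P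
∀Nums-intro zero    P f = f [] refl
∀Nums-intro (suc v) P f = λ x → ∀Nums-intro v (P ∘ (x ∷_)) λ xs eq → f (x ∷ xs) (cong suc eq)

∀Sets-intro : ∀ {n} k (P : List (Subset n) → Set) → (∀ ρ → length ρ ≡ k → P ρ) → ∀Sets k P
∀Sets-intro zero    P f = f [] refl
∀Sets-intro (suc k) P f = λ X → ∀Sets-intro k (P ∘ (X ∷_)) λ ρ eq → f (X ∷ ρ) (cong suc eq)

∀Env-intro : ∀ ks P → (∀ σ → shape σ ≡ ks → P σ) → ∀Env ks P
∀Env-intro []       P f = f [] refl
∀Env-intro (k ∷ ks) P f {n} = ∀Sets-intro k (λ ρ → ∀Env ks λ σ → P ((n , ρ) ∷ σ)) λ ρ eq →
  ∀Env-intro ks (λ σ → P ((n , ρ) ∷ σ)) λ σ eq′ → f ((n , ρ) ∷ σ) (cong₂ _∷_ eq eq′)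

-- ks lists the numbers of set variables over each ground set and v is the number
-- of natural number variables.  Each inequality is used exactly once and each
-- equation exactly once, in either direction.
abstract
  arith : ∀ ks v (f : Bind 0 ks v) {ok : T (provable ks v (name 0 ks v f))} →
          ∀Env ks λ σ → ∀Nums v λ xs → Valid (name 0 ks v f) xs σ
  arith ks v f {ok} = ∀Env-intro ks _ λ σ eq′ → ∀Nums-intro v _ λ xs eq →
    provable-sound ks v (name 0 ks v f) ok xs σ eq eq′

-- Matroids: bases, circuits and cyclic flats

⁅x⁆⊆ : ∀ {n} {x : Fin n} {X} → x ∈ X → ⁅ x ⁆ ⊆ X
⁅x⁆⊆ {x = x} {X} x∈X y∈ = subst (_∈ X) (sym (x∈⁅y⁆⇒x≡y x y∈)) x∈X

⁅x⁆⊆∁ : ∀ {n} {x : Fin n} {X} → x ∉ X → ⁅ x ⁆ ⊆ ∁ X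
⁅x⁆⊆∁ x∉X = ⁅x⁆⊆ (x∉p⇒x∈∁p x∉X)

subset-induction : ∀ {n} (P : Subset n → Set) → P ⊥ →
                   (∀ X x → x ∉ X → P X → P (X ∪ ⁅ x ⁆)) → ∀ X → P X
subset-induction P base step [] = base
subset-induction {suc n} P base step (b ∷ X) with
  subset-induction (P ∘ (false ∷_)) base (λ Y x x∉Y → step (false ∷ Y) (suc x) (x∉Y ∘ drop-there)) X
... | PX with b
...   | false = PX
...   | true  = subst (P ∘ (true ∷_)) (∪-identityʳ X) (step (false ∷ X) zero (λ ()) PX)

abstract
  argmin : ∀ {n} {P : Subset n → Set} → (∀ X → Dec (P X)) → (μ : Subset n → ℕ) → ∃ P →
           ∃ λ X → P X × ∀ Y → P Y → μ X ≤ μ Y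
  argmin {n} {P} P? μ (X₀ , PX₀) = <-rec Goal search (μ X₀) X₀ refl PX₀
    where
    Goal : ℕ → Set
    Goal m = ∀ X → μ X ≡ m → P X → ∃ λ X → P X × ∀ Y → P Y → μ X ≤ μ Y
    search : ∀ m → (∀ {k} → k < m → Goal k) → Goal m
    search m rec X refl PX with anySubset? (λ Y → P? Y ×-dec (μ Y <? μ X))
    ... | yes (Y , PY , lt) = rec lt Y refl PY
    ... | no  none            = X , PX , λ Y PY → ≮⇒≥ λ lt → none (Y , PY , lt)

module _ {n} (M : Matroid n) where
  private r = rk M

  rk-⊥ : r ⊥ ≡ 0
  rk-⊥ = n≤0⇒n≡0 (subst (r ⊥ ≤_) (∣⊥∣≡0 n) (rk-bound M ⊥))

  -- Submodularity for Y and X - Y, with the term of the intersection dropped and r(X - Y) bounded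
  -- by the cardinality.
  rk-diff : ∀ X Y → r X ≤ r Y + ∣ X ∩ ∁ Y ∣
  rk-diff X Y = arith (2 ∷ []) 5
    (λ X Y x y i j k → x ≲ i ∷ i ⊕ j ≲ y ⊕ k ∷ k ≲ # (X ⋒ ∁′ Y) ∷ [] ⊢ x ≲ y ⊕ # (X ⋒ ∁′ Y))
    X Y (r X) (r Y) (r (Y ∪ (X ∩ ∁ Y))) (r (Y ∩ (X ∩ ∁ Y))) (r (X ∩ ∁ Y))
    (rk-mono M (arith (2 ∷ []) 0 (λ X Y → [] ⊢ X ⊑ Y ⋓ (X ⋒ ∁′ Y)) X Y))
    (rk-submod M Y (X ∩ ∁ Y)) (rk-bound M _)

  rk≤rank : ∀ X → r X ≤ rank M
  rk≤rank X = rk-mono M ⊆⊤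

  indep-⊆ : ∀ {X Y} → X ⊆ Y → Independent M Y → Independent M X
  indep-⊆ {X} {Y} X⊆Y ind = ≤-antisym (rk-bound M X) (arith (2 ∷ []) 2
    (λ X Y x y → X ⊑ Y ∷ y ≈ # Y ∷ y ≲ x ⊕ # (Y ⋒ ∁′ X) ∷ [] ⊢ # X ≲ x)
    X Y (r X) (r Y) X⊆Y ind (rk-diff Y X))

  nullity-mono : ∀ {X Y} → X ⊆ Y → ∣ X ∣ + r Y ≤ ∣ Y ∣ + r X
  nullity-mono {X} {Y} X⊆Y = arith (2 ∷ []) 2
    (λ X Y x y → X ⊑ Y ∷ y ≲ x ⊕ # (Y ⋒ ∁′ X) ∷ [] ⊢ # X ⊕ y ≲ # Y ⊕ x) X Y (r X) (r Y) X⊆Y (rk-diff Y X)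

  basis : ∀ X → ∃ λ I → I ⊆ X × Independent M I × r I ≡ r X
  basis = subset-induction _ (⊥ , ⊆-refl , trans rk-⊥ (sym (∣⊥∣≡0 n)) , refl) extend
    where
    extend : ∀ X x → x ∉ X → (∃ λ I → I ⊆ X × Independent M I × r I ≡ r X) →
             ∃ λ I → I ⊆ X ∪ ⁅ x ⁆ × Independent M I × r I ≡ r (X ∪ ⁅ x ⁆)
    extend X x x∉X (I , I⊆X , ind , eq) with r (X ∪ ⁅ x ⁆) ≤? r X
    ... | yes le = I , p⊆p∪q ⁅ x ⁆ ∘ I⊆X , ind , trans eq (≤-antisym (rk-mono M (p⊆p∪q ⁅ x ⁆)) le)
    ... | no  gt = I ∪ ⁅ x ⁆ , Ix⊆Xx , ≤-antisym (rk-bound M _) card≤ , ≤-antisym (rk-mono M Ix⊆Xx) rk≤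
      where
      Ix⊆Xx : I ∪ ⁅ x ⁆ ⊆ X ∪ ⁅ x ⁆
      Ix⊆Xx = arith (3 ∷ []) 0 (λ I X x → I ⊑ X ∷ [] ⊢ I ⋓ x ⊑ X ⋓ x) I X ⁅ x ⁆ I⊆X
      -- Diminishing returns: x raises the rank of X by at most as much as it raises that of the
      -- smaller set I.
      submod : r (X ∪ ⁅ x ⁆) + r I ≤ r (I ∪ ⁅ x ⁆) + r X
      submod = ≤-trans (+-mono-≤
          (rk-mono M (arith (3 ∷ []) 0 (λ I X x → [] ⊢ X ⋓ x ⊑ (I ⋓ x) ⋓ X) I X ⁅ x ⁆))
          (rk-mono M (arith (3 ∷ []) 0 (λ I X x → I ⊑ X ∷ [] ⊢ I ⊑ (I ⋓ x) ⋒ X) I X ⁅ x ⁆ I⊆X)))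
        (rk-submod M (I ∪ ⁅ x ⁆) X)
      card≤ : ∣ I ∪ ⁅ x ⁆ ∣ ≤ r (I ∪ ⁅ x ⁆)
      card≤ = arith (2 ∷ []) 4
        (λ I x i a b c → # x ≈ lit 1 ∷ b ⊕ i ≲ c ⊕ a ∷ lit 1 ⊕ a ≲ b ∷ i ≈ # I ∷ [] ⊢ # (I ⋓ x) ≲ c)
        I ⁅ x ⁆ (r I) (r X) (r (X ∪ ⁅ x ⁆)) (r (I ∪ ⁅ x ⁆)) (∣⁅x⁆∣≡1 x) submod (≰⇒> gt) ind
      rk≤ : r (X ∪ ⁅ x ⁆) ≤ r (I ∪ ⁅ x ⁆)
      rk≤ = arith [] 4 (λ i a b c → b ⊕ i ≲ c ⊕ a ∷ i ≈ a ∷ [] ⊢ b ≲ c)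
        (r I) (r X) (r (X ∪ ⁅ x ⁆)) (r (I ∪ ⁅ x ⁆)) submod eq

  -- Inside a basis of W, a smallest set V that spans x gives the fundamental circuit V ∪ {x}.
  circuit-through : ∀ W x → x ∉ W → r (W ∪ ⁅ x ⁆) ≤ r W →
                    ∃ λ C → IsCircuit M C × C ⊆ W ∪ ⁅ x ⁆ × x ∈ C
  circuit-through W x x∉W spanned with basis W
  ... | I , I⊆W , ind , eq with argmin
          (λ V → (V ⊆? I) ×-dec (r (V ∪ ⁅ x ⁆) ≤? r V)) ∣_∣
          (I , ⊆-refl , ≤-trans (rk-mono M (arith (3 ∷ []) 0 (λ I W x → I ⊑ W ∷ [] ⊢ I ⋓ x ⊑ W ⋓ x) I W ⁅ x ⁆ I⊆W))
                          (≤-trans spanned (≤-reflexive (sym eq))))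
  ...   | V , (V⊆I , dep) , minimal = V ∪ ⁅ x ⁆ , (dependent , proper) , C⊆ , q⊆p∪q V ⁅ x ⁆ (x∈⁅x⁆ x)
    where
    C⊆ : V ∪ ⁅ x ⁆ ⊆ W ∪ ⁅ x ⁆
    C⊆ = arith (4 ∷ []) 0 (λ I V W x → I ⊑ W ∷ V ⊑ I ∷ [] ⊢ V ⋓ x ⊑ W ⋓ x) I V W ⁅ x ⁆ I⊆W V⊆I
    x∉V : x ∉ V
    x∉V x∈V = x∉W (I⊆W (V⊆I x∈V))
    dependent : r (V ∪ ⁅ x ⁆) < ∣ V ∪ ⁅ x ⁆ ∣
    dependent = arith (2 ∷ []) 2
      (λ V x a b → x ⊑ ∁′ V ∷ # x ≈ lit 1 ∷ b ≲ a ∷ a ≲ # V ∷ [] ⊢ lit 1 ⊕ b ≲ # (V ⋓ x))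
      V ⁅ x ⁆ (r V) (r (V ∪ ⁅ x ⁆)) (⁅x⁆⊆∁ x∉V) (∣⁅x⁆∣≡1 x) dep (rk-bound M V)
    proper : ∀ Y → Y ⊆ V ∪ ⁅ x ⁆ → Y ≢ V ∪ ⁅ x ⁆ → Independent M Y
    proper Y Y⊆C Y≢C with x ∈? Y
    ... | no x∉Y = indep-⊆ (arith (4 ∷ []) 0 (λ I V Y x → x ⊑ ∁′ Y ∷ Y ⊑ V ⋓ x ∷ V ⊑ I ∷ [] ⊢ Y ⊑ I)
                     I V Y ⁅ x ⁆ (⁅x⁆⊆∁ x∉Y) Y⊆C V⊆I) ind
    -- If Y - x still spans x, then minimality of V makes Y the whole candidate; otherwise x raises
    -- the rank of an independent set, and Y is independent.
    ... | yes x∈Y with r ((Y ∩ ∁ ⁅ x ⁆) ∪ ⁅ x ⁆) ≤? r (Y ∩ ∁ ⁅ x ⁆)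
    ...   | yes le = contradiction
              (arith (3 ∷ []) 0 (λ V Y x → # V ≲ # (Y ⋒ ∁′ x) ∷ x ⊑ Y ∷ Y ⊑ V ⋓ x ∷ [] ⊢ Y ≐ V ⋓ x) V Y ⁅ x ⁆
                (minimal (Y ∩ ∁ ⁅ x ⁆) (U⊆I , le)) (⁅x⁆⊆ x∈Y) Y⊆C) Y≢C
      where
      U⊆I : Y ∩ ∁ ⁅ x ⁆ ⊆ I
      U⊆I = arith (4 ∷ []) 0 (λ I V Y x → Y ⊑ V ⋓ x ∷ V ⊑ I ∷ [] ⊢ Y ⋒ ∁′ x ⊑ I) I V Y ⁅ x ⁆ Y⊆C V⊆I
    ...   | no gt = ≤-antisym (rk-bound M Y) (arith (2 ∷ []) 3
              (λ Y x u v y → # x ≈ lit 1 ∷ x ⊑ Y ∷ u ≈ # (Y ⋒ ∁′ x) ∷ lit 1 ⊕ u ≲ v ∷ v ≲ y ∷ [] ⊢ # Y ≲ y)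
              Y ⁅ x ⁆ (r (Y ∩ ∁ ⁅ x ⁆)) (r ((Y ∩ ∁ ⁅ x ⁆) ∪ ⁅ x ⁆)) (r Y) (∣⁅x⁆∣≡1 x) (⁅x⁆⊆ x∈Y)
              (indep-⊆ (arith (4 ∷ []) 0 (λ I V Y x → Y ⊑ V ⋓ x ∷ V ⊑ I ∷ [] ⊢ Y ⋒ ∁′ x ⊑ I) I V Y ⁅ x ⁆ Y⊆C V⊆I) ind)
              (≰⇒> gt)
              (rk-mono M (arith (2 ∷ []) 0 (λ Y x → x ⊑ Y ∷ [] ⊢ (Y ⋒ ∁′ x) ⋓ x ⊑ Y) Y ⁅ x ⁆ (⁅x⁆⊆ x∈Y))))

  abstract
    -- Among the sets Z attaining r X = r Z + |X - Z|, minimising 2 r Z + |E - Z|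
    -- forbids both adding a point of the closure and deleting a coloop.
    cyclic-flat-attaining-rk : ∀ X → ∃ λ Z → IsCyclicFlat M Z × r Z + ∣ X ∩ ∁ Z ∣ ≤ r X
    cyclic-flat-attaining-rk X with argmin (λ Z → r Z + ∣ X ∩ ∁ Z ∣ ≤? r X) (λ Z → r Z + r Z + ∣ ∁ Z ∣)
      (X , arith (1 ∷ []) 1 (λ X x → [] ⊢ x ⊕ # (X ⋒ ∁′ X) ≲ x) X (r X))
    ... | Z , att , minimal = Z , (flat , cyclic) , att
      where
      flat : IsFlat M Z
      -- The measure contains the rank twice, so the rank inequality is supplied twice; the same
      -- holds for `no-coloop`, where a loss of two outweighs the one point gained by E - Z.
      flat x x∉Z = ≰⇒> λ le → n≮n 0 (arith (2 ∷ []) 2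
        (λ Z x z y → # x ≈ lit 1 ∷ x ⊑ ∁′ Z ∷ y ≲ z ∷ y ≲ z ∷ z ⊕ z ⊕ # (∁′ Z) ≲ y ⊕ y ⊕ # (∁′ (Z ⋓ x)) ∷ [] ⊢
          lit 1 ≲ lit 0)
        Z ⁅ x ⁆ (r Z) (r (Z ∪ ⁅ x ⁆)) (∣⁅x⁆∣≡1 x) (⁅x⁆⊆∁ x∉Z) le le
        (minimal (Z ∪ ⁅ x ⁆) (arith (3 ∷ []) 3
          (λ X Z x a z y → y ≲ z ∷ z ⊕ # (X ⋒ ∁′ Z) ≲ a ∷ [] ⊢ y ⊕ # (X ⋒ ∁′ (Z ⋓ x)) ≲ a)
          X Z ⁅ x ⁆ (r X) (r Z) (r (Z ∪ ⁅ x ⁆)) le att)))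
      no-coloop : ∀ x → x ∈ Z → r Z ≤ r (Z ∩ ∁ ⁅ x ⁆)
      no-coloop x x∈Z = ≮⇒≥ λ gt → n≮n 0 (arith (2 ∷ []) 2
        (λ Z x z y → # x ≈ lit 1 ∷ x ⊑ Z ∷ lit 1 ⊕ y ≲ z ∷ lit 1 ⊕ y ≲ z ∷
                     z ⊕ z ⊕ # (∁′ Z) ≲ y ⊕ y ⊕ # (∁′ (Z ⋒ ∁′ x)) ∷ [] ⊢ lit 1 ≲ lit 0)
        Z ⁅ x ⁆ (r Z) (r (Z ∩ ∁ ⁅ x ⁆)) (∣⁅x⁆∣≡1 x) (⁅x⁆⊆ x∈Z) gt gt
        (minimal (Z ∩ ∁ ⁅ x ⁆) (arith (3 ∷ []) 3
          (λ X Z x a z y → # x ≈ lit 1 ∷ lit 1 ⊕ y ≲ z ∷ z ⊕ # (X ⋒ ∁′ Z) ≲ a ∷ [] ⊢ y ⊕ # (X ⋒ ∁′ (Z ⋒ ∁′ x)) ≲ a)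
          X Z ⁅ x ⁆ (r X) (r Z) (r (Z ∩ ∁ ⁅ x ⁆)) (∣⁅x⁆∣≡1 x) gt att)))
      cyclic : IsCyclic M Z
      cyclic x x∈Z =
        let Zxx⊆Z = arith (2 ∷ []) 0 (λ Z x → x ⊑ Z ∷ [] ⊢ (Z ⋒ ∁′ x) ⋓ x ⊑ Z) Z ⁅ x ⁆ (⁅x⁆⊆ x∈Z)
            C , circ , C⊆ , x∈C = circuit-through (Z ∩ ∁ ⁅ x ⁆) x
              (λ x∈ → x∈p⇒x∉∁p (x∈⁅x⁆ x) (proj₂ (x∈p∩q⁻ Z (∁ ⁅ x ⁆) x∈)))
              (≤-trans (rk-mono M Zxx⊆Z) (no-coloop x x∈Z))
        in C , circ , (λ {y} y∈C → Zxx⊆Z (C⊆ y∈C)) , x∈C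

-- A basis of X in `M` stays independent in `N` and bounds the rank there from below.
rk≤rk : ∀ {n} (M N : Matroid n) → (∀ X → Independent M X → Independent N X) → ∀ X → rk M X ≤ rk N X
rk≤rk M N imp X with basis M X
... | I , I⊆X , ind , eq = begin
  rk M X ≡⟨ sym eq ⟩
  rk M I ≡⟨ ind ⟩
  ∣ I ∣  ≡⟨ sym (imp I ind) ⟩
  rk N I ≤⟨ rk-mono N I⊆X ⟩
  rk N X ∎
  where open ≤-Reasoning

-- Transversal presentations and Hall's theorem

meets : ∀ {n} → Subset n → Subset n → ℕ
meets A W = 1 ⊓ ∣ A ∩ W ∣

-- The size of the neighbourhood of W in the bipartite graph between points and members, as in
-- Hall's condition.
hits : ∀ {n} → List (Subset n) → Subset n → ℕ
hits []       W = 0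
hits (A ∷ As) W = meets A W + hits As W

meets≤1 : ∀ {n} (A W : Subset n) → meets A W ≤ 1
meets≤1 A W = m⊓n≤m 1 ∣ A ∩ W ∣

meets-mono : ∀ {n} (A : Subset n) {V W} → V ⊆ W → meets A V ≤ meets A W
meets-mono A {V} {W} V⊆W = ⊓-monoʳ-≤ 1 (arith (3 ∷ []) 0 (λ A V W → V ⊑ W ∷ [] ⊢ # (A ⋒ V) ≲ # (A ⋒ W)) A V W V⊆W)

-- Submodularity of `hits` is proved member by member. A member that misses V also misses V ∩ W and
-- can meet V ∪ W only through W; one that meets both V and W already contributes two on the right.
1⊓-submod : ∀ a b u i → i ≤ a → i ≤ b → u ≤ a + b → 1 ⊓ u + 1 ⊓ i ≤ 1 ⊓ a + 1 ⊓ b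
1⊓-submod zero    b       u .zero z≤n _   u≤b = ≤-trans (≤-reflexive (+-identityʳ (1 ⊓ u))) (⊓-monoʳ-≤ 1 u≤b)
1⊓-submod (suc a) zero    u .zero _   z≤n _   = +-monoˡ-≤ 0 (m⊓n≤m 1 u)
1⊓-submod (suc a) (suc b) u i     _   _   _   = +-mono-≤ (m⊓n≤m 1 u) (m⊓n≤m 1 i)

meets-submod : ∀ {n} (A V W : Subset n) → meets A (V ∪ W) + meets A (V ∩ W) ≤ meets A V + meets A W
meets-submod A V W = 1⊓-submod ∣ A ∩ V ∣ ∣ A ∩ W ∣ _ _
  (arith (3 ∷ []) 0 (λ A V W → [] ⊢ # (A ⋒ (V ⋒ W)) ≲ # (A ⋒ V)) A V W)
  (arith (3 ∷ []) 0 (λ A V W → [] ⊢ # (A ⋒ (V ⋒ W)) ≲ # (A ⋒ W)) A V W)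
  (arith (3 ∷ []) 0 (λ A V W → [] ⊢ # (A ⋒ (V ⋓ W)) ≲ # (A ⋒ V) ⊕ # (A ⋒ W)) A V W)

hits-mono : ∀ {n} (As : List (Subset n)) {V W} → V ⊆ W → hits As V ≤ hits As W
hits-mono []       V⊆W = z≤n
hits-mono (A ∷ As) V⊆W = +-mono-≤ (meets-mono A V⊆W) (hits-mono As V⊆W)

hits-submod : ∀ {n} (As : List (Subset n)) V W → hits As (V ∪ W) + hits As (V ∩ W) ≤ hits As V + hits As W
hits-submod []       V W = z≤n
hits-submod (A ∷ As) V W = arith [] 8
  (λ a b c d e f g h → a ⊕ b ≲ c ⊕ d ∷ e ⊕ f ≲ g ⊕ h ∷ [] ⊢ (a ⊕ e) ⊕ (b ⊕ f) ≲ (c ⊕ g) ⊕ (d ⊕ h))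
  (meets A (V ∪ W)) (meets A (V ∩ W)) (meets A V) (meets A W) _ _ _ _ (meets-submod A V W) (hits-submod As V W)

hits≤length : ∀ {n} (As : List (Subset n)) W → hits As W ≤ length As
hits≤length []       W = z≤n
hits≤length (A ∷ As) W = +-mono-≤ (meets≤1 A W) (hits≤length As W)

hits-++ : ∀ {n} (As Bs : List (Subset n)) W → hits (As ++ˡ Bs) W ≡ hits As W + hits Bs W
hits-++ []       Bs W = refl
hits-++ (A ∷ As) Bs W = trans (cong (meets A W +_) (hits-++ As Bs W)) (sym (+-assoc (meets A W) _ _))

0<∣X∣⇒Nonempty : ∀ {n} (X : Subset n) → 0 < ∣ X ∣ → Nonempty X
0<∣X∣⇒Nonempty {n} X pos with nonempty? X
... | yes ne = ne
... | no  em = contradiction (subst (0 <_) (trans (cong ∣_∣ (Empty-unique em)) (∣⊥∣≡0 n)) pos) (n≮n 0)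

Nonempty⇒1≤ : ∀ {n} (X : Subset n) → Nonempty X → 1 ≤ ∣ X ∣
Nonempty⇒1≤ X (x , x∈X) = subst (_≤ ∣ X ∣) (∣⁅x⁆∣≡1 x) (p⊆q⇒∣p∣≤∣q∣ (⁅x⁆⊆ x∈X))

meets≡1 : ∀ {n} (A W : Subset n) → 1 ≤ ∣ A ∩ W ∣ → meets A W ≡ 1
meets≡1 A W = m≤n⇒m⊓n≡m

-- A matching that covers X, recorded one member at a time: each member is skipped or takes a point
-- of X, and the final `X ≡ ⊥` says that every point has been taken. Recursion on the members makes
-- the induction for Hall's theorem direct.
Matchable : ∀ {n} → List (Subset n) → Subset n → Set
Matchable []       X = X ≡ ⊥
Matchable (A ∷ As) X = Matchable As X ⊎ (∃ λ x → x ∈ A × x ∈ X × Matchable As (X ∩ ∁ ⁅ x ⁆))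

HallCondition : ∀ {n} → List (Subset n) → Subset n → Set
HallCondition As X = ∀ W → W ⊆ X → ∣ W ∣ ≤ hits As W

∈-─ : ∀ {n} {X : Subset n} {x y} → y ∈ X ∩ ∁ ⁅ x ⁆ → y ∈ X × y ≢ x
∈-─ {X = X} {x} y∈ = let y∈X , y∈∁ = x∈p∩q⁻ X (∁ ⁅ x ⁆) y∈ in
  y∈X , λ { refl → x∈∁p⇒x∉p y∈∁ (x∈⁅x⁆ x) }

─-∈ : ∀ {n} {X : Subset n} {x y} → y ∈ X → y ≢ x → y ∈ X ∩ ∁ ⁅ x ⁆
─-∈ y∈X y≢x = x∈p∩q⁺ (y∈X , x∉p⇒x∈∁p (x≢y⇒x∉⁅y⁆ y≢x))

matchable⇒hall : ∀ {n} (As : List (Subset n)) X → Matchable As X → HallCondition As X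
matchable⇒hall {n} [] X refl W W⊆⊥ = subst (∣ W ∣ ≤_) (∣⊥∣≡0 n) (p⊆q⇒∣p∣≤∣q∣ W⊆⊥)
matchable⇒hall (A ∷ As) X (inj₁ m) W W⊆X =
  ≤-trans (matchable⇒hall As X m W W⊆X) (m≤n+m (hits As W) (meets A W))
matchable⇒hall (A ∷ As) X (inj₂ (x , x∈A , x∈X , m)) W W⊆X with x ∈? W
... | no x∉W = ≤-trans
        (matchable⇒hall As (X ∩ ∁ ⁅ x ⁆) m W λ y∈W → ─-∈ (W⊆X y∈W) λ { refl → x∉W y∈W })
        (m≤n+m (hits As W) (meets A W))
... | yes x∈W = arith (2 ∷ []) 3
        (λ W x h g a → # (W ⋒ ∁′ x) ≲ h ∷ h ≲ g ∷ # x ≈ lit 1 ∷ a ≈ lit 1 ∷ [] ⊢ # W ≲ a ⊕ g)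
        W ⁅ x ⁆ (hits As (W ∩ ∁ ⁅ x ⁆)) (hits As W) (meets A W)
        (matchable⇒hall As (X ∩ ∁ ⁅ x ⁆) m (W ∩ ∁ ⁅ x ⁆)
          (arith (3 ∷ []) 0 (λ W X x → W ⊑ X ∷ [] ⊢ W ⋒ ∁′ x ⊑ X ⋒ ∁′ x) W X ⁅ x ⁆ W⊆X))
        (hits-mono As (p∩q⊆p W (∁ ⁅ x ⁆))) (∣⁅x⁆∣≡1 x)
        (meets≡1 A W (Nonempty⇒1≤ (A ∩ W) (x , x∈p∩q⁺ (x∈A , x∈W))))

1⊓-pos : ∀ {k} → 1 ≤ 1 ⊓ k → 1 ≤ k
1⊓-pos {suc k} _ = s≤s z≤n

-- If no set can be skipped, the violators of Hall's condition for the remaining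
-- family are closed under intersection, so that there is a least violator; the
-- skipped set meets it, and matching there destroys all violators.
hall⇒matchable : ∀ {n} (As : List (Subset n)) X → HallCondition As X → Matchable As X
hall⇒matchable [] X hall = Empty-unique (∣X∣≤0⇒∉ X (hall X ⊆-refl))
hall⇒matchable (A ∷ As) X hall
  with anySubset? (λ W → (W ⊆? X) ×-dec (hits As W <? ∣ W ∣))
... | no none = inj₁ (hall⇒matchable As X λ W W⊆X → ≮⇒≥ λ lt → none (W , W⊆X , lt))
... | yes some with argmin (λ W → (W ⊆? X) ×-dec (hits As W <? ∣ W ∣)) ∣_∣ some
...   | W , (W⊆X , violates) , minimal =
  let x , x∈ = 0<∣X∣⇒Nonempty (A ∩ W) (1⊓-pos (arith [] 3
                 (λ w h a → lit 1 ⊕ h ≲ w ∷ w ≲ a ⊕ h ∷ [] ⊢ lit 1 ≲ a)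
                 ∣ W ∣ (hits As W) (meets A W) violates (hall W W⊆X)))
      x∈A , x∈W = x∈p∩q⁻ A W x∈
  in inj₂ (x , x∈A , W⊆X x∈W , hall⇒matchable As (X ∩ ∁ ⁅ x ⁆) λ V V⊆ → ≮⇒≥ λ lt →
       let V⊆X : V ⊆ X
           V⊆X y∈ = proj₁ (∈-─ (V⊆ y∈))
           W⊆V = arith (2 ∷ []) 0 (λ V W → # W ≲ # (V ⋒ W) ∷ [] ⊢ W ⊑ V) V W
                   (minimal (V ∩ W) ((λ y∈ → V⊆X (p∩q⊆p V W y∈)) , ∩-violates V V⊆X lt))
       in proj₂ (∈-─ (V⊆ (W⊆V x∈W))) refl)
  where
  ∩-violates : ∀ V → V ⊆ X → hits As V < ∣ V ∣ → hits As (V ∩ W) < ∣ V ∩ W ∣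
  -- V and W exceed their neighbourhoods by at least two in total, while `A` can account for only
  -- one on V ∪ W; by submodularity an excess of one remains on V ∩ W.
  ∩-violates V V⊆X lt = arith (2 ∷ []) 5
    (λ V W a b c d m → lit 1 ⊕ a ≲ # V ∷ lit 1 ⊕ b ≲ # W ∷ c ⊕ d ≲ a ⊕ b ∷ m ≲ lit 1 ∷ # (V ⋓ W) ≲ m ⊕ c ∷ []
                       ⊢ lit 1 ⊕ d ≲ # (V ⋒ W))
    V W (hits As V) (hits As W) (hits As (V ∪ W)) (hits As (V ∩ W)) (meets A (V ∪ W))
    lt violates (hits-submod As V W) (meets≤1 A (V ∪ W))
    (hall (V ∪ W) (arith (3 ∷ []) 0 (λ V W X → V ⊑ X ∷ W ⊑ X ∷ [] ⊢ V ⋓ W ⊑ X) V W X V⊆X W⊆X))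

partialTransversal⇒matchable : ∀ {n} m (A : Fin m → Subset n) X →
                               IsPartialTransversal A X → Matchable (tabulate A) X
partialTransversal⇒matchable zero A X (f , _) = Empty-unique λ { (x , x∈X) → contradiction (f x x∈X) λ () }
partialTransversal⇒matchable {n} (suc m) A X (f , inj , good) with any? hit?
  where
  hit? : ∀ x → Dec (Σ (x ∈ X) λ px → f x px ≡ zero)
  hit? x with x ∈? X
  ... | no x∉X = no (x∉X ∘ proj₁)
  ... | yes px with f x px ≟ᶠ zero
  ...   | yes eq = yes (px , eq)
  -- The matching `f` takes the proof of membership as an argument, so two proofs of the same
  -- membership have to be identified.
  ...   | no neq = no λ (px′ , eq) → neq (trans (cong (f x) ([]=-irrelevant px px′)) eq)
... | no none = inj₁ (partialTransversal⇒matchable m (A ∘ suc) X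
  ( (λ x px → punchOut (nz x px))
  , (λ x y px py eq → inj x y px py (punchOut-injective (nz x px) (nz y py) eq))
  , (λ x px → subst (λ i → x ∈ A i) (sym (punchIn-punchOut (nz x px))) (good x px))))
  where
  nz : ∀ x px → zero ≢ f x px
  nz x px eq = none (x , px , sym eq)
... | yes (x₀ , px₀ , eq₀) = inj₂ (x₀ , subst (λ i → x₀ ∈ A i) eq₀ (good x₀ px₀) , px₀ ,
  partialTransversal⇒matchable m (A ∘ suc) (X ∩ ∁ ⁅ x₀ ⁆)
  ( (λ x px → punchOut (nz x px))
  , (λ x y px py eq → inj x y _ _ (punchOut-injective (nz x px) (nz y py) eq))
  , (λ x px → subst (λ i → x ∈ A i) (sym (punchIn-punchOut (nz x px))) (good x _))))
  where
  nz : ∀ x (px : x ∈ X ∩ ∁ ⁅ x₀ ⁆) → zero ≢ f x (proj₁ (∈-─ px))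
  nz x px eq = proj₂ (∈-─ px) (inj x x₀ _ px₀ (trans (sym eq) (sym eq₀)))

matchable⇒partialTransversal : ∀ {n} m (A : Fin m → Subset n) X →
                               Matchable (tabulate A) X → IsPartialTransversal A X
matchable⇒partialTransversal zero A X refl =
  (λ x x∈ → contradiction x∈ ∉⊥) , (λ x y px → contradiction px ∉⊥) , (λ x px → contradiction px ∉⊥)
matchable⇒partialTransversal (suc m) A X (inj₁ mt) =
  let f , inj , good = matchable⇒partialTransversal m (A ∘ suc) X mt in
  (λ x px → suc (f x px)) , (λ x y px py eq → inj x y px py (sucᶠ-injective eq)) , good
matchable⇒partialTransversal {n} (suc m) A X (inj₂ (x₀ , x₀∈A , x₀∈X , mt)) = g , g-inj , g-good
  where
  rest = matchable⇒partialTransversal m (A ∘ suc) (X ∩ ∁ ⁅ x₀ ⁆) mt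
  g : (x : Fin n) → x ∈ X → Fin (suc m)
  g x px with x ≟ᶠ x₀
  ... | yes _   = zero
  ... | no x≢x₀ = suc (proj₁ rest x (─-∈ px x≢x₀))
  g-inj : ∀ x y px py → g x px ≡ g y py → x ≡ y
  g-inj x y px py eq with x ≟ᶠ x₀ | y ≟ᶠ x₀
  ... | yes refl | yes refl = refl
  ... | no x≢ | no y≢ = proj₁ (proj₂ rest) x y _ _ (sucᶠ-injective eq)
  g-good : ∀ x px → x ∈ A (g x px)
  g-good x px with x ≟ᶠ x₀
  ... | yes refl = x₀∈A
  ... | no x≢    = proj₂ (proj₂ rest) x _

HallPresents : ∀ {n} → (Subset n → ℕ) → List (Subset n) → Set
HallPresents r As = ∀ X → (IndepR r X → HallCondition As X) × (HallCondition As X → IndepR r X)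

transversal⇒hallPresented : ∀ {n} {r : Subset n → ℕ} → IsTransversalR r → ∃ (HallPresents r)
transversal⇒hallPresented (m , A , pres) = tabulate A , λ X →
  (λ ind → matchable⇒hall (tabulate A) X (partialTransversal⇒matchable m A X (proj₁ (pres X) ind))) ,
  (λ hall → proj₂ (pres X) (matchable⇒partialTransversal m A X (hall⇒matchable (tabulate A) X hall)))

hallPresented⇒transversal : ∀ {n} {r : Subset n → ℕ} As → HallPresents r As → IsTransversalR r
hallPresented⇒transversal As pres = length As , lookup As , λ X →
  (λ ind → matchable⇒partialTransversal _ (lookup As) X (subst (λ Bs → Matchable Bs X) (sym (tabulate-lookup As))
             (hall⇒matchable As X (proj₁ (pres X) ind)))) ,
  (λ pt → proj₂ (pres X) (matchable⇒hall As X (subst (λ Bs → Matchable Bs X) (tabulate-lookup As)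
            (partialTransversal⇒matchable _ (lookup As) X pt))))

-- The deficiency form of Hall's theorem: r(X) is the minimum over W of |Γ(W)| + |X - W|, where Γ(W)
-- is the set of members meeting W. It is split into the upper bound and its attainment, and W
-- ranges over all sets, not only subsets of X.
Presents : ∀ {n} → (Subset n → ℕ) → List (Subset n) → Set
Presents r As = (∀ X W → r X ≤ hits As W + ∣ X ∩ ∁ W ∣) × (∀ X → ∃ λ W → hits As W + ∣ X ∩ ∁ W ∣ ≤ r X)

module _ {n} (As : List (Subset n)) where

  private
    value : Subset n → Subset n → ℕ
    value X W = hits As W + ∣ X ∩ ∁ W ∣
    best : ∀ X → ∃ λ W → _ × ∀ V → _ → value X W ≤ value X V
    best X = argmin (λ _ → yes tt) (value X) (⊥ , tt)
    W* : Subset n → Subset n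
    W* X = proj₁ (best X)
    rkT : Subset n → ℕ
    rkT X = value X (W* X)
    rkT≤ : ∀ X W → rkT X ≤ value X W
    rkT≤ X W = proj₂ (proj₂ (best X)) W tt

  hits-⊥ : hits As ⊥ ≡ 0
  hits-⊥ = go As
    where
    go : ∀ (Bs : List (Subset n)) → hits Bs ⊥ ≡ 0
    go []       = refl
    go (B ∷ Bs) = cong₂ _+_ (cong (1 ⊓_) (trans (cong ∣_∣ (∩-zeroʳ B)) (∣⊥∣≡0 n))) (go Bs)

  abstract
    -- Submodularity is uncrossing: the union and the intersection of the minimisers for X and Y are
    -- candidates for X ∪ Y and X ∩ Y.
    transversalMatroid : Matroid n
    transversalMatroid = record
      { rk = rkT
      ; rk-bound = λ X → arith (1 ∷ []) 2 (λ X r h → r ≲ h ⊕ # (X ⋒ ∁′ ⊥′) ∷ h ≈ lit 0 ∷ [] ⊢ r ≲ # X)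
          X (rkT X) (hits As ⊥) (rkT≤ X ⊥) hits-⊥
      ; rk-mono = λ {X} {Y} X⊆Y → arith (3 ∷ []) 2
          (λ X Y W r h → X ⊑ Y ∷ r ≲ h ⊕ # (X ⋒ ∁′ W) ∷ [] ⊢ r ≲ h ⊕ # (Y ⋒ ∁′ W))
          X Y (W* Y) (rkT X) (hits As (W* Y)) X⊆Y (rkT≤ X (W* Y))
      ; rk-submod = λ X Y → arith (4 ∷ []) 6
          (λ X Y V W a b c d p q → a ≲ p ⊕ # ((X ⋓ Y) ⋒ ∁′ (V ⋓ W)) ∷ b ≲ q ⊕ # ((X ⋒ Y) ⋒ ∁′ (V ⋒ W)) ∷
                                   p ⊕ q ≲ c ⊕ d ∷ [] ⊢ a ⊕ b ≲ (c ⊕ # (X ⋒ ∁′ V)) ⊕ (d ⊕ # (Y ⋒ ∁′ W)))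
          X Y (W* X) (W* Y) (rkT (X ∪ Y)) (rkT (X ∩ Y)) (hits As (W* X)) (hits As (W* Y))
          (hits As (W* X ∪ W* Y)) (hits As (W* X ∩ W* Y))
          (rkT≤ (X ∪ Y) (W* X ∪ W* Y)) (rkT≤ (X ∩ Y) (W* X ∩ W* Y)) (hits-submod As (W* X) (W* Y))
      }

    transversalMatroid-presents : Presents (rk transversalMatroid) As
    transversalMatroid-presents = rkT≤ , λ X → W* X , ≤-refl

presents⇒hallPresents : ∀ {n} (M : Matroid n) As → Presents (rk M) As → HallPresents (rk M) As
presents⇒hallPresents M As (upper , lower) X = indep⇒hall , hall⇒indep
  where
  indep⇒hall : IndepR (rk M) X → HallCondition As X
  indep⇒hall ind W W⊆X = arith (2 ∷ []) 2
    (λ X W r h → W ⊑ X ∷ r ≈ # X ∷ r ≲ h ⊕ # (X ⋒ ∁′ W) ∷ [] ⊢ # W ≲ h)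
    X W (rk M X) (hits As W) W⊆X ind (upper X W)
  hall⇒indep : HallCondition As X → IndepR (rk M) X
  -- The minimiser need not lie in X, so Hall's condition is applied to its trace X ∩ W, which is
  -- met by no more members.
  hall⇒indep hall = let W , le = lower X in ≤-antisym (rk-bound M X) (arith (2 ∷ []) 3
    (λ X W r h g → # (X ⋒ W) ≲ g ∷ g ≲ h ∷ h ⊕ # (X ⋒ ∁′ W) ≲ r ∷ [] ⊢ # X ≲ r)
    X W (rk M X) (hits As W) (hits As (X ∩ W)) (hall (X ∩ W) (p∩q⊆p X W)) (hits-mono As (p∩q⊆q X W)) le)

-- `M` and the transversal matroid of `As` have the same independent sets, namely those satisfying
-- Hall's condition, and hence the same rank.
hallPresents⇒presents : ∀ {n} (M : Matroid n) As → HallPresents (rk M) As → Presents (rk M) As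
hallPresents⇒presents M As pres =
  (λ X W → ≤-trans (rk≤rk M N (λ Y → proj₂ (presN Y) ∘ proj₁ (pres Y)) X) (proj₁ presents X W)) ,
  (λ X → let W , le = proj₂ presents X in W ,
         ≤-trans le (rk≤rk N M (λ Y → proj₂ (pres Y) ∘ proj₁ (presN Y)) X))
  where
  N        = transversalMatroid As
  presents = transversalMatroid-presents As
  presN    = presents⇒hallPresents N As presents

transversal⇒presented : ∀ {n} (M : Matroid n) → IsTransversal M → ∃ (Presents (rk M))
transversal⇒presented M tr = let As , pres = transversal⇒hallPresented {r = rk M} tr in As , hallPresents⇒presents M As pres

presented⇒transversal : ∀ {n} (M : Matroid n) As → Presents (rk M) As → IsTransversal M
presented⇒transversal M As pres = hallPresented⇒transversal {r = rk M} As (presents⇒hallPresents M As pres)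

hits-map-cong : ∀ {m n} (f : Subset m → Subset n) {X Y} → (∀ A → meets (f A) Y ≡ meets A X) →
                ∀ As → hits (map f As) Y ≡ hits As X
hits-map-cong f eq []       = refl
hits-map-cong f eq (A ∷ As) = cong₂ _+_ (eq A) (hits-map-cong f eq As)

singletons : ∀ {n} (V : Subset n) → ∃ λ L → length L ≡ ∣ V ∣ × ∀ W → hits L W ≡ ∣ W ∩ V ∣
singletons [] = [] , refl , λ { [] → refl }
singletons {suc n} (b ∷ V) with singletons V
... | L , len , hit = go b
  where
  hit′ : ∀ c W → hits (map (false ∷_) L) (c ∷ W) ≡ ∣ W ∩ V ∣
  hit′ c W = trans (hits-map-cong (false ∷_) (λ _ → refl) L) (hit W)
  go : ∀ b → ∃ λ L → length L ≡ ∣ b ∷ V ∣ × ∀ W → hits L W ≡ ∣ W ∩ (b ∷ V) ∣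
  go false = map (false ∷_) L , trans (length-map _ L) len , λ
    { (true ∷ W) → hit′ true W ; (false ∷ W) → hit′ false W }
  go true = ⁅ zero ⁆ ∷ map (false ∷_) L , cong suc (trans (length-map _ L) len) , λ
    { (true ∷ W) → cong suc (hit′ true W)
    ; (false ∷ W) → cong₂ _+_ (cong (1 ⊓_) (trans (cong ∣_∣ (∩-zeroˡ W)) (∣⊥∣≡0 n))) (hit′ false W) }

-- Members missing V are discarded and the others are cut down to V, so that the length counts
-- exactly the members meeting V.
traces : ∀ {n} (V : Subset n) (As : List (Subset n)) →
         ∃ λ L → length L ≡ hits As V × ∀ W → hits L W ≡ hits As (W ∩ V)
traces V [] = [] , refl , λ _ → refl
traces V (A ∷ As) with traces V As | ∣ A ∩ V ∣ in eq
... | L , len , hit | zero  = L , len , λ W → trans (hit W) (cong (_+ hits As (W ∩ V)) (sym (cong (1 ⊓_) (n≤0⇒n≡0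
        (arith (3 ∷ []) 0 (λ A V W → # (A ⋒ V) ≈ lit 0 ∷ [] ⊢ # (A ⋒ W ⋒ V) ≲ lit 0) A V W eq)))))
... | L , len , hit | suc _ = A ∩ V ∷ L , cong suc len , λ W → cong₂ _+_ (cong (1 ⊓_)
        (arith (3 ∷ []) 0 (λ A V W → [] ⊢ # ((A ⋒ V) ⋒ W) ≈ # (A ⋒ W ⋒ V)) A V W)) (hit W)

-- W₀ attains r E = hits As W₀ + |E - W₀|: the elements outside W₀ are coloops,
-- and are presented by singletons instead.
tight-presentation : ∀ {n} (M : Matroid n) As → Presents (rk M) As →
                     ∃ λ Bs → Presents (rk M) Bs × length Bs ≡ rank M
tight-presentation M As (upper , lower) = traced ++ˡ coloops , (upper′ , lower′) ,
  trans (length-++ traced) (trans (cong₂ _+_ len₁ len₂) (≤-antisym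
    (arith (1 ∷ []) 2 (λ W h r → h ⊕ # (⊤′ ⋒ ∁′ W) ≲ r ∷ [] ⊢ h ⊕ # (∁′ W) ≲ r) W₀ (hits As W₀) (rank M) att)
    (arith (1 ∷ []) 2 (λ W h r → r ≲ h ⊕ # (⊤′ ⋒ ∁′ W) ∷ [] ⊢ r ≲ h ⊕ # (∁′ W)) W₀ (hits As W₀) (rank M) (upper ⊤ W₀))))
  where
  W₀  = proj₁ (lower ⊤)
  att : hits As W₀ + ∣ ⊤ ∩ ∁ W₀ ∣ ≤ rank M
  att = proj₂ (lower ⊤)
  traced = proj₁ (traces W₀ As)
  len₁   = proj₁ (proj₂ (traces W₀ As))
  coloops = proj₁ (singletons (∁ W₀))
  len₂    = proj₁ (proj₂ (singletons (∁ W₀)))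
  hit : ∀ W → hits (traced ++ˡ coloops) W ≡ hits As (W ∩ W₀) + ∣ W ∩ ∁ W₀ ∣
  hit W = trans (hits-++ traced coloops W)
                (cong₂ _+_ (proj₂ (proj₂ (traces W₀ As)) W) (proj₂ (proj₂ (singletons (∁ W₀))) W))
  upper′ : ∀ X W → rk M X ≤ hits (traced ++ˡ coloops) W + ∣ X ∩ ∁ W ∣
  upper′ X W = arith (3 ∷ []) 3
    (λ X W V r h g → r ≲ h ⊕ # (X ⋒ ∁′ (W ⋒ V)) ∷ g ≈ h ⊕ # (W ⋒ ∁′ V) ∷ [] ⊢ r ≲ g ⊕ # (X ⋒ ∁′ W))
    X W W₀ (rk M X) (hits As (W ∩ W₀)) _ (upper X (W ∩ W₀)) (hit W)
  lower′ : ∀ X → ∃ λ W → hits (traced ++ˡ coloops) W + ∣ X ∩ ∁ W ∣ ≤ rk M X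
  -- Because W₀ attains the rank, uncrossing W with W₀ gives hits(W ∩ W₀) + |W - W₀| ≤ hits(W); a
  -- minimiser for the old family therefore still serves.
  lower′ X = let W , le = lower X in W , arith (3 ∷ []) 7
    (λ X W V r s h g h₀ i u → s ≲ u ⊕ # (⊤′ ⋒ ∁′ (W ⋓ V)) ∷ h₀ ⊕ # (⊤′ ⋒ ∁′ V) ≲ s ∷ u ⊕ i ≲ h ⊕ h₀ ∷
       g ≈ i ⊕ # (W ⋒ ∁′ V) ∷ h ⊕ # (X ⋒ ∁′ W) ≲ r ∷ [] ⊢ g ⊕ # (X ⋒ ∁′ W) ≲ r)
    X W W₀ (rk M X) (rank M) (hits As W) _ (hits As W₀) (hits As (W ∩ W₀)) (hits As (W ∪ W₀))
    (upper ⊤ (W ∪ W₀)) att (hits-submod As W W₀) (hit W) le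

-- The ground set is kept and the points outside S become loops, which avoids relabelling.
restrict : ∀ {n} → Matroid n → Subset n → Matroid n
restrict M S = record
  { rk = λ X → rk M (X ∩ S)
  ; rk-bound = λ X → ≤-trans (rk-bound M (X ∩ S)) (∣p∩q∣≤∣p∣ X S)
  ; rk-mono = λ {X} {Y} X⊆Y → rk-mono M (arith (3 ∷ []) 0 (λ X Y S → X ⊑ Y ∷ [] ⊢ X ⋒ S ⊑ Y ⋒ S) X Y S X⊆Y)
  ; rk-submod = λ X Y → ≤-trans (+-mono-≤
      (rk-mono M (arith (3 ∷ []) 0 (λ X Y S → [] ⊢ (X ⋓ Y) ⋒ S ⊑ (X ⋒ S) ⋓ (Y ⋒ S)) X Y S))
      (rk-mono M (arith (3 ∷ []) 0 (λ X Y S → [] ⊢ (X ⋒ Y) ⋒ S ⊑ (X ⋒ S) ⋒ (Y ⋒ S)) X Y S)))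
      (rk-submod M (X ∩ S) (Y ∩ S))
  }

restrict-presents : ∀ {n} (M : Matroid n) S As → Presents (rk M) As → Presents (rk (restrict M S)) (map (_∩ S) As)
restrict-presents M S As (upper , lower) =
  (λ X W → arith (3 ∷ []) 3 (λ X W S r h g → g ≈ h ∷ r ≲ h ⊕ # ((X ⋒ S) ⋒ ∁′ (W ⋒ S)) ∷ [] ⊢ r ≲ g ⊕ # (X ⋒ ∁′ W))
    X W S (rk M (X ∩ S)) (hits As (W ∩ S)) _ (hit W) (upper (X ∩ S) (W ∩ S))) ,
  -- Adding the points outside S to W costs nothing, since the cut-down members avoid them, and it
  -- removes them from X - W.
  (λ X → let W , le = lower (X ∩ S) in W ∪ ∁ S , arith (3 ∷ []) 4
    (λ X W S r h h′ g → g ≈ h′ ∷ h′ ≲ h ∷ h ⊕ # ((X ⋒ S) ⋒ ∁′ W) ≲ r ∷ [] ⊢ g ⊕ # (X ⋒ ∁′ (W ⋓ ∁′ S)) ≲ r)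
    X W S (rk M (X ∩ S)) (hits As W) (hits As ((W ∪ ∁ S) ∩ S)) _ (hit (W ∪ ∁ S))
    (hits-mono As (arith (2 ∷ []) 0 (λ W S → [] ⊢ (W ⋓ ∁′ S) ⋒ S ⊑ W) W S)) le)
  where
  hit : ∀ W → hits (map (_∩ S) As) W ≡ hits As (W ∩ S)
  hit W = hits-map-cong (_∩ S) (λ A → cong (1 ⊓_)
    (arith (3 ∷ []) 0 (λ A W S → [] ⊢ # ((A ⋒ S) ⋒ W) ≈ # (A ⋒ (W ⋒ S))) A W S)) As

abstract
  transversal⇒tightly-presented : ∀ {n} (M : Matroid n) → IsTransversal M →
                                  ∃ λ Bs → Presents (rk M) Bs × length Bs ≡ rank M
  transversal⇒tightly-presented M tr = let As , pres = transversal⇒presented M tr in tight-presentation M As pres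

restrict-transversal : ∀ {n} (M : Matroid n) S → IsTransversal M → IsTransversal (restrict M S)
restrict-transversal M S tr = let As , pres = transversal⇒presented M tr in
  presented⇒transversal (restrict M S) (map (_∩ S) As) (restrict-presents M S As pres)

-- Rearranging disjoint unions of ground sets

∣++∣ : ∀ {m n} (X : Subset m) (Y : Subset n) → ∣ X ++ Y ∣ ≡ ∣ X ∣ + ∣ Y ∣
∣++∣ []      Y = refl
∣++∣ (b ∷ X) Y = begin
  ∣ b ∷ X ++ Y ∣          ≡⟨ ∣∷∣ b (X ++ Y) ⟩
  bit b + ∣ X ++ Y ∣      ≡⟨ cong (bit b +_) (∣++∣ X Y) ⟩
  bit b + (∣ X ∣ + ∣ Y ∣) ≡⟨ sym (+-assoc (bit b) _ _) ⟩
  bit b + ∣ X ∣ + ∣ Y ∣   ≡⟨ cong (_+ ∣ Y ∣) (sym (∣∷∣ b X)) ⟩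
  ∣ b ∷ X ∣ + ∣ Y ∣       ∎
  where open ≡-Reasoning

∩-++ : ∀ {m n} (X X′ : Subset m) (Y Y′ : Subset n) → (X ++ Y) ∩ (X′ ++ Y′) ≡ (X ∩ X′) ++ (Y ∩ Y′)
∩-++ X X′ Y Y′ = zipWith-++ _∧_ X Y X′ Y′

∪-++ : ∀ {m n} (X X′ : Subset m) (Y Y′ : Subset n) → (X ++ Y) ∪ (X′ ++ Y′) ≡ (X ∪ X′) ++ (Y ∪ Y′)
∪-++ X X′ Y Y′ = zipWith-++ _∨_ X Y X′ Y′

∁-++ : ∀ {m n} (X : Subset m) (Y : Subset n) → ∁ (X ++ Y) ≡ ∁ X ++ ∁ Y
∁-++ X Y = map-++ not X Y

take-++ : ∀ {m n} (X : Subset m) (Y : Subset n) → take m (X ++ Y) ≡ X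
take-++ {m} X Y = ++-injectiveˡ _ X (take++drop≡id m (X ++ Y))

drop-++ : ∀ {m n} (X : Subset m) (Y : Subset n) → drop m (X ++ Y) ≡ Y
drop-++ {m} X Y = ++-injectiveʳ (take m (X ++ Y)) X (take++drop≡id m (X ++ Y))

data SplitView (m : ℕ) {n} : Subset (m + n) → Set where
  _++ᵛ_ : (X : Subset m) (Y : Subset n) → SplitView m (X ++ Y)

splitView : ∀ m {n} (Z : Subset (m + n)) → SplitView m Z
splitView m Z = subst (SplitView m) (take++drop≡id m Z) (take m Z ++ᵛ drop m Z)

-- A cardinality-preserving isomorphism of power sets stands in for a bijection of points: rank
-- functions see only subsets.
record SetIso (m n : ℕ) : Set where
  field
    to      : Subset m → Subset n
    from    : Subset n → Subset m
    to-from : ∀ Y → to (from Y) ≡ Y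
    from-to : ∀ X → from (to X) ≡ X
    to-∩    : ∀ X Y → to (X ∩ Y) ≡ to X ∩ to Y
    to-∪    : ∀ X Y → to (X ∪ Y) ≡ to X ∪ to Y
    to-∁    : ∀ X → to (∁ X) ≡ ∁ (to X)
    to-card : ∀ X → ∣ to X ∣ ≡ ∣ X ∣
open SetIso public

idᵢ : ∀ {n} → SetIso n n
idᵢ = record { to = id ; from = id ; to-from = λ _ → refl ; from-to = λ _ → refl ; to-∩ = λ _ _ → refl
             ; to-∪ = λ _ _ → refl ; to-∁ = λ _ → refl ; to-card = λ _ → refl }

symᵢ : ∀ {m n} → SetIso m n → SetIso n m
symᵢ f = record
  { to = from f ; from = to f ; to-from = from-to f ; from-to = to-from f
  ; to-∩ = λ X Y → trans (cong (from f) (trans (sym (cong₂ _∩_ (to-from f X) (to-from f Y)))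
                                               (sym (to-∩ f (from f X) (from f Y))))) (from-to f _)
  ; to-∪ = λ X Y → trans (cong (from f) (trans (sym (cong₂ _∪_ (to-from f X) (to-from f Y)))
                                               (sym (to-∪ f (from f X) (from f Y))))) (from-to f _)
  ; to-∁ = λ X → trans (cong (from f) (trans (sym (cong ∁ (to-from f X))) (sym (to-∁ f (from f X))))) (from-to f _)
  ; to-card = λ X → trans (sym (to-card f (from f X))) (cong ∣_∣ (to-from f X))
  }

infixr 5 _⨾_
_⨾_ : ∀ {l m n} → SetIso l m → SetIso m n → SetIso l n
f ⨾ g = record
  { to = to g ∘ to f ; from = from f ∘ from g
  ; to-from = λ Y → trans (cong (to g) (to-from f (from g Y))) (to-from g Y)
  ; from-to = λ X → trans (cong (from f) (from-to g (to f X))) (from-to f X)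
  ; to-∩ = λ X Y → trans (cong (to g) (to-∩ f X Y)) (to-∩ g _ _)
  ; to-∪ = λ X Y → trans (cong (to g) (to-∪ f X Y)) (to-∪ g _ _)
  ; to-∁ = λ X → trans (cong (to g) (to-∁ f X)) (to-∁ g _)
  ; to-card = λ X → trans (to-card g _) (to-card f X)
  }

module _ {a b c d} (f : SetIso a b) (g : SetIso c d) where
  private
    F : Subset (a + c) → Subset (b + d)
    F Z = to f (take a Z) ++ to g (drop a Z)
    G : Subset (b + d) → Subset (a + c)
    G Z = from f (take b Z) ++ from g (drop b Z)

  ⊕-to : ∀ X Y → F (X ++ Y) ≡ to f X ++ to g Y
  ⊕-to X Y = cong₂ _++_ (cong (to f) (take-++ X Y)) (cong (to g) (drop-++ X Y))

  private
    ⊕-from : ∀ X Y → G (X ++ Y) ≡ from f X ++ from g Y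
    ⊕-from X Y = cong₂ _++_ (cong (from f) (take-++ X Y)) (cong (from g) (drop-++ X Y))

    F-∩ : ∀ Z Z′ → F (Z ∩ Z′) ≡ F Z ∩ F Z′
    F-∩ Z Z′ with splitView a Z | splitView a Z′
    ... | X ++ᵛ Y | X′ ++ᵛ Y′ = begin
      F ((X ++ Y) ∩ (X′ ++ Y′))                       ≡⟨ cong F (∩-++ X X′ Y Y′) ⟩
      F ((X ∩ X′) ++ (Y ∩ Y′))                        ≡⟨ ⊕-to _ _ ⟩
      to f (X ∩ X′) ++ to g (Y ∩ Y′)                  ≡⟨ cong₂ _++_ (to-∩ f X X′) (to-∩ g Y Y′) ⟩
      (to f X ∩ to f X′) ++ (to g Y ∩ to g Y′)        ≡⟨ sym (∩-++ (to f X) (to f X′) (to g Y) (to g Y′)) ⟩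
      (to f X ++ to g Y) ∩ (to f X′ ++ to g Y′)       ≡⟨ sym (cong₂ _∩_ (⊕-to X Y) (⊕-to X′ Y′)) ⟩
      F (X ++ Y) ∩ F (X′ ++ Y′)                       ∎
      where open ≡-Reasoning

    F-∪ : ∀ Z Z′ → F (Z ∪ Z′) ≡ F Z ∪ F Z′
    F-∪ Z Z′ with splitView a Z | splitView a Z′
    ... | X ++ᵛ Y | X′ ++ᵛ Y′ = begin
      F ((X ++ Y) ∪ (X′ ++ Y′))                       ≡⟨ cong F (∪-++ X X′ Y Y′) ⟩
      F ((X ∪ X′) ++ (Y ∪ Y′))                        ≡⟨ ⊕-to _ _ ⟩
      to f (X ∪ X′) ++ to g (Y ∪ Y′)                  ≡⟨ cong₂ _++_ (to-∪ f X X′) (to-∪ g Y Y′) ⟩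
      (to f X ∪ to f X′) ++ (to g Y ∪ to g Y′)        ≡⟨ sym (∪-++ (to f X) (to f X′) (to g Y) (to g Y′)) ⟩
      (to f X ++ to g Y) ∪ (to f X′ ++ to g Y′)       ≡⟨ sym (cong₂ _∪_ (⊕-to X Y) (⊕-to X′ Y′)) ⟩
      F (X ++ Y) ∪ F (X′ ++ Y′)                       ∎
      where open ≡-Reasoning

    F-∁ : ∀ Z → F (∁ Z) ≡ ∁ (F Z)
    F-∁ Z with splitView a Z
    ... | X ++ᵛ Y = begin
      F (∁ (X ++ Y))             ≡⟨ cong F (∁-++ X Y) ⟩
      F (∁ X ++ ∁ Y)             ≡⟨ ⊕-to _ _ ⟩
      to f (∁ X) ++ to g (∁ Y)   ≡⟨ cong₂ _++_ (to-∁ f X) (to-∁ g Y) ⟩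
      ∁ (to f X) ++ ∁ (to g Y)   ≡⟨ sym (∁-++ (to f X) (to g Y)) ⟩
      ∁ (to f X ++ to g Y)       ≡⟨ sym (cong ∁ (⊕-to X Y)) ⟩
      ∁ (F (X ++ Y))             ∎
      where open ≡-Reasoning

    F-card : ∀ Z → ∣ F Z ∣ ≡ ∣ Z ∣
    F-card Z with splitView a Z
    ... | X ++ᵛ Y = begin
      ∣ F (X ++ Y) ∣          ≡⟨ cong ∣_∣ (⊕-to X Y) ⟩
      ∣ to f X ++ to g Y ∣    ≡⟨ ∣++∣ (to f X) (to g Y) ⟩
      ∣ to f X ∣ + ∣ to g Y ∣ ≡⟨ cong₂ _+_ (to-card f X) (to-card g Y) ⟩
      ∣ X ∣ + ∣ Y ∣           ≡⟨ sym (∣++∣ X Y) ⟩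
      ∣ X ++ Y ∣              ∎
      where open ≡-Reasoning

    F-G : ∀ Z → F (G Z) ≡ Z
    F-G Z with splitView b Z
    ... | X ++ᵛ Y = trans (cong F (⊕-from X Y)) (trans (⊕-to _ _) (cong₂ _++_ (to-from f X) (to-from g Y)))

    G-F : ∀ Z → G (F Z) ≡ Z
    G-F Z with splitView a Z
    ... | X ++ᵛ Y = trans (cong G (⊕-to X Y)) (trans (⊕-from _ _) (cong₂ _++_ (from-to f X) (from-to g Y)))

  infixr 6 _⊕ᵢ_
  _⊕ᵢ_ : SetIso (a + c) (b + d)
  _⊕ᵢ_ = record { to = F ; from = G ; to-from = F-G ; from-to = G-F ; to-∩ = F-∩ ; to-∪ = F-∪ ; to-∁ = F-∁ ; to-card = F-card }

flip++ : ∀ m {n} → Subset (m + n) → Subset (n + m)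
flip++ m Z = drop m Z ++ take m Z

flip++-++ : ∀ {m n} (X : Subset m) (Y : Subset n) → flip++ m (X ++ Y) ≡ Y ++ X
flip++-++ X Y = cong₂ _++_ (drop-++ X Y) (take-++ X Y)

swapᵢ : ∀ m n → SetIso (m + n) (n + m)
swapᵢ m n = record
  { to = flip++ m ; from = flip++ n ; to-from = invol n m ; from-to = invol m n
  ; to-∩ = hom-∩ ; to-∪ = hom-∪ ; to-∁ = hom-∁ ; to-card = hom-card }
  where
  invol : ∀ m n (Z : Subset (m + n)) → flip++ n (flip++ m Z) ≡ Z
  invol m n Z with splitView m Z
  ... | X ++ᵛ Y = trans (cong (flip++ n) (flip++-++ X Y)) (flip++-++ Y X)
  hom-∩ : ∀ Z Z′ → flip++ m (Z ∩ Z′) ≡ flip++ m Z ∩ flip++ m Z′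
  hom-∩ Z Z′ with splitView m Z | splitView m Z′
  ... | X ++ᵛ Y | X′ ++ᵛ Y′ = trans (cong (flip++ m) (∩-++ X X′ Y Y′)) (trans (flip++-++ (X ∩ X′) (Y ∩ Y′))
        (trans (sym (∩-++ Y Y′ X X′)) (sym (cong₂ _∩_ (flip++-++ X Y) (flip++-++ X′ Y′)))))
  hom-∪ : ∀ Z Z′ → flip++ m (Z ∪ Z′) ≡ flip++ m Z ∪ flip++ m Z′
  hom-∪ Z Z′ with splitView m Z | splitView m Z′
  ... | X ++ᵛ Y | X′ ++ᵛ Y′ = trans (cong (flip++ m) (∪-++ X X′ Y Y′)) (trans (flip++-++ (X ∪ X′) (Y ∪ Y′))
        (trans (sym (∪-++ Y Y′ X X′)) (sym (cong₂ _∪_ (flip++-++ X Y) (flip++-++ X′ Y′)))))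
  hom-∁ : ∀ Z → flip++ m (∁ Z) ≡ ∁ (flip++ m Z)
  hom-∁ Z with splitView m Z
  ... | X ++ᵛ Y = trans (cong (flip++ m) (∁-++ X Y)) (trans (flip++-++ (∁ X) (∁ Y))
        (trans (sym (∁-++ Y X)) (sym (cong ∁ (flip++-++ X Y)))))
  hom-card : ∀ Z → ∣ flip++ m Z ∣ ≡ ∣ Z ∣
  hom-card Z with splitView m Z
  ... | X ++ᵛ Y = trans (cong ∣_∣ (flip++-++ X Y)) (trans (∣++∣ Y X) (trans (+-comm ∣ Y ∣ ∣ X ∣) (sym (∣++∣ X Y))))

consᵢ : ∀ {m n} → SetIso m n → SetIso (suc m) (suc n)
consᵢ f = idᵢ {1} ⊕ᵢ f

assocᵢ : ∀ l m n → SetIso ((l + m) + n) (l + (m + n))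
assocᵢ zero    m n = idᵢ
assocᵢ (suc l) m n = consᵢ (assocᵢ l m n)

assoc-++ : ∀ {l m n} (X : Subset l) (Y : Subset m) (Z : Subset n) →
           to (assocᵢ l m n) ((X ++ Y) ++ Z) ≡ X ++ (Y ++ Z)
assoc-++ []      Y Z = refl
assoc-++ (b ∷ X) Y Z = cong (b ∷_) (assoc-++ X Y Z)

from-flip : ∀ {m n} (f : SetIso m n) {X Y} → to f X ≡ Y → from f Y ≡ X
from-flip f {X} refl = from-to f X

exchᵢ : ∀ l m n → SetIso (l + (m + n)) (m + (l + n))
exchᵢ l m n = symᵢ (assocᵢ l m n) ⨾ (swapᵢ l m ⊕ᵢ idᵢ {n}) ⨾ assocᵢ m l n

exch-++ : ∀ {l m n} (X : Subset l) (Y : Subset m) (Z : Subset n) →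
          to (exchᵢ l m n) (X ++ (Y ++ Z)) ≡ Y ++ (X ++ Z)
exch-++ {l} {m} {n} X Y Z = begin
  to (assocᵢ m l n) (to (swapᵢ l m ⊕ᵢ idᵢ {n}) (from (assocᵢ l m n) (X ++ (Y ++ Z))))
    ≡⟨ cong (to (assocᵢ m l n) ∘ to (swapᵢ l m ⊕ᵢ idᵢ {n})) (from-flip (assocᵢ l m n) (assoc-++ X Y Z)) ⟩
  to (assocᵢ m l n) (to (swapᵢ l m ⊕ᵢ idᵢ {n}) ((X ++ Y) ++ Z))
    ≡⟨ cong (to (assocᵢ m l n)) (trans (⊕-to (swapᵢ l m) (idᵢ {n}) (X ++ Y) Z) (cong (_++ Z) (flip++-++ X Y))) ⟩
  to (assocᵢ m l n) ((Y ++ X) ++ Z)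
    ≡⟨ assoc-++ Y X Z ⟩
  Y ++ (X ++ Z) ∎
  where open ≡-Reasoning

interchangeᵢ : ∀ a b c d → SetIso ((a + b) + (c + d)) ((a + c) + (b + d))
interchangeᵢ a b c d = assocᵢ a b (c + d) ⨾ (idᵢ {a} ⊕ᵢ exchᵢ b c d) ⨾ symᵢ (assocᵢ a c (b + d))

interchange-++ : ∀ {a b c d} (X : Subset a) (Y : Subset b) (Z : Subset c) (W : Subset d) →
                 to (interchangeᵢ a b c d) ((X ++ Y) ++ (Z ++ W)) ≡ (X ++ Z) ++ (Y ++ W)
interchange-++ {a} {b} {c} {d} X Y Z W = begin
  from (assocᵢ a c (b + d)) (to (idᵢ {a} ⊕ᵢ exchᵢ b c d) (to (assocᵢ a b (c + d)) ((X ++ Y) ++ (Z ++ W))))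
    ≡⟨ cong (from (assocᵢ a c (b + d)) ∘ to (idᵢ {a} ⊕ᵢ exchᵢ b c d)) (assoc-++ X Y (Z ++ W)) ⟩
  from (assocᵢ a c (b + d)) (to (idᵢ {a} ⊕ᵢ exchᵢ b c d) (X ++ (Y ++ (Z ++ W))))
    ≡⟨ cong (from (assocᵢ a c (b + d))) (trans (⊕-to (idᵢ {a}) (exchᵢ b c d) X _) (cong (X ++_) (exch-++ Y Z W))) ⟩
  from (assocᵢ a c (b + d)) (X ++ (Z ++ (Y ++ W)))
    ≡⟨ from-flip (assocᵢ a c (b + d)) (assoc-++ X Z (Y ++ W)) ⟩
  (X ++ Z) ++ (Y ++ W) ∎
  where open ≡-Reasoning

rotateᵢ : ∀ a b c → SetIso ((a + b) + c) ((a + c) + b)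
rotateᵢ a b c = assocᵢ a b c ⨾ (idᵢ {a} ⊕ᵢ swapᵢ b c) ⨾ symᵢ (assocᵢ a c b)

rotate-++ : ∀ {a b c} (X : Subset a) (Y : Subset b) (Z : Subset c) →
            to (rotateᵢ a b c) ((X ++ Y) ++ Z) ≡ (X ++ Z) ++ Y
rotate-++ {a} {b} {c} X Y Z = begin
  from (assocᵢ a c b) (to (idᵢ {a} ⊕ᵢ swapᵢ b c) (to (assocᵢ a b c) ((X ++ Y) ++ Z)))
    ≡⟨ cong (from (assocᵢ a c b) ∘ to (idᵢ {a} ⊕ᵢ swapᵢ b c)) (assoc-++ X Y Z) ⟩
  from (assocᵢ a c b) (to (idᵢ {a} ⊕ᵢ swapᵢ b c) (X ++ (Y ++ Z)))
    ≡⟨ cong (from (assocᵢ a c b)) (trans (⊕-to (idᵢ {a}) (swapᵢ b c) X _) (cong (X ++_) (flip++-++ Y Z))) ⟩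
  from (assocᵢ a c b) (X ++ (Z ++ Y))
    ≡⟨ from-flip (assocᵢ a c b) (assoc-++ X Z Y) ⟩
  (X ++ Z) ++ Y ∎
  where open ≡-Reasoning

-- The rank function of M_k(N₁,A₁,U₁;N₂,A₂,U₂)

min₄ : ℕ → ℕ → ℕ → ℕ → ℕ
min₄ a b c d = (a ⊓ b) ⊓ (c ⊓ d)

module _ (a b c d : ℕ) where

  min₄≤₁ : min₄ a b c d ≤ a
  min₄≤₁ = ≤-trans (m⊓n≤m (a ⊓ b) (c ⊓ d)) (m⊓n≤m a b)

  min₄≤₂ : min₄ a b c d ≤ b
  min₄≤₂ = ≤-trans (m⊓n≤m (a ⊓ b) (c ⊓ d)) (m⊓n≤n a b)

  min₄≤₃ : min₄ a b c d ≤ c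
  min₄≤₃ = ≤-trans (m⊓n≤n (a ⊓ b) (c ⊓ d)) (m⊓n≤m c d)

  min₄≤₄ : min₄ a b c d ≤ d
  min₄≤₄ = ≤-trans (m⊓n≤n (a ⊓ b) (c ⊓ d)) (m⊓n≤n c d)

  min₄-sel : (P : ℕ → Set) → P a → P b → P c → P d → P (min₄ a b c d)
  min₄-sel P pa pb pc pd with ⊓-sel (a ⊓ b) (c ⊓ d) | ⊓-sel a b | ⊓-sel c d
  ... | inj₁ e | inj₁ f | _ = subst P (sym (trans e f)) pa
  ... | inj₁ e | inj₂ f | _ = subst P (sym (trans e f)) pb
  ... | inj₂ e | _ | inj₁ f = subst P (sym (trans e f)) pc
  ... | inj₂ e | _ | inj₂ f = subst P (sym (trans e f)) pd

module _ {n₁ n₂ t₁ t₂ : ℕ} where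

  join-∩ : ∀ (a : Subset n₁) (b : Subset n₂) (c : Subset t₁) (d : Subset t₂) a′ b′ c′ d′ →
           join a b c d ∩ join a′ b′ c′ d′ ≡ join (a ∩ a′) (b ∩ b′) (c ∩ c′) (d ∩ d′)
  join-∩ a b c d a′ b′ c′ d′ = trans (∩-++ a a′ _ _) (cong (a ∩ a′ ++_)
    (trans (∩-++ b b′ _ _) (cong (b ∩ b′ ++_) (∩-++ c c′ d d′))))

  join-∁ : ∀ (a : Subset n₁) (b : Subset n₂) (c : Subset t₁) (d : Subset t₂) →
           ∁ (join a b c d) ≡ join (∁ a) (∁ b) (∁ c) (∁ d)
  join-∁ a b c d = trans (∁-++ a _) (cong (∁ a ++_)
    (trans (∁-++ b _) (cong (∁ b ++_) (∁-++ c d))))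

  join-card : ∀ (a : Subset n₁) (b : Subset n₂) (c : Subset t₁) (d : Subset t₂) →
              ∣ join a b c d ∣ ≡ ∣ a ∣ + (∣ b ∣ + (∣ c ∣ + ∣ d ∣))
  join-card a b c d = trans (∣++∣ a _) (cong (∣ a ∣ +_) (trans (∣++∣ b _) (cong (∣ b ∣ +_) (∣++∣ c d))))

-- The hypotheses under which M_k(N₁,A₁,U₁;N₂,A₂,U₂) is defined, free of subtraction.
record Sizes {n₁ n₂} (k : ℕ) (N₁ : Matroid n₁) (A₁ : Subset n₁) (N₂ : Matroid n₂) (A₂ : Subset n₂) (t₁ t₂ : ℕ) : Set where
  field
    size₁ : t₁ + rank N₁ + ∣ A₂ ∣ ≡ k
    size₂ : t₂ + rank N₂ + ∣ A₁ ∣ ≡ k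
    room  : rank N₁ + ∣ A₁ ∣ + (rank N₂ + ∣ A₂ ∣) ≤ k + (rk N₁ A₁ + rk N₂ A₂)

swap-sizes : ∀ {n₁ n₂ k t₁ t₂} {N₁ : Matroid n₁} {A₁} {N₂ : Matroid n₂} {A₂} →
             Sizes k N₁ A₁ N₂ A₂ t₁ t₂ → Sizes k N₂ A₂ N₁ A₁ t₂ t₁
swap-sizes {k = k} {N₁ = N₁} {A₁} {N₂} {A₂} s = record
  { size₁ = size₂ ; size₂ = size₁
  ; room = subst₂ _≤_ (+-comm (rank N₁ + ∣ A₁ ∣) (rank N₂ + ∣ A₂ ∣)) (cong (k +_) (+-comm (rk N₁ A₁) (rk N₂ A₂))) room }
  where open Sizes s

-- Here a, b, c, d are the parts of X in R₁, R₂, U₁, U₂. The third term comes from the flats F ∪ U₁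
-- ∪ A₂: minimising ρ₁(F) + |a - F| gives `rk N₁ a`, and |A₂| + |b - A₂| is |A₂ ∪ b|. The fourth is
-- symmetric, and the first two belong to the empty set and E.
amalgamRk : ∀ {n₁ n₂ t₁ t₂} (k : ℕ) (N₁ : Matroid n₁) (A₁ : Subset n₁) (N₂ : Matroid n₂) (A₂ : Subset n₂) →
            Subset n₁ → Subset n₂ → Subset t₁ → Subset t₂ → ℕ
amalgamRk {t₁ = t₁} {t₂} k N₁ A₁ N₂ A₂ a b c d = min₄
  (∣ a ∣ + (∣ b ∣ + (∣ c ∣ + ∣ d ∣))) k
  (rk N₁ a + t₁ + ∣ A₂ ∪ b ∣ + ∣ d ∣)
  (rk N₂ b + t₂ + ∣ A₁ ∪ a ∣ + ∣ c ∣)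

swap-amalgamRk : ∀ {n₁ n₂ t₁ t₂} k (N₁ : Matroid n₁) A₁ (N₂ : Matroid n₂) A₂ a b (c : Subset t₁) (d : Subset t₂) →
                 amalgamRk k N₂ A₂ N₁ A₁ b a d c ≡ amalgamRk k N₁ A₁ N₂ A₂ a b c d
swap-amalgamRk k N₁ A₁ N₂ A₂ a b c d = cong₂ _⊓_
  (cong (_⊓ k) (arith (1 ∷ 1 ∷ 1 ∷ 1 ∷ []) 0
    (λ a b c d → [] ⊢ # b ⊕ (# a ⊕ (# d ⊕ # c)) ≈ # a ⊕ (# b ⊕ (# c ⊕ # d))) a b c d))
  (⊓-comm _ _)

-- An identification of a ground set with R₁, R₂, U₁, U₂. Varying it lets the exchanged construction
-- and the dual live on the ground set of M itself. The record keeps the four sizes as indices,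
-- since they could not be inferred from their sum.
record Quad (n₁ n₂ t₁ t₂ n : ℕ) : Set where
  constructor quad
  field iso : SetIso (n₁ + (n₂ + (t₁ + t₂))) n
open Quad public

module _ {n₁ n₂ t₁ t₂ n} (q : Quad n₁ n₂ t₁ t₂ n) where

  at : Subset n₁ → Subset n₂ → Subset t₁ → Subset t₂ → Subset n
  at a b c d = to (iso q) (join a b c d)

  data AtView : Subset n → Set where
    atᵛ : ∀ a b c d → AtView (at a b c d)

  atView : ∀ X → AtView X
  atView X = subst AtView (to-from (iso q) X) (go (from (iso q) X))
    where
    go : ∀ Z → AtView (to (iso q) Z)
    go Z with splitView n₁ Z
    ... | a ++ᵛ Z′ with splitView n₂ Z′
    ...   | b ++ᵛ Z″ with splitView t₁ Z″
    ...     | c ++ᵛ d = atᵛ a b c d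

  at-∩ : ∀ a b c d a′ b′ c′ d′ → at a b c d ∩ at a′ b′ c′ d′ ≡ at (a ∩ a′) (b ∩ b′) (c ∩ c′) (d ∩ d′)
  at-∩ a b c d a′ b′ c′ d′ = trans (sym (to-∩ (iso q) _ _)) (cong (to (iso q)) (join-∩ a b c d a′ b′ c′ d′))

  at-card : ∀ a b c d → ∣ at a b c d ∣ ≡ ∣ a ∣ + (∣ b ∣ + (∣ c ∣ + ∣ d ∣))
  at-card a b c d = trans (to-card (iso q) _) (join-card a b c d)

  at-─ : ∀ a b c d a′ b′ c′ d′ → ∣ at a b c d ∩ ∁ (at a′ b′ c′ d′) ∣ ≡
         ∣ a ∩ ∁ a′ ∣ + (∣ b ∩ ∁ b′ ∣ + (∣ c ∩ ∁ c′ ∣ + ∣ d ∩ ∁ d′ ∣))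
  at-─ a b c d a′ b′ c′ d′ = trans (cong (λ Z → ∣ at a b c d ∩ Z ∣)
      (trans (sym (to-∁ (iso q) _)) (cong (to (iso q)) (join-∁ a′ b′ c′ d′))))
    (trans (cong ∣_∣ (at-∩ a b c d (∁ a′) (∁ b′) (∁ c′) (∁ d′)))
      (at-card (a ∩ ∁ a′) (b ∩ ∁ b′) (c ∩ ∁ c′) (d ∩ ∁ d′)))

  IsAmalgamRk : ℕ → Matroid n₁ → Subset n₁ → Matroid n₂ → Subset n₂ → (Subset n → ℕ) → Set
  IsAmalgamRk k N₁ A₁ N₂ A₂ r = ∀ a b c d → r (at a b c d) ≡ amalgamRk k N₁ A₁ N₂ A₂ a b c d

0-or-pos : ∀ o → o ≡ 0 ⊎ 1 ≤ o
0-or-pos zero    = inj₁ refl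
0-or-pos (suc o) = inj₂ (s≤s z≤n)

hits-replicate : ∀ {n} m (A W : Subset n) → 1 ≤ ∣ A ∩ W ∣ → hits (replicate m A) W ≡ m
hits-replicate zero    A W pos = refl
hits-replicate (suc m) A W pos = cong₂ _+_ (meets≡1 A W pos) (hits-replicate m A W pos)

-- Meant for an `f` that enlarges every member by one common set, with o counting the points of X in
-- the enlargement: either X does not see the enlargement, or X meets every `f A`.
module _ {m n} (f : Subset m → Subset n) (X : Subset n) (a : Subset m) (o : ℕ)
         (eq : ∀ A → ∣ f A ∩ X ∣ ≡ ∣ A ∩ a ∣ + o) where

  hits-map-0 : o ≡ 0 → ∀ As → hits (map f As) X ≡ hits As a
  hits-map-0 refl = hits-map-cong f (λ A → cong (1 ⊓_) (trans (eq A) (+-identityʳ _)))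

  hits-map-1 : 1 ≤ o → ∀ As → hits (map f As) X ≡ length As
  hits-map-1 pos []       = refl
  hits-map-1 pos (A ∷ As) = cong₂ _+_
    (meets≡1 (f A) X (subst (1 ≤_) (sym (eq A)) (≤-trans pos (m≤n+m o ∣ A ∩ a ∣)))) (hits-map-1 pos As)

-- The presentation has k sets: those of N₁ enlarged by everything outside
-- R₁ ∪ U₁ ∪ A₂, those of N₂ enlarged by everything outside R₂ ∪ U₂ ∪ A₁, and
-- k - r(N₁) - r(N₂) copies of E.
module Presentation {n₁ n₂ t₁ t₂ n} (q : Quad n₁ n₂ t₁ t₂ n) {k N₁ A₁ N₂ A₂}
                    (sizes : Sizes k N₁ A₁ N₂ A₂ t₁ t₂)
                    (Bs : List (Subset n₁)) (presB : Presents (rk N₁) Bs) (lenB : length Bs ≡ rank N₁)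
                    (Cs : List (Subset n₂)) (presC : Presents (rk N₂) Cs) (lenC : length Cs ≡ rank N₂) where
  open Sizes sizes

  ranks≤k : rank N₁ + rank N₂ ≤ k
  ranks≤k = arith (1 ∷ 1 ∷ []) 5
    (λ A₁ A₂ r₁ r₂ x y k → r₁ ⊕ # A₁ ⊕ (r₂ ⊕ # A₂) ≲ k ⊕ (x ⊕ y) ∷ x ≲ # A₁ ∷ y ≲ # A₂ ∷ [] ⊢ r₁ ⊕ r₂ ≲ k)
    A₁ A₂ (rank N₁) (rank N₂) (rk N₁ A₁) (rk N₂ A₂) k room (rk-bound N₁ A₁) (rk-bound N₂ A₂)

  spare : ℕ
  spare = k ∸ (rank N₁ + rank N₂)

  spare-eq : spare + (rank N₁ + rank N₂) ≡ k
  spare-eq = m∸n+n≡m ranks≤k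

  liftB : Subset n₁ → Subset n
  liftB B = at q B (∁ A₂) ⊥ ⊤

  liftC : Subset n₂ → Subset n
  liftC C = at q (∁ A₁) C ⊤ ⊥

  family : List (Subset n)
  family = map liftB Bs ++ˡ (map liftC Cs ++ˡ replicate spare ⊤)

  hits-family : ∀ W → hits family W ≡ hits (map liftB Bs) W + (hits (map liftC Cs) W + hits (replicate spare ⊤) W)
  hits-family W = trans (hits-++ (map liftB Bs) _ W) (cong (hits (map liftB Bs) W +_) (hits-++ (map liftC Cs) _ W))

  liftB-eq : ∀ a b c d B → ∣ liftB B ∩ at q a b c d ∣ ≡ ∣ B ∩ a ∣ + (∣ b ∩ ∁ A₂ ∣ + ∣ d ∣)
  liftB-eq a b c d B = trans (cong ∣_∣ (at-∩ q B (∁ A₂) ⊥ ⊤ a b c d)) (trans (at-card q (B ∩ a) (∁ A₂ ∩ b) (⊥ ∩ c) (⊤ ∩ d))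
    (arith (2 ∷ 2 ∷ 1 ∷ 1 ∷ []) 0
      (λ B a A₂ b c d → [] ⊢ # (B ⋒ a) ⊕ (# (∁′ A₂ ⋒ b) ⊕ (# (⊥′ ⋒ c) ⊕ # (⊤′ ⋒ d))) ≈ # (B ⋒ a) ⊕ (# (b ⋒ ∁′ A₂) ⊕ # d))
      B a A₂ b c d))

  liftC-eq : ∀ a b c d C → ∣ liftC C ∩ at q a b c d ∣ ≡ ∣ C ∩ b ∣ + (∣ a ∩ ∁ A₁ ∣ + ∣ c ∣)
  liftC-eq a b c d C = trans (cong ∣_∣ (at-∩ q (∁ A₁) C ⊤ ⊥ a b c d)) (trans (at-card q (∁ A₁ ∩ a) (C ∩ b) (⊤ ∩ c) (⊥ ∩ d))
    (arith (2 ∷ 2 ∷ 1 ∷ 1 ∷ []) 0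
      (λ A₁ a C b c d → [] ⊢ # (∁′ A₁ ⋒ a) ⊕ (# (C ⋒ b) ⊕ (# (⊤′ ⋒ c) ⊕ # (⊥′ ⋒ d))) ≈ # (C ⋒ b) ⊕ (# (a ⋒ ∁′ A₁) ⊕ # c))
      A₁ a C b c d))

  value : Subset n₁ → Subset n₂ → Subset t₁ → Subset t₂ → ℕ
  value = amalgamRk k N₁ A₁ N₂ A₂

  -- Which term of the minimum is compared depends on whether W meets what was adjoined to the
  -- members of N₁ and to those of N₂: k if it meets both, the third or fourth term if it meets only
  -- one of them, |X| if it meets neither. Empty W is separate because the copies of E meet only
  -- nonempty sets.
  value≤ : ∀ a b c d a′ b′ c′ d′ → value a b c d ≤
           hits family (at q a′ b′ c′ d′) + (∣ a ∩ ∁ a′ ∣ + (∣ b ∩ ∁ b′ ∣ + (∣ c ∩ ∁ c′ ∣ + ∣ d ∩ ∁ d′ ∣)))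
  value≤ a b c d a′ b′ c′ d′
    with 0-or-pos (∣ a′ ∣ + (∣ b′ ∣ + (∣ c′ ∣ + ∣ d′ ∣)))
       | 0-or-pos (∣ b′ ∩ ∁ A₂ ∣ + ∣ d′ ∣) | 0-or-pos (∣ a′ ∩ ∁ A₁ ∣ + ∣ c′ ∣)
  ... | inj₁ empty | _ | _ = ≤-trans (min₄≤₁ _ _ _ _) (arith (2 ∷ 2 ∷ 2 ∷ 2 ∷ []) 1
    (λ a a′ b b′ c c′ d d′ h → # a′ ⊕ (# b′ ⊕ (# c′ ⊕ # d′)) ≈ lit 0 ∷ [] ⊢
      # a ⊕ (# b ⊕ (# c ⊕ # d)) ≲ h ⊕ (# (a ⋒ ∁′ a′) ⊕ (# (b ⋒ ∁′ b′) ⊕ (# (c ⋒ ∁′ c′) ⊕ # (d ⋒ ∁′ d′)))))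
    a a′ b b′ c c′ d d′ (hits family (at q a′ b′ c′ d′)) empty)
  ... | inj₂ nonempty | o₁ | o₂ = cases o₁ o₂
    where
    W = at q a′ b′ c′ d′
    XW = ∣ a ∩ ∁ a′ ∣ + (∣ b ∩ ∁ b′ ∣ + (∣ c ∩ ∁ c′ ∣ + ∣ d ∩ ∁ d′ ∣))
    E-hits : hits (replicate spare ⊤) W ≡ spare
    E-hits = hits-replicate spare ⊤ W (subst (1 ≤_)
      (sym (trans (cong ∣_∣ (∩-identityˡ W)) (at-card q a′ b′ c′ d′))) nonempty)
    total : ∀ {β γ} → hits (map liftB Bs) W ≡ β → hits (map liftC Cs) W ≡ γ → hits family W ≡ β + (γ + spare)
    total p p′ = trans (hits-family W) (cong₂ _+_ p (cong₂ _+_ p′ E-hits))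
    cases : ∣ b′ ∩ ∁ A₂ ∣ + ∣ d′ ∣ ≡ 0 ⊎ 1 ≤ ∣ b′ ∩ ∁ A₂ ∣ + ∣ d′ ∣ →
            ∣ a′ ∩ ∁ A₁ ∣ + ∣ c′ ∣ ≡ 0 ⊎ 1 ≤ ∣ a′ ∩ ∁ A₁ ∣ + ∣ c′ ∣ → value a b c d ≤ hits family W + XW
    cases (inj₂ o₁) (inj₂ o₂) = ≤-trans (min₄≤₂ _ _ _ _) (arith [] 6
      (λ k h x r₁ r₂ e → h ≈ r₁ ⊕ (r₂ ⊕ e) ∷ e ⊕ (r₁ ⊕ r₂) ≈ k ∷ [] ⊢ k ≲ h ⊕ x)
      k (hits family W) XW (rank N₁) (rank N₂) spare
      (total (trans (hits-map-1 liftB W a′ _ (liftB-eq a′ b′ c′ d′) o₁ Bs) lenB)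
             (trans (hits-map-1 liftC W b′ _ (liftC-eq a′ b′ c′ d′) o₂ Cs) lenC)) spare-eq)
    cases (inj₁ o₁) (inj₂ o₂) = ≤-trans (min₄≤₃ _ _ _ _) (arith (2 ∷ 3 ∷ 2 ∷ 2 ∷ []) 8
      (λ a a′ b b′ A₂ c c′ d d′ k h r₁ r₂ e x t g → h ≈ g ⊕ (r₂ ⊕ e) ∷ e ⊕ (r₁ ⊕ r₂) ≈ k ∷ t ⊕ r₁ ⊕ # A₂ ≈ k ∷
        x ≲ g ⊕ # (a ⋒ ∁′ a′) ∷ # (b′ ⋒ ∁′ A₂) ⊕ # d′ ≈ lit 0 ∷ [] ⊢ x ⊕ t ⊕ # (A₂ ⋓ b) ⊕ # d ≲
        h ⊕ (# (a ⋒ ∁′ a′) ⊕ (# (b ⋒ ∁′ b′) ⊕ (# (c ⋒ ∁′ c′) ⊕ # (d ⋒ ∁′ d′)))))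
      a a′ b b′ A₂ c c′ d d′ k (hits family W) (rank N₁) (rank N₂) spare (rk N₁ a) t₁ (hits Bs a′)
      (total (hits-map-0 liftB W a′ _ (liftB-eq a′ b′ c′ d′) o₁ Bs)
             (trans (hits-map-1 liftC W b′ _ (liftC-eq a′ b′ c′ d′) o₂ Cs) lenC))
      spare-eq size₁ (proj₁ presB a a′) o₁)
    cases (inj₂ o₁) (inj₁ o₂) = ≤-trans (min₄≤₄ _ _ _ _) (arith (3 ∷ 2 ∷ 2 ∷ 2 ∷ []) 8
      (λ a a′ A₁ b b′ c c′ d d′ k h r₁ r₂ e x t g → h ≈ r₁ ⊕ (g ⊕ e) ∷ e ⊕ (r₁ ⊕ r₂) ≈ k ∷ t ⊕ r₂ ⊕ # A₁ ≈ k ∷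
        x ≲ g ⊕ # (b ⋒ ∁′ b′) ∷ # (a′ ⋒ ∁′ A₁) ⊕ # c′ ≈ lit 0 ∷ [] ⊢ x ⊕ t ⊕ # (A₁ ⋓ a) ⊕ # c ≲
        h ⊕ (# (a ⋒ ∁′ a′) ⊕ (# (b ⋒ ∁′ b′) ⊕ (# (c ⋒ ∁′ c′) ⊕ # (d ⋒ ∁′ d′)))))
      a a′ A₁ b b′ c c′ d d′ k (hits family W) (rank N₁) (rank N₂) spare (rk N₂ b) t₂ (hits Cs b′)
      (total (trans (hits-map-1 liftB W a′ _ (liftB-eq a′ b′ c′ d′) o₁ Bs) lenB)
             (hits-map-0 liftC W b′ _ (liftC-eq a′ b′ c′ d′) o₂ Cs))
      spare-eq size₂ (proj₁ presC b b′) o₂)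
    -- Now W lies in A₁ ∪ A₂, and `room`, with r(A_i) bounded through the traces of W, yields |W| ≤
    -- hits(W).
    cases (inj₁ o₁) (inj₁ o₂) = ≤-trans (min₄≤₁ _ _ _ _) (arith (3 ∷ 3 ∷ 2 ∷ 2 ∷ []) 9
      (λ a a′ A₁ b b′ A₂ c c′ d d′ k h r₁ r₂ e x y g g′ → h ≈ g ⊕ (g′ ⊕ e) ∷ e ⊕ (r₁ ⊕ r₂) ≈ k ∷
        r₁ ⊕ # A₁ ⊕ (r₂ ⊕ # A₂) ≲ k ⊕ (x ⊕ y) ∷ x ≲ g ⊕ # (A₁ ⋒ ∁′ a′) ∷ y ≲ g′ ⊕ # (A₂ ⋒ ∁′ b′) ∷
        # (a′ ⋒ ∁′ A₁) ⊕ # c′ ≈ lit 0 ∷ # (b′ ⋒ ∁′ A₂) ⊕ # d′ ≈ lit 0 ∷ [] ⊢ # a ⊕ (# b ⊕ (# c ⊕ # d)) ≲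
        h ⊕ (# (a ⋒ ∁′ a′) ⊕ (# (b ⋒ ∁′ b′) ⊕ (# (c ⋒ ∁′ c′) ⊕ # (d ⋒ ∁′ d′)))))
      a a′ A₁ b b′ A₂ c c′ d d′ k (hits family W) (rank N₁) (rank N₂) spare (rk N₁ A₁) (rk N₂ A₂) (hits Bs a′) (hits Cs b′)
      (total (hits-map-0 liftB W a′ _ (liftB-eq a′ b′ c′ d′) o₁ Bs)
             (hits-map-0 liftC W b′ _ (liftC-eq a′ b′ c′ d′) o₂ Cs))
      spare-eq room (proj₁ presB A₁ a′) (proj₁ presC A₂ b′) o₂ o₁)

  Attained : Subset n₁ → Subset n₂ → Subset t₁ → Subset t₂ → ℕ → Set
  Attained a b c d v = ∃ λ W → hits family W + ∣ at q a b c d ∩ ∁ W ∣ ≤ v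

  attain-at : ∀ a b c d {v} a′ b′ c′ d′ →
    hits family (at q a′ b′ c′ d′) + (∣ a ∩ ∁ a′ ∣ + (∣ b ∩ ∁ b′ ∣ + (∣ c ∩ ∁ c′ ∣ + ∣ d ∩ ∁ d′ ∣))) ≤ v →
    Attained a b c d v
  attain-at a b c d a′ b′ c′ d′ le = at q a′ b′ c′ d′ ,
    subst (λ z → hits family (at q a′ b′ c′ d′) + z ≤ _) (sym (at-─ q a b c d a′ b′ c′ d′)) le

  -- The witnesses are the empty set, E, and a minimiser for N₁ joined with U₁ ∪ A₂ or one for N₂
  -- joined with U₂ ∪ A₁. The set U₁ ∪ A₂ avoids everything adjoined to the members of N₁, so these
  -- are hit exactly as in N₁.
  value-attained : ∀ a b c d → Attained a b c d (value a b c d)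
  value-attained a b c d = min₄-sel _ _ _ _ (Attained a b c d) att₁ att₂ att₃ att₄
    where
    att₁ : Attained a b c d (∣ a ∣ + (∣ b ∣ + (∣ c ∣ + ∣ d ∣)))
    att₁ = ⊥ , ≤-reflexive (trans (cong (_+ ∣ at q a b c d ∩ ∁ ⊥ ∣) (hits-⊥ family))
      (trans (arith (1 ∷ []) 0 (λ X → [] ⊢ # (X ⋒ ∁′ ⊥′) ≈ # X) (at q a b c d)) (at-card q a b c d)))
    att₂ : Attained a b c d k
    att₂ = ⊤ , arith (1 ∷ []) 9
      (λ X h k r₁ r₂ e lB lC x y → h ≲ x ⊕ (y ⊕ e) ∷ x ≈ lB ∷ y ≈ lC ∷ lB ≈ r₁ ∷ lC ≈ r₂ ∷ e ⊕ (r₁ ⊕ r₂) ≈ k ∷ [] ⊢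
        h ⊕ # (X ⋒ ∁′ ⊤′) ≲ k)
      (at q a b c d) (hits family ⊤) k (rank N₁) (rank N₂) spare _ _ _ _
      (subst (hits family ⊤ ≤_) (trans (length-++ (map liftB Bs)) (cong (length (map liftB Bs) +_)
        (trans (length-++ (map liftC Cs)) (cong (length (map liftC Cs) +_) (length-replicate spare))))) (hits≤length family ⊤))
      (length-map liftB Bs) (length-map liftC Cs) lenB lenC spare-eq
    att₃ : Attained a b c d (rk N₁ a + t₁ + ∣ A₂ ∪ b ∣ + ∣ d ∣)
    att₃ = let a′ , le = proj₂ presB a ; W = at q a′ A₂ ⊤ ⊥ in
      attain-at a b c d a′ A₂ ⊤ ⊥ (arith (2 ∷ 2 ∷ 1 ∷ 1 ∷ []) 12
        (λ a a′ b A₂ c d h k r₁ r₂ e lC x t g hB hC hE → h ≈ hB ⊕ (hC ⊕ hE) ∷ hB ≈ g ∷ hC ≲ lC ∷ lC ≈ r₂ ∷ hE ≲ e ∷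
          e ⊕ (r₁ ⊕ r₂) ≈ k ∷ t ⊕ r₁ ⊕ # A₂ ≈ k ∷ g ⊕ # (a ⋒ ∁′ a′) ≲ x ∷ [] ⊢
          h ⊕ (# (a ⋒ ∁′ a′) ⊕ (# (b ⋒ ∁′ A₂) ⊕ (# (c ⋒ ∁′ ⊤′) ⊕ # (d ⋒ ∁′ ⊥′)))) ≲ x ⊕ t ⊕ # (A₂ ⋓ b) ⊕ # d)
        a a′ b A₂ c d (hits family W) k (rank N₁) (rank N₂) spare (length Cs) (rk N₁ a) t₁ (hits Bs a′)
        (hits (map liftB Bs) W) (hits (map liftC Cs) W) (hits (replicate spare ⊤) W)
        (hits-family W)
        (hits-map-0 liftB W a′ _ (liftB-eq a′ A₂ ⊤ ⊥) (arith (1 ∷ 1 ∷ []) 0 (λ A d → [] ⊢ # (A ⋒ ∁′ A) ⊕ # (⊥′ {1}) ≈ lit 0) A₂ (⊥ {t₂})) Bs)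
        (subst (hits (map liftC Cs) W ≤_) (length-map liftC Cs) (hits≤length (map liftC Cs) W)) lenC
        (subst (hits (replicate spare ⊤) W ≤_) (length-replicate spare) (hits≤length (replicate spare ⊤) W))
        spare-eq size₁ le)
    att₄ : Attained a b c d (rk N₂ b + t₂ + ∣ A₁ ∪ a ∣ + ∣ c ∣)
    att₄ = let b′ , le = proj₂ presC b ; W = at q A₁ b′ ⊥ ⊤ in
      attain-at a b c d A₁ b′ ⊥ ⊤ (arith (2 ∷ 2 ∷ 1 ∷ 1 ∷ []) 12
        (λ a A₁ b b′ c d h k r₁ r₂ e lB x t g hB hC hE → h ≈ hB ⊕ (hC ⊕ hE) ∷ hC ≈ g ∷ hB ≲ lB ∷ lB ≈ r₁ ∷ hE ≲ e ∷
          e ⊕ (r₁ ⊕ r₂) ≈ k ∷ t ⊕ r₂ ⊕ # A₁ ≈ k ∷ g ⊕ # (b ⋒ ∁′ b′) ≲ x ∷ [] ⊢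
          h ⊕ (# (a ⋒ ∁′ A₁) ⊕ (# (b ⋒ ∁′ b′) ⊕ (# (c ⋒ ∁′ ⊥′) ⊕ # (d ⋒ ∁′ ⊤′)))) ≲ x ⊕ t ⊕ # (A₁ ⋓ a) ⊕ # c)
        a A₁ b b′ c d (hits family W) k (rank N₁) (rank N₂) spare (length Bs) (rk N₂ b) t₂ (hits Cs b′)
        (hits (map liftB Bs) W) (hits (map liftC Cs) W) (hits (replicate spare ⊤) W)
        (hits-family W)
        (hits-map-0 liftC W b′ _ (liftC-eq A₁ b′ ⊥ ⊤) (arith (1 ∷ 1 ∷ []) 0 (λ A c → [] ⊢ # (A ⋒ ∁′ A) ⊕ # (⊥′ {1}) ≈ lit 0) A₁ (⊥ {t₁})) Cs)
        (subst (hits (map liftB Bs) W ≤_) (length-map liftB Bs) (hits≤length (map liftB Bs) W)) lenB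
        (subst (hits (replicate spare ⊤) W ≤_) (length-replicate spare) (hits≤length (replicate spare ⊤) W))
        spare-eq size₂ le)

  amalgam-presents : ∀ r → IsAmalgamRk q k N₁ A₁ N₂ A₂ r → Presents r family
  amalgam-presents r formula = upper , lower
    where
    upper : ∀ X W → r X ≤ hits family W + ∣ X ∩ ∁ W ∣
    upper X W with atView q X | atView q W
    ... | atᵛ a b c d | atᵛ a′ b′ c′ d′ = subst₂ _≤_ (sym (formula a b c d))
      (cong (hits family W +_) (sym (at-─ q a b c d a′ b′ c′ d′))) (value≤ a b c d a′ b′ c′ d′)
    lower : ∀ X → ∃ λ W → hits family W + ∣ X ∩ ∁ W ∣ ≤ r X
    lower X with atView q X
    ... | atᵛ a b c d = subst (Attained a b c d) (sym (formula a b c d)) (value-attained a b c d)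

  -- This supplies the construction itself for transversal N₁ and N₂, as the gammoid case needs: the
  -- transversal matroid of `family` has the required rank function.
  presented-isAmalgam : ∀ r → Presents r family → IsAmalgamRk q k N₁ A₁ N₂ A₂ r
  presented-isAmalgam r (upper , lower) a b c d = ≤-antisym
    (let W , le = value-attained a b c d in ≤-trans (upper (at q a b c d) W) le)
    (let W , le = lower (at q a b c d) in ≤-trans (go W) le)
    where
    go : ∀ W → value a b c d ≤ hits family W + ∣ at q a b c d ∩ ∁ W ∣
    go W with atView q W
    ... | atᵛ a′ b′ c′ d′ = subst (value a b c d ≤_)
      (cong (hits family W +_) (sym (at-─ q a b c d a′ b′ c′ d′))) (value≤ a b c d a′ b′ c′ d′)

amalgam-transversal : ∀ {n₁ n₂ t₁ t₂ n} (q : Quad n₁ n₂ t₁ t₂ n) {k N₁ A₁ N₂ A₂} (M : Matroid n) →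
                      Sizes k N₁ A₁ N₂ A₂ t₁ t₂ → IsAmalgamRk q k N₁ A₁ N₂ A₂ (rk M) →
                      IsTransversal N₁ → IsTransversal N₂ → IsTransversal M
amalgam-transversal q {N₁ = N₁} {N₂ = N₂} M sizes formula tr₁ tr₂ =
  let Bs , presB , lenB = transversal⇒tightly-presented N₁ tr₁
      Cs , presC , lenC = transversal⇒tightly-presented N₂ tr₂
      open Presentation q sizes Bs presB lenB Cs presC lenC
  in presented⇒transversal M family (amalgam-presents (rk M) formula)

-- Exchanging the two sides and exchanging U₁ with U₂

min₄-map : ∀ (f : ℕ → ℕ) → (∀ {x y} → x ≤ y → f x ≤ f y) → ∀ a b c d →
           f (min₄ a b c d) ≡ min₄ (f a) (f b) (f c) (f d)
min₄-map f mono a b c d = trans (mono-≤-distrib-⊓ mono (a ⊓ b) (c ⊓ d))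
  (cong₂ _⊓_ (mono-≤-distrib-⊓ mono a b) (mono-≤-distrib-⊓ mono c d))

swap-quad : ∀ {n₁ n₂ t₁ t₂ n} → Quad n₁ n₂ t₁ t₂ n → Quad n₂ n₁ t₂ t₁ n
swap-quad {n₁} {n₂} {t₁} {t₂} q =
  quad (exchᵢ n₂ n₁ (t₂ + t₁) ⨾ (idᵢ {n₁} ⊕ᵢ (idᵢ {n₂} ⊕ᵢ swapᵢ t₂ t₁)) ⨾ iso q)

at-swap-quad : ∀ {n₁ n₂ t₁ t₂ n} (q : Quad n₁ n₂ t₁ t₂ n) a b c d → at (swap-quad q) b a d c ≡ at q a b c d
at-swap-quad {n₁} {n₂} {t₁} {t₂} q a b c d = cong (to (iso q)) (trans
  (cong (to (idᵢ {n₁} ⊕ᵢ (idᵢ {n₂} ⊕ᵢ swapᵢ t₂ t₁))) (exch-++ b a (d ++ c)))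
  (trans (⊕-to (idᵢ {n₁}) (idᵢ {n₂} ⊕ᵢ swapᵢ t₂ t₁) a (b ++ (d ++ c))) (cong (a ++_)
  (trans (⊕-to (idᵢ {n₂}) (swapᵢ t₂ t₁) b (d ++ c)) (cong (b ++_) (flip++-++ d c))))))

flip-quad : ∀ {n₁ n₂ t₁ t₂ n} → Quad n₁ n₂ t₁ t₂ n → Quad n₁ n₂ t₂ t₁ n
flip-quad {n₁} {n₂} {t₁} {t₂} q = quad ((idᵢ {n₁} ⊕ᵢ (idᵢ {n₂} ⊕ᵢ swapᵢ t₂ t₁)) ⨾ iso q)

at-flip-quad : ∀ {n₁ n₂ t₁ t₂ n} (q : Quad n₁ n₂ t₁ t₂ n) a b c d → at (flip-quad q) a b d c ≡ at q a b c d
at-flip-quad {n₁} {n₂} {t₁} {t₂} q a b c d = cong (to (iso q))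
  (trans (⊕-to (idᵢ {n₁}) (idᵢ {n₂} ⊕ᵢ swapᵢ t₂ t₁) a (b ++ (d ++ c))) (cong (a ++_)
  (trans (⊕-to (idᵢ {n₂}) (swapᵢ t₂ t₁) b (d ++ c)) (cong (b ++_) (flip++-++ d c)))))

swap-isAmalgam : ∀ {n₁ n₂ t₁ t₂ n} (q : Quad n₁ n₂ t₁ t₂ n) {k} N₁ A₁ N₂ A₂ r →
                 IsAmalgamRk q k N₁ A₁ N₂ A₂ r → IsAmalgamRk (swap-quad q) k N₂ A₂ N₁ A₁ r
swap-isAmalgam q {k} N₁ A₁ N₂ A₂ r formula b a d c =
  trans (cong r (at-swap-quad q a b c d)) (trans (formula a b c d) (sym (swap-amalgamRk k N₁ A₁ N₂ A₂ a b c d)))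

-- Recovering N₁ from M

module _ {n₁ n₂ t₁ t₂ n} (q : Quad n₁ n₂ t₁ t₂ n) {k N₁ A₁ N₂ A₂} (M : Matroid n)
         (sizes : Sizes k N₁ A₁ N₂ A₂ t₁ t₂) (formula : IsAmalgamRk q k N₁ A₁ N₂ A₂ (rk M)) where
  open Sizes sizes

  -- This keeps the fourth term of the rank formula from being the smallest on sets inside R₁ ∪ U₁ ∪
  -- A₂.
  nullity-A₂≤t₂ : ∣ A₂ ∣ ≤ t₂ + rk N₂ A₂
  nullity-A₂≤t₂ = arith (1 ∷ 1 ∷ []) 6
    (λ A₁ A₂ r₁ r₂ x y k t → t ⊕ r₂ ⊕ # A₁ ≈ k ∷ r₁ ⊕ # A₁ ⊕ (r₂ ⊕ # A₂) ≲ k ⊕ (x ⊕ y) ∷ x ≲ r₁ ∷ [] ⊢ # A₂ ≲ t ⊕ y)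
    A₁ A₂ (rank N₁) (rank N₂) (rk N₁ A₁) (rk N₂ A₂) k t₂ size₂ room (rk≤rank N₁ A₁)

  -- On Y ∪ U₁ ∪ A₂ the third term is the least of the four. For Y empty this says that U₁ ∪ A₂ is
  -- independent.
  N₁-as-contraction : ∀ Y → rk M (at q Y A₂ ⊤ ⊥) ≡ rk N₁ Y + (t₁ + ∣ A₂ ∣)
  N₁-as-contraction Y = trans (formula Y A₂ ⊤ ⊥) (≤-antisym
    (≤-trans (min₄≤₃ _ _ _ _) (arith (1 ∷ 1 ∷ []) 2
      (λ A d r t → [] ⊢ r ⊕ t ⊕ # (A ⋓ A) ⊕ # (⊥′ {1}) ≲ r ⊕ (t ⊕ # A)) A₂ (⊥ {t₂}) (rk N₁ Y) t₁))
    (min₄-sel _ _ _ _ (rk N₁ Y + (t₁ + ∣ A₂ ∣) ≤_)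
      (arith (1 ∷ 1 ∷ 1 ∷ 1 ∷ []) 2
        (λ Y A c d r t → r ≲ # Y ∷ # (⊤′ {2}) ≈ t ∷ [] ⊢ r ⊕ (t ⊕ # A) ≲ # Y ⊕ (# A ⊕ (# (⊤′ {2}) ⊕ # (⊥′ {3}))))
        Y A₂ (⊤ {t₁}) (⊥ {t₂}) (rk N₁ Y) t₁ (rk-bound N₁ Y) (∣⊤∣≡n t₁))
      (arith (1 ∷ []) 4 (λ A r r₁ t k → t ⊕ r₁ ⊕ # A ≈ k ∷ r ≲ r₁ ∷ [] ⊢ r ⊕ (t ⊕ # A) ≲ k)
        A₂ (rk N₁ Y) (rank N₁) t₁ k size₁ (rk≤rank N₁ Y))
      (arith (1 ∷ 1 ∷ []) 2
        (λ A d r t → [] ⊢ r ⊕ (t ⊕ # A) ≲ r ⊕ t ⊕ # (A ⋓ A) ⊕ # (⊥′ {1})) A₂ (⊥ {t₂}) (rk N₁ Y) t₁)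
      (arith (2 ∷ 1 ∷ 1 ∷ []) 4
        (λ A₁ Y A₂ c r t y t₂ → r ≲ # Y ∷ # (⊤′ {2}) ≈ t ∷ # A₂ ≲ t₂ ⊕ y ∷ [] ⊢
          r ⊕ (t ⊕ # A₂) ≲ y ⊕ t₂ ⊕ # (A₁ ⋓ Y) ⊕ # (⊤′ {2}))
        A₁ Y A₂ (⊤ {t₁}) (rk N₁ Y) t₁ (rk N₂ A₂) t₂ (rk-bound N₁ Y) (∣⊤∣≡n t₁) nullity-A₂≤t₂)))

  -- Members meeting U₁ ∪ A₂ contribute a constant, since they are met by every W ∪ U₁ ∪ A₂.
  contract-family : (Ds : List (Subset n)) → ∃ λ L → ∀ W → hits Ds (at q W A₂ ⊤ ⊥) ≡ hits L W + hits Ds (at q ⊥ A₂ ⊤ ⊥)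
  contract-family [] = [] , λ _ → refl
  contract-family (D ∷ Ds) with contract-family Ds | atView q D
  ... | L , hit | atᵛ x y u v = cases (0-or-pos o)
    where
    o = ∣ y ∩ A₂ ∣ + (∣ u ∩ ⊤ ∣ + ∣ v ∩ ⊥ ∣)
    card : ∀ W → ∣ at q x y u v ∩ at q W A₂ ⊤ ⊥ ∣ ≡ ∣ x ∩ W ∣ + o
    card W = trans (cong ∣_∣ (at-∩ q x y u v W A₂ ⊤ ⊥)) (at-card q (x ∩ W) (y ∩ A₂) (u ∩ ⊤) (v ∩ ⊥))
    cases : o ≡ 0 ⊎ 1 ≤ o → ∃ λ L → ∀ W → meets (at q x y u v) (at q W A₂ ⊤ ⊥) + hits Ds (at q W A₂ ⊤ ⊥) ≡
            hits L W + (meets (at q x y u v) (at q ⊥ A₂ ⊤ ⊥) + hits Ds (at q ⊥ A₂ ⊤ ⊥))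
    cases (inj₁ o≡0) = x ∷ L , λ W → arith [] 6
      (λ m h m′ l z p → m ≈ m′ ∷ z ≈ lit 0 ∷ h ≈ l ⊕ p ∷ [] ⊢ m ⊕ h ≈ (m′ ⊕ l) ⊕ (z ⊕ p))
      _ (hits Ds (at q W A₂ ⊤ ⊥)) (meets x W) (hits L W) (meets (at q x y u v) (at q ⊥ A₂ ⊤ ⊥)) (hits Ds (at q ⊥ A₂ ⊤ ⊥))
      (cong (1 ⊓_) (trans (card W) (trans (cong (∣ x ∩ W ∣ +_) o≡0) (+-identityʳ _))))
      (cong (1 ⊓_) (trans (card ⊥) (cong₂ _+_ (trans (cong ∣_∣ (∩-zeroʳ x)) (∣⊥∣≡0 n₁)) o≡0)))
      (hit W)
    cases (inj₂ 1≤o) = L , λ W → arith [] 5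
      (λ m h l z p → m ≈ lit 1 ∷ z ≈ lit 1 ∷ h ≈ l ⊕ p ∷ [] ⊢ m ⊕ h ≈ l ⊕ (z ⊕ p))
      _ (hits Ds (at q W A₂ ⊤ ⊥)) (hits L W) _ (hits Ds (at q ⊥ A₂ ⊤ ⊥)) (met W) (met ⊥) (hit W)
      where
      met : ∀ W → meets (at q x y u v) (at q W A₂ ⊤ ⊥) ≡ 1
      met W = meets≡1 (at q x y u v) (at q W A₂ ⊤ ⊥) (subst (1 ≤_) (sym (card W)) (≤-trans 1≤o (m≤n+m o ∣ x ∩ W ∣)))

  -- A minimal dependent set W of N₁ together with U₁ ∪ A₂ is a circuit of M, so
  -- the only set violating Hall's condition inside W ∪ U₁ ∪ A₂ is the whole set.
  N₁-transversal : IsTransversal M → IsTransversal N₁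
  N₁-transversal tr = hallPresented⇒transversal {r = rk N₁} (L ++ˡ replicate e ⊤) λ Y → indep⇒hall Y , hall⇒indep Y
    where
    Ds = proj₁ (transversal⇒presented M tr)
    upper = proj₁ (proj₂ (transversal⇒presented M tr))
    lower = proj₂ (proj₂ (transversal⇒presented M tr))
    L = proj₁ (contract-family Ds)
    P = hits Ds (at q ⊥ A₂ ⊤ ⊥)
    s = t₁ + ∣ A₂ ∣
    rk≤hits : ∀ X → rk M X ≤ hits Ds X
    rk≤hits X = arith (1 ∷ []) 2 (λ X r h → r ≲ h ⊕ # (X ⋒ ∁′ X) ∷ [] ⊢ r ≲ h) X (rk M X) (hits Ds X) (upper X X)
    s≤P : s ≤ P
    s≤P = ≤-trans (m≤n+m s (rk N₁ ⊥)) (subst (_≤ P) (N₁-as-contraction ⊥) (rk≤hits (at q ⊥ A₂ ⊤ ⊥)))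
    -- Of the P members meeting U₁ ∪ A₂, s are used up in matching that independent set; the surplus
    -- is replaced by copies of R₁.
    e = P ∸ s
    e+s≡P : e + s ≡ P
    e+s≡P = m∸n+n≡m s≤P
    indep⇒hall : ∀ Y → Independent N₁ Y → HallCondition (L ++ˡ replicate e ⊤) Y
    indep⇒hall Y ind W W⊆Y with 0-or-pos ∣ W ∣
    ... | inj₁ empty = ≤-trans (≤-reflexive empty) z≤n
    ... | inj₂ pos = arith [] 10
      (λ w r x h l e p s f g → r ≈ w ∷ x ≈ r ⊕ s ∷ x ≲ h ∷ h ≈ l ⊕ p ∷ e ⊕ s ≈ p ∷ f ≈ l ⊕ g ∷ g ≈ e ∷ [] ⊢ w ≲ f)
      ∣ W ∣ (rk N₁ W) (rk M (at q W A₂ ⊤ ⊥)) (hits Ds (at q W A₂ ⊤ ⊥)) (hits L W) e P s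
      (hits (L ++ˡ replicate e ⊤) W) (hits (replicate e ⊤) W)
      (indep-⊆ N₁ W⊆Y ind) (N₁-as-contraction W) (rk≤hits (at q W A₂ ⊤ ⊥)) (proj₂ (contract-family Ds) W) e+s≡P
      (hits-++ L (replicate e ⊤) W)
      (hits-replicate e ⊤ W (subst (1 ≤_) (sym (cong ∣_∣ (∩-identityˡ W))) pos))
    hall⇒indep : ∀ Y → HallCondition (L ++ˡ replicate e ⊤) Y → Independent N₁ Y
    hall⇒indep Y hall with rk N₁ Y ≟ ∣ Y ∣
    ... | yes ind = ind
    ... | no dep with argmin (λ V → (V ⊆? Y) ×-dec (rk N₁ V <? ∣ V ∣)) ∣_∣ (Y , ⊆-refl , ≤∧≢⇒< (rk-bound N₁ Y) dep)
    ...   | W , (W⊆Y , W-dep) , minimal = contradiction (inside V refl) (n≮n 0)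
      where
      X = at q W A₂ ⊤ ⊥
      V = proj₁ (lower X)
      V-le : hits Ds V + ∣ X ∩ ∁ V ∣ ≤ rk M X
      V-le = proj₂ (lower X)
      nullity≤1 : ∣ W ∣ ≤ suc (rk N₁ W)
      nullity≤1 with 0<∣X∣⇒Nonempty W (≤-trans (s≤s z≤n) W-dep)
      -- With nullity two or more, deleting any point of W would leave a smaller dependent set.
      ... | x , x∈W = ≮⇒≥ λ big → n≮n 0 (arith (2 ∷ []) 0
        (λ W x → # x ≈ lit 1 ∷ x ⊑ W ∷ # W ≲ # (W ⋒ ∁′ x) ∷ [] ⊢ lit 1 ≲ lit 0) W ⁅ x ⁆
        (∣⁅x⁆∣≡1 x) (⁅x⁆⊆ x∈W)
        (minimal (W ∩ ∁ ⁅ x ⁆) ((λ y∈ → W⊆Y (p∩q⊆p W (∁ ⁅ x ⁆) y∈)) , arith (2 ∷ []) 2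
          (λ W x r r′ → # x ≈ lit 1 ∷ x ⊑ W ∷ lit 2 ⊕ r ≲ # W ∷ r′ ≲ r ∷ [] ⊢ lit 1 ⊕ r′ ≲ # (W ⋒ ∁′ x))
          W ⁅ x ⁆ (rk N₁ W) (rk N₁ (W ∩ ∁ ⁅ x ⁆)) (∣⁅x⁆∣≡1 x) (⁅x⁆⊆ x∈W) big (rk-mono N₁ (p∩q⊆p W (∁ ⁅ x ⁆))))))
      X-card : ∣ X ∣ ≡ ∣ W ∣ + s
      X-card = trans (at-card q W A₂ ⊤ ⊥) (arith (1 ∷ 1 ∷ 1 ∷ 1 ∷ []) 1
        (λ W A c d t → # (⊤′ {2}) ≈ t ∷ [] ⊢ # W ⊕ (# A ⊕ (# (⊤′ {2}) ⊕ # (⊥′ {3}))) ≈ # W ⊕ (t ⊕ # A))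
        W A₂ (⊤ {t₁}) (⊥ {t₂}) t₁ (∣⊤∣≡n t₁))
      V-violates : hits Ds V < ∣ V ∩ X ∣
      V-violates = arith (2 ∷ []) 5
        (λ X V h x r w s → h ⊕ # (X ⋒ ∁′ V) ≲ x ∷ x ≈ r ⊕ s ∷ lit 1 ⊕ r ≲ w ∷ # X ≈ w ⊕ s ∷ [] ⊢ lit 1 ⊕ h ≲ # (V ⋒ X))
        X V (hits Ds V) (rk M X) (rk N₁ W) ∣ W ∣ s V-le (N₁-as-contraction W) W-dep X-card
      -- V is generalised to a variable so that its decomposition can be matched while the facts
      -- about V stay untouched.
      inside : ∀ V′ → V′ ≡ V → 1 ≤ 0
      inside V′ eq with atView q V′
      -- Once X lies in V, hits(X) ≤ hits(V) < |X| = |W| + s. Since hits(X) is the count of `L` on W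
      -- plus e + s, this contradicts Hall's condition for W.
      ... | atᵛ a b c d = arith [] 9
        (λ hX hV vx w s l p e f → hX ≲ hV ∷ lit 1 ⊕ hV ≲ vx ∷ vx ≈ w ⊕ s ∷ hX ≈ l ⊕ p ∷ e ⊕ s ≈ p ∷ w ≲ f ∷ f ≲ l ⊕ e ∷ [] ⊢
          lit 1 ≲ lit 0)
        (hits Ds X) (hits Ds V) ∣ V ∩ X ∣ ∣ W ∣ s (hits L W) P e (hits (L ++ˡ replicate e ⊤) W)
        (hits-mono Ds X⊆V) V-violates (trans (cong ∣_∣ VX≡X) X-card) (proj₂ (contract-family Ds) W) e+s≡P (hall W W⊆Y)
        (≤-trans (≤-reflexive (hits-++ L (replicate e ⊤) W)) (+-monoʳ-≤ (hits L W)
          (subst (hits (replicate e ⊤) W ≤_) (length-replicate e) (hits≤length (replicate e ⊤) W))))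
        where
        VX = at q (a ∩ W) (b ∩ A₂) (c ∩ ⊤) (d ∩ ⊥)
        VX-eq : V ∩ X ≡ VX
        VX-eq = trans (cong (_∩ X) (sym eq)) (at-∩ q a b c d W A₂ ⊤ ⊥)
        size = ∣ a ∩ W ∣ + (∣ b ∩ A₂ ∣ + (∣ c ∩ ⊤ ∣ + ∣ d ∩ ⊥ ∣))
        VX-card : ∣ V ∩ X ∣ ≡ size
        VX-card = trans (cong ∣_∣ VX-eq) (at-card q (a ∩ W) (b ∩ A₂) (c ∩ ⊤) (d ∩ ⊥))
        small : rk N₁ (a ∩ W) + s < size
        -- V ∩ X is dependent in M, so one of the four terms is below its size. The first is the
        -- size itself, and the fourth is excluded because the nullity of b ∩ A₂ is at most that of
        -- A₂; the other two both give the claim.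
        small = min₄-sel _ _ _ _ (λ m → m < size → rk N₁ (a ∩ W) + s < size)
          (λ lt → contradiction lt (n≮n size))
          (λ lt → arith [] 6 (λ k z r r₁ t A → lit 1 ⊕ k ≲ z ∷ t ⊕ r₁ ⊕ A ≈ k ∷ r ≲ r₁ ∷ [] ⊢ lit 1 ⊕ (r ⊕ (t ⊕ A)) ≲ z)
            k size (rk N₁ (a ∩ W)) (rank N₁) t₁ ∣ A₂ ∣ lt size₁ (rk≤rank N₁ (a ∩ W)))
          (λ lt → arith (2 ∷ 1 ∷ []) 3
            (λ b A d r t z → lit 1 ⊕ (r ⊕ t ⊕ # (A ⋓ (b ⋒ A)) ⊕ # (d ⋒ ⊥′)) ≲ z ∷ [] ⊢ lit 1 ⊕ (r ⊕ (t ⊕ # A)) ≲ z)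
            b A₂ d (rk N₁ (a ∩ W)) t₁ size lt)
          (λ lt → contradiction (arith (3 ∷ 2 ∷ 1 ∷ 1 ∷ []) 3
            (λ a W A₁ b A₂ c d t y₀ y → lit 1 ⊕ (y ⊕ t ⊕ # (A₁ ⋓ (a ⋒ W)) ⊕ # (c ⋒ ⊤′)) ≲
               # (a ⋒ W) ⊕ (# (b ⋒ A₂) ⊕ (# (c ⋒ ⊤′) ⊕ # (d ⋒ ⊥′))) ∷ # A₂ ≲ t ⊕ y₀ ∷ # (b ⋒ A₂) ⊕ y₀ ≲ # A₂ ⊕ y ∷ [] ⊢
               lit 1 ≲ lit 0)
            a W A₁ b A₂ c d t₂ (rk N₂ A₂) (rk N₂ (b ∩ A₂)) lt nullity-A₂≤t₂ (nullity-mono N₂ (p∩q⊆q b A₂))) (n≮n 0))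
          (≤-trans (s≤s (≤-trans (≤-reflexive (sym (formula (a ∩ W) (b ∩ A₂) (c ∩ ⊤) (d ∩ ⊥))))
              (≤-trans (rk≤hits VX) (hits-mono Ds (λ x∈ → p∩q⊆p V X (subst (_ ∈_) (sym VX-eq) x∈))))))
            (≤-trans V-violates (≤-reflexive VX-card)))
        W≤ : ∣ W ∣ ≤ ∣ a ∩ W ∣
        W≤ = minimal (a ∩ W) ((λ x∈ → W⊆Y (p∩q⊆q a W x∈)) , arith (2 ∷ 2 ∷ 1 ∷ 1 ∷ []) 2
          (λ a W b A c d r t → lit 1 ⊕ (r ⊕ (t ⊕ # A)) ≲ # (a ⋒ W) ⊕ (# (b ⋒ A) ⊕ (# (c ⋒ ⊤′) ⊕ # (d ⋒ ⊥′))) ∷ # c ≲ t ∷ [] ⊢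
            lit 1 ⊕ r ≲ # (a ⋒ W)) a W b A₂ c d (rk N₁ (a ∩ W)) t₁ small (∣p∣≤n c))
        aW : a ∩ W ≡ W
        aW = arith (2 ∷ []) 0 (λ a W → # W ≲ # (a ⋒ W) ∷ [] ⊢ a ⋒ W ≐ W) a W W≤
        full : ∣ A₂ ∣ + t₁ ≤ ∣ b ∩ A₂ ∣ + ∣ c ∣
        -- W has nullity at most one, so a single missing point of U₁ ∪ A₂ would already destroy the
        -- dependence.
        full = arith (2 ∷ 2 ∷ 1 ∷ 1 ∷ []) 3
          (λ a W b A c d r r′ t → lit 1 ⊕ (r ⊕ (t ⊕ # A)) ≲ # (a ⋒ W) ⊕ (# (b ⋒ A) ⊕ (# (c ⋒ ⊤′) ⊕ # (d ⋒ ⊥′))) ∷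
            r ≈ r′ ∷ # W ≲ lit 1 ⊕ r′ ∷ [] ⊢ # A ⊕ t ≲ # (b ⋒ A) ⊕ # c)
          a W b A₂ c d (rk N₁ (a ∩ W)) (rk N₁ W) t₁ small (cong (rk N₁) aW) nullity≤1
        bA : b ∩ A₂ ≡ A₂
        bA = arith (2 ∷ 1 ∷ []) 1 (λ b A c t → # A ⊕ t ≲ # (b ⋒ A) ⊕ # c ∷ # c ≲ t ∷ [] ⊢
          b ⋒ A ≐ A) b A₂ c t₁ full (∣p∣≤n c)
        c⊤ : c ∩ ⊤ ≡ ⊤
        c⊤ = arith (2 ∷ 1 ∷ []) 1 (λ b A c t → # A ⊕ t ≲ # (b ⋒ A) ⊕ # c ∷ # (⊤′ {1}) ≈ t ∷ [] ⊢
          c ⋒ ⊤′ ≐ ⊤′) b A₂ c t₁ full (∣⊤∣≡n t₁)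
        VX≡X : V ∩ X ≡ X
        VX≡X = trans VX-eq (trans (cong₂ (λ x y → at q x y (c ∩ ⊤) (d ∩ ⊥)) aW bA)
                                  (cong₂ (at q W A₂) c⊤ (∩-zeroʳ d)))
        X⊆V : X ⊆ V
        X⊆V x∈ = p∩q⊆p V X (subst (_ ∈_) (sym VX≡X) x∈)

-- From the prescribed cyclic flats to the rank formula

module _ {n₁ n₂ t₁ t₂ k} {N₁ : Matroid n₁} {A₁} {N₂ : Matroid n₂} {A₂} (M : Matroid (n₁ + (n₂ + (t₁ + t₂))))
         (sizes : Sizes k N₁ A₁ N₂ A₂ t₁ t₂) (isMk : IsMk {n₁} {n₂} {t₁} {t₂} k N₁ A₁ N₂ A₂ M) where
  open Sizes sizes

  private
    classify : ∀ Z → IsCyclicFlat M Z → _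
    classify Z = proj₁ (proj₁ isMk Z)
    rank≡k : rank M ≡ k
    rank≡k = proj₁ (proj₂ (proj₂ isMk))
    rk-type₁ : ∀ F → IsNPCyclicFlat N₁ F → rk M (join F A₂ (⊤ {t₁}) (⊥ {t₂})) ≡ rk N₁ F + t₁ + ∣ A₂ ∣
    rk-type₁ = proj₁ (proj₂ (proj₂ (proj₂ isMk)))
    rk-type₂ : ∀ F → IsNPCyclicFlat N₂ F → rk M (join A₁ F (⊥ {t₁}) (⊤ {t₂})) ≡ rk N₂ F + t₂ + ∣ A₁ ∣
    rk-type₂ = proj₂ (proj₂ (proj₂ (proj₂ isMk)))
    Q : Quad n₁ n₂ t₁ t₂ (n₁ + (n₂ + (t₁ + t₂)))
    Q = quad idᵢ

    rk≤card : ∀ a b (c : Subset t₁) (d : Subset t₂) → rk M (at Q a b c d) ≤ ∣ a ∣ + (∣ b ∣ + (∣ c ∣ + ∣ d ∣))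
    rk≤card a b c d = ≤-trans (rk-bound M (at Q a b c d)) (≤-reflexive (at-card Q a b c d))

    rk≤k : ∀ X → rk M X ≤ k
    rk≤k X = ≤-trans (rk≤rank M X) (≤-reflexive rank≡k)

    -- Let F be a cyclic flat of N₁ attaining the rank of a. If F is empty or all of R₁, no flat F ∪
    -- U₁ ∪ A₂ is prescribed, but then |X| or k, respectively, is at most the third term.
    rk≤₃ : ∀ a b (c : Subset t₁) (d : Subset t₂) → rk M (at Q a b c d) ≤ rk N₁ a + t₁ + ∣ A₂ ∪ b ∣ + ∣ d ∣
    rk≤₃ a b c d with cyclic-flat-attaining-rk N₁ a
    ... | F , cf , att with ≡-dec _≟ᵇ_ F ⊥ | ≡-dec _≟ᵇ_ F ⊤
    ...   | yes refl | _ = ≤-trans (rk≤card a b c d) (arith (1 ∷ 2 ∷ 1 ∷ 1 ∷ []) 3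
      (λ a b A c d r z t → z ⊕ # (a ⋒ ∁′ ⊥′) ≲ r ∷ # c ≲ t ∷ [] ⊢ # a ⊕ (# b ⊕ (# c ⊕ # d)) ≲ r ⊕ t ⊕ # (A ⋓ b) ⊕ # d)
      a b A₂ c d (rk N₁ a) (rk N₁ ⊥) t₁ att (∣p∣≤n c))
    ...   | no _ | yes refl = ≤-trans (rk≤k (at Q a b c d)) (arith (1 ∷ 2 ∷ 1 ∷ []) 4
      (λ a b A d r r₁ t k → t ⊕ r₁ ⊕ # A ≈ k ∷ r₁ ⊕ # (a ⋒ ∁′ ⊤′) ≲ r ∷ [] ⊢ k ≲ r ⊕ t ⊕ # (A ⋓ b) ⊕ # d)
      a b A₂ d (rk N₁ a) (rank N₁) t₁ k size₁ att)
    ...   | no F≢⊥ | no F≢⊤ = arith (2 ∷ 2 ∷ 1 ∷ 1 ∷ []) 6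
      (λ a F b A c d v v′ r r′ t g → v ≲ v′ ⊕ g ∷ g ≈ # (a ⋒ ∁′ F) ⊕ (# (b ⋒ ∁′ A) ⊕ (# (c ⋒ ∁′ ⊤′) ⊕ # (d ⋒ ∁′ ⊥′))) ∷
         v′ ≈ r′ ⊕ t ⊕ # A ∷ r′ ⊕ # (a ⋒ ∁′ F) ≲ r ∷ [] ⊢ v ≲ r ⊕ t ⊕ # (A ⋓ b) ⊕ # d)
      a F b A₂ c d (rk M (at Q a b c d)) (rk M (at Q F A₂ ⊤ ⊥)) (rk N₁ a) (rk N₁ F) t₁ _
      (rk-diff M (at Q a b c d) (at Q F A₂ ⊤ ⊥)) (at-─ Q a b c d F A₂ ⊤ ⊥) (rk-type₁ F (cf , F≢⊥ , F≢⊤)) att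

    rk≤₄ : ∀ a b (c : Subset t₁) (d : Subset t₂) → rk M (at Q a b c d) ≤ rk N₂ b + t₂ + ∣ A₁ ∪ a ∣ + ∣ c ∣
    rk≤₄ a b c d with cyclic-flat-attaining-rk N₂ b
    ... | F , cf , att with ≡-dec _≟ᵇ_ F ⊥ | ≡-dec _≟ᵇ_ F ⊤
    ...   | yes refl | _ = ≤-trans (rk≤card a b c d) (arith (2 ∷ 1 ∷ 1 ∷ 1 ∷ []) 3
      (λ a A b c d r z t → z ⊕ # (b ⋒ ∁′ ⊥′) ≲ r ∷ # d ≲ t ∷ [] ⊢ # a ⊕ (# b ⊕ (# c ⊕ # d)) ≲ r ⊕ t ⊕ # (A ⋓ a) ⊕ # c)
      a A₁ b c d (rk N₂ b) (rk N₂ ⊥) t₂ att (∣p∣≤n d))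
    ...   | no _ | yes refl = ≤-trans (rk≤k (at Q a b c d)) (arith (2 ∷ 1 ∷ 1 ∷ []) 4
      (λ a A b c r r₂ t k → t ⊕ r₂ ⊕ # A ≈ k ∷ r₂ ⊕ # (b ⋒ ∁′ ⊤′) ≲ r ∷ [] ⊢ k ≲ r ⊕ t ⊕ # (A ⋓ a) ⊕ # c)
      a A₁ b c (rk N₂ b) (rank N₂) t₂ k size₂ att)
    ...   | no F≢⊥ | no F≢⊤ = arith (2 ∷ 2 ∷ 1 ∷ 1 ∷ []) 6
      (λ a A b F c d v v′ r r′ t g → v ≲ v′ ⊕ g ∷ g ≈ # (a ⋒ ∁′ A) ⊕ (# (b ⋒ ∁′ F) ⊕ (# (c ⋒ ∁′ ⊥′) ⊕ # (d ⋒ ∁′ ⊤′))) ∷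
         v′ ≈ r′ ⊕ t ⊕ # A ∷ r′ ⊕ # (b ⋒ ∁′ F) ≲ r ∷ [] ⊢ v ≲ r ⊕ t ⊕ # (A ⋓ a) ⊕ # c)
      a A₁ b F c d (rk M (at Q a b c d)) (rk M (at Q A₁ F ⊥ ⊤)) (rk N₂ b) (rk N₂ F) t₂ _
      (rk-diff M (at Q a b c d) (at Q A₁ F ⊥ ⊤)) (at-─ Q a b c d A₁ F ⊥ ⊤) (rk-type₂ F (cf , F≢⊥ , F≢⊤)) att

  -- The rank of X is attained at a cyclic flat, and those are listed by IsMk;
  -- gathering the cyclic flats of each N_i turns their minimum into rk N_i.
  isMk⇒isAmalgam : IsAmalgamRk Q k N₁ A₁ N₂ A₂ (rk M)
  isMk⇒isAmalgam a b c d = ≤-antisym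
    (min₄-sel _ _ _ _ (rk M (at Q a b c d) ≤_) (rk≤card a b c d) (rk≤k (at Q a b c d)) (rk≤₃ a b c d) (rk≤₄ a b c d))
    attained
    where
    attained : amalgamRk k N₁ A₁ N₂ A₂ a b c d ≤ rk M (at Q a b c d)
    attained with cyclic-flat-attaining-rk M (at Q a b c d)
    ... | Z , cf , att with classify Z cf
    ...   | inj₁ refl = ≤-trans (min₄≤₁ _ _ _ _) (≤-trans (≤-reflexive (sym (at-card Q a b c d)))
      (arith (1 ∷ []) 2 (λ X z r → z ⊕ # (X ⋒ ∁′ ⊥′) ≲ r ∷ [] ⊢
        # X ≲ r) (at Q a b c d) (rk M ⊥) (rk M (at Q a b c d)) att))
    ...   | inj₂ (inj₁ refl) = ≤-trans (min₄≤₂ _ _ _ _) (≤-trans (≤-reflexive (sym rank≡k)) (m+n≤o⇒m≤o (rank M) att))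
    ...   | inj₂ (inj₂ (inj₁ (F , np , refl))) = ≤-trans (min₄≤₃ _ _ _ _) (arith (2 ∷ 2 ∷ 1 ∷ 1 ∷ []) 6
      (λ a F b A c d v v′ r r′ t g → v′ ⊕ g ≲ v ∷ g ≈ # (a ⋒ ∁′ F) ⊕ (# (b ⋒ ∁′ A) ⊕ (# (c ⋒ ∁′ ⊤′) ⊕ # (d ⋒ ∁′ ⊥′))) ∷
         v′ ≈ r′ ⊕ t ⊕ # A ∷ r ≲ r′ ⊕ # (a ⋒ ∁′ F) ∷ [] ⊢ r ⊕ t ⊕ # (A ⋓ b) ⊕ # d ≲ v)
      a F b A₂ c d (rk M (at Q a b c d)) (rk M (at Q F A₂ ⊤ ⊥)) (rk N₁ a) (rk N₁ F) t₁ _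
      att (at-─ Q a b c d F A₂ ⊤ ⊥) (rk-type₁ F np) (rk-diff N₁ a F))
    ...   | inj₂ (inj₂ (inj₂ (F , np , refl))) = ≤-trans (min₄≤₄ _ _ _ _) (arith (2 ∷ 2 ∷ 1 ∷ 1 ∷ []) 6
      (λ a A b F c d v v′ r r′ t g → v′ ⊕ g ≲ v ∷ g ≈ # (a ⋒ ∁′ A) ⊕ (# (b ⋒ ∁′ F) ⊕ (# (c ⋒ ∁′ ⊥′) ⊕ # (d ⋒ ∁′ ⊤′))) ∷
         v′ ≈ r′ ⊕ t ⊕ # A ∷ r ≲ r′ ⊕ # (b ⋒ ∁′ F) ∷ [] ⊢ r ⊕ t ⊕ # (A ⋓ a) ⊕ # c ≲ v)
      a A₁ b F c d (rk M (at Q a b c d)) (rk M (at Q A₁ F ⊥ ⊤)) (rk N₂ b) (rk N₂ F) t₂ _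
      att (at-─ Q a b c d A₁ F ⊥ ⊤) (rk-type₂ F np) (rk-diff N₂ b F))

-- Duality

module _ {n} (M : Matroid n) where

  -- The truncated subtraction in `dualRk` is exact, because r(E) ≤ r(E - X) + |X|.
  dualRk+rank : ∀ X → dualRk M X + rank M ≡ ∣ X ∣ + rk M (∁ X)
  dualRk+rank X = m∸n+n≡m (arith (1 ∷ []) 2
    (λ X r r′ → r ≲ r′ ⊕ # (⊤′ ⋒ ∁′ (∁′ X)) ∷ [] ⊢ r ≲ # X ⊕ r′) X (rank M) (rk M (∁ X)) (rk-diff M ⊤ (∁ X)))

  dual : Matroid n
  dual = record
    { rk = dualRk M
    ; rk-bound = λ X → arith (1 ∷ []) 3 (λ X d r r′ → d ⊕ r ≈ # X ⊕ r′ ∷ r′ ≲ r ∷ [] ⊢ d ≲ # X)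
        X (dualRk M X) (rank M) (rk M (∁ X)) (dualRk+rank X) (rk≤rank M (∁ X))
    ; rk-mono = λ {X} {Y} X⊆Y → arith (2 ∷ []) 5
        (λ X Y d e r x y → X ⊑ Y ∷ d ⊕ r ≈ # X ⊕ x ∷ e ⊕ r ≈ # Y ⊕ y ∷ x ≲ y ⊕ # (∁′ X ⋒ ∁′ (∁′ Y)) ∷ [] ⊢ d ≲ e)
        X Y (dualRk M X) (dualRk M Y) (rank M) (rk M (∁ X)) (rk M (∁ Y)) X⊆Y (dualRk+rank X) (dualRk+rank Y)
        (rk-diff M (∁ X) (∁ Y))
    ; rk-submod = λ X Y → arith (2 ∷ []) 11
        (λ X Y u i x y r u′ i′ x′ y′ p q → u ⊕ r ≈ # (X ⋓ Y) ⊕ u′ ∷ i ⊕ r ≈ # (X ⋒ Y) ⊕ i′ ∷ x ⊕ r ≈ # X ⊕ x′ ∷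
           y ⊕ r ≈ # Y ⊕ y′ ∷ u′ ≲ p ∷ i′ ≲ q ∷ q ⊕ p ≲ x′ ⊕ y′ ∷ [] ⊢ u ⊕ i ≲ x ⊕ y)
        X Y (dualRk M (X ∪ Y)) (dualRk M (X ∩ Y)) (dualRk M X) (dualRk M Y) (rank M)
        (rk M (∁ (X ∪ Y))) (rk M (∁ (X ∩ Y))) (rk M (∁ X)) (rk M (∁ Y)) (rk M (∁ X ∩ ∁ Y)) (rk M (∁ X ∪ ∁ Y))
        (dualRk+rank (X ∪ Y)) (dualRk+rank (X ∩ Y)) (dualRk+rank X) (dualRk+rank Y)
        (rk-mono M (arith (2 ∷ []) 0 (λ X Y → [] ⊢ ∁′ (X ⋓ Y) ⊑ ∁′ X ⋒ ∁′ Y) X Y))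
        (rk-mono M (arith (2 ∷ []) 0 (λ X Y → [] ⊢ ∁′ (X ⋒ Y) ⊑ ∁′ X ⋓ ∁′ Y) X Y))
        (rk-submod M (∁ X) (∁ Y))
    }

  rank-dual : rank dual + rank M ≡ n
  rank-dual = trans (dualRk+rank ⊤) (trans (cong₂ _+_ (∣⊤∣≡n n) (n≤0⇒n≡0 (≤-trans (rk-bound M (∁ ⊤))
    (arith (1 ∷ []) 0 (λ X → [] ⊢ # (∁′ (⊤′ {0})) ≲ lit 0) (⊤ {n}))))) (+-identityʳ n))

module _ {n₁ n₂ t₁ t₂ n} (q : Quad n₁ n₂ t₁ t₂ n) {k N₁ A₁ N₂ A₂} (M : Matroid n) (rank≡k : rank M ≡ k)
         (sizes : Sizes k N₁ A₁ N₂ A₂ t₁ t₂) (formula : IsAmalgamRk q k N₁ A₁ N₂ A₂ (rk M)) where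
  open Sizes sizes

  -- This is |E| - k, the rank of the dual, written so that the first size equation holds by
  -- definition.
  k* : ℕ
  k* = t₂ + rank (dual N₁) + ∣ ∁ A₂ ∣

  dual-sizes : Sizes k* (dual N₁) (∁ A₁) (dual N₂) (∁ A₂) t₂ t₁
  dual-sizes = record
    { size₁ = refl
    ; size₂ = arith (1 ∷ 1 ∷ []) 9
        (λ A₁ A₂ r₁ r₂ s₁ s₂ t₁ t₂ k m₁ m₂ → s₁ ⊕ r₁ ≈ m₁ ∷ s₂ ⊕ r₂ ≈ m₂ ∷ t₁ ⊕ r₁ ⊕ # A₂ ≈ k ∷ t₂ ⊕ r₂ ⊕ # A₁ ≈ k ∷
           # (⊤′ {0}) ≈ m₁ ∷ # (⊤′ {1}) ≈ m₂ ∷ [] ⊢ t₁ ⊕ s₂ ⊕ # (∁′ A₁) ≈ t₂ ⊕ s₁ ⊕ # (∁′ A₂))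
        A₁ A₂ (rank N₁) (rank N₂) (rank (dual N₁)) (rank (dual N₂)) t₁ t₂ k n₁ n₂
        (rank-dual N₁) (rank-dual N₂) size₁ size₂ (∣⊤∣≡n n₁) (∣⊤∣≡n n₂)
    -- Given the size equations, this inequality and the original one both amount to k ≤ t₁ + t₂ +
    -- r₁(A₁) + r₂(A₂).
    ; room = arith (1 ∷ 1 ∷ []) 13
        (λ A₁ A₂ r₁ r₂ s₁ s₂ t₂ k m₂ x y x′ y′ x″ y″ → s₂ ⊕ r₂ ≈ m₂ ∷ t₂ ⊕ r₂ ⊕ # A₁ ≈ k ∷
           # (⊤′ {1}) ≈ m₂ ∷ r₁ ⊕ # A₁ ⊕ (r₂ ⊕ # A₂) ≲ k ⊕ (x ⊕ y) ∷
           x′ ⊕ r₁ ≈ # (∁′ A₁) ⊕ x″ ∷ y′ ⊕ r₂ ≈ # (∁′ A₂) ⊕ y″ ∷ x″ ≈ x ∷ y″ ≈ y ∷ [] ⊢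
           s₁ ⊕ # (∁′ A₁) ⊕ (s₂ ⊕ # (∁′ A₂)) ≲ (t₂ ⊕ s₁ ⊕ # (∁′ A₂)) ⊕ (x′ ⊕ y′))
        A₁ A₂ (rank N₁) (rank N₂) (rank (dual N₁)) (rank (dual N₂)) t₂ k n₂
        (rk N₁ A₁) (rk N₂ A₂) (dualRk N₁ (∁ A₁)) (dualRk N₂ (∁ A₂)) (rk N₁ (∁ (∁ A₁))) (rk N₂ (∁ (∁ A₂)))
        (rank-dual N₂) size₂ (∣⊤∣≡n n₂) room
        (dualRk+rank N₁ (∁ A₁)) (dualRk+rank N₂ (∁ A₂)) (cong (rk N₁) (∁∁ A₁)) (cong (rk N₂) (∁∁ A₂))
    }
    where
    ∁∁ : ∀ {m} (A : Subset m) → ∁ (∁ A) ≡ A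
    ∁∁ = arith (1 ∷ []) 0 (λ A → [] ⊢ ∁′ (∁′ A) ≐ A)

  -- The map taking v to |X| + v - k is monotone and so passes through the minimum. It exchanges the
  -- roles of the first two terms and turns each of the others into its dual counterpart.
  dual-isAmalgam : IsAmalgamRk (flip-quad q) k* (dual N₁) (∁ A₁) (dual N₂) (∁ A₂) (dualRk M)
  dual-isAmalgam a b c d = begin
    dualRk M (at (flip-quad q) a b c d)
      ≡⟨ cong (dualRk M) (at-flip-quad q a b d c) ⟩
    (∣ X ∣ + rk M (∁ X)) ∸ rank M
      ≡⟨ cong₂ _∸_ (cong₂ _+_ (at-card q a b d c) (trans (cong (rk M) ∁X) (formula (∁ a) (∁ b) (∁ d) (∁ c)))) rank≡k ⟩
    (x + amalgamRk k N₁ A₁ N₂ A₂ (∁ a) (∁ b) (∁ d) (∁ c)) ∸ k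
      ≡⟨ min₄-map (λ v → (x + v) ∸ k) (λ le → ∸-monoˡ-≤ k (+-monoʳ-≤ x le)) _ _ _ _ ⟩
    min₄ ((x + (∣ ∁ a ∣ + (∣ ∁ b ∣ + (∣ ∁ d ∣ + ∣ ∁ c ∣)))) ∸ k) ((x + k) ∸ k)
         ((x + (rk N₁ (∁ a) + t₁ + ∣ A₂ ∪ ∁ b ∣ + ∣ ∁ c ∣)) ∸ k) ((x + (rk N₂ (∁ b) + t₂ + ∣ A₁ ∪ ∁ a ∣ + ∣ ∁ d ∣)) ∸ k)
      ≡⟨ cong₂ _⊓_ (cong₂ _⊓_ (cancel first) (cancel second)) (cong₂ _⊓_ (cancel third) (cancel fourth)) ⟩
    min₄ k* (∣ a ∣ + (∣ b ∣ + (∣ c ∣ + ∣ d ∣)))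
         (dualRk N₁ a + t₂ + ∣ ∁ A₂ ∪ b ∣ + ∣ d ∣) (dualRk N₂ b + t₁ + ∣ ∁ A₁ ∪ a ∣ + ∣ c ∣)
      ≡⟨ cong (_⊓ ((dualRk N₁ a + t₂ + ∣ ∁ A₂ ∪ b ∣ + ∣ d ∣) ⊓ (dualRk N₂ b + t₁ + ∣ ∁ A₁ ∪ a ∣ + ∣ c ∣))) (⊓-comm k* _) ⟩
    amalgamRk k* (dual N₁) (∁ A₁) (dual N₂) (∁ A₂) a b c d ∎
    where
    open ≡-Reasoning
    X = at q a b d c
    x = ∣ a ∣ + (∣ b ∣ + (∣ d ∣ + ∣ c ∣))
    ∁X : ∁ X ≡ at q (∁ a) (∁ b) (∁ d) (∁ c)
    ∁X = trans (sym (to-∁ (iso q) _)) (cong (to (iso q)) (join-∁ a b d c))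
    cancel : ∀ {u v} → u ≡ v + k → u ∸ k ≡ v
    cancel {v = v} eq = trans (cong (_∸ k) eq) (m+n∸n≡m v k)
    first : x + (∣ ∁ a ∣ + (∣ ∁ b ∣ + (∣ ∁ d ∣ + ∣ ∁ c ∣))) ≡ k* + k
    first = arith (1 ∷ 2 ∷ 1 ∷ 1 ∷ []) 6
      (λ a b A₂ c d s₁ r₁ m₁ t₁ t₂ k → s₁ ⊕ r₁ ≈ m₁ ∷ # (⊤′ {0}) ≈ m₁ ∷ t₁ ⊕ r₁ ⊕ # A₂ ≈ k ∷ # (⊤′ {2}) ≈ t₂ ∷ # (⊤′ {3}) ≈ t₁ ∷ [] ⊢
        # a ⊕ (# b ⊕ (# d ⊕ # c)) ⊕ (# (∁′ a) ⊕ (# (∁′ b) ⊕ (# (∁′ d) ⊕ # (∁′ c)))) ≈ t₂ ⊕ s₁ ⊕ # (∁′ A₂) ⊕ k)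
      a b A₂ c d (rank (dual N₁)) (rank N₁) n₁ t₁ t₂ k (rank-dual N₁) (∣⊤∣≡n n₁) size₁ (∣⊤∣≡n t₂) (∣⊤∣≡n t₁)
    second : x + k ≡ (∣ a ∣ + (∣ b ∣ + (∣ c ∣ + ∣ d ∣))) + k
    second = arith (1 ∷ 1 ∷ 1 ∷ 1 ∷ []) 1
      (λ a b c d k → [] ⊢ # a ⊕ (# b ⊕ (# d ⊕ # c)) ⊕ k ≈ # a ⊕ (# b ⊕ (# c ⊕ # d)) ⊕ k) a b c d k
    third : x + (rk N₁ (∁ a) + t₁ + ∣ A₂ ∪ ∁ b ∣ + ∣ ∁ c ∣) ≡ dualRk N₁ a + t₂ + ∣ ∁ A₂ ∪ b ∣ + ∣ d ∣ + k
    third = arith (1 ∷ 2 ∷ 1 ∷ 1 ∷ []) 6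
      (λ a b A₂ c d r₁ x y t₁ t₂ k → y ⊕ r₁ ≈ # a ⊕ x ∷ t₁ ⊕ r₁ ⊕ # A₂ ≈ k ∷ # (⊤′ {2}) ≈ t₂ ∷ [] ⊢
        # a ⊕ (# b ⊕ (# d ⊕ # c)) ⊕ (x ⊕ t₁ ⊕ # (A₂ ⋓ ∁′ b) ⊕ # (∁′ c)) ≈ y ⊕ t₂ ⊕ # (∁′ A₂ ⋓ b) ⊕ # d ⊕ k)
      a b A₂ c d (rank N₁) (rk N₁ (∁ a)) (dualRk N₁ a) t₁ t₂ k (dualRk+rank N₁ a) size₁ (∣⊤∣≡n t₂)
    fourth : x + (rk N₂ (∁ b) + t₂ + ∣ A₁ ∪ ∁ a ∣ + ∣ ∁ d ∣) ≡ dualRk N₂ b + t₁ + ∣ ∁ A₁ ∪ a ∣ + ∣ c ∣ + k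
    fourth = arith (2 ∷ 1 ∷ 1 ∷ 1 ∷ []) 6
      (λ a A₁ b c d r₂ x y t₁ t₂ k → y ⊕ r₂ ≈ # b ⊕ x ∷ t₂ ⊕ r₂ ⊕ # A₁ ≈ k ∷ # (⊤′ {3}) ≈ t₁ ∷ [] ⊢
        # a ⊕ (# b ⊕ (# d ⊕ # c)) ⊕ (x ⊕ t₂ ⊕ # (A₁ ⋓ ∁′ a) ⊕ # (∁′ d)) ≈ y ⊕ t₁ ⊕ # (∁′ A₁ ⋓ a) ⊕ # c ⊕ k)
      a A₁ b c d (rank N₂) (rk N₂ (∁ b)) (dualRk N₂ b) t₁ t₂ k (dualRk+rank N₂ b) size₂ (∣⊤∣≡n t₁)

-- Gammoids

relabel : ∀ {m n} → SetIso m n → Matroid n → Matroid m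
relabel f M = record
  { rk = λ X → rk M (to f X)
  ; rk-bound = λ X → ≤-trans (rk-bound M (to f X)) (≤-reflexive (to-card f X))
  ; rk-mono = λ {X} {Y} X⊆Y → rk-mono M (to-⊆ X Y X⊆Y)
  ; rk-submod = λ X Y → subst₂ (λ U I → rk M U + rk M I ≤ rk M (to f X) + rk M (to f Y))
      (sym (to-∪ f X Y)) (sym (to-∩ f X Y)) (rk-submod M (to f X) (to f Y))
  }
  where
  to-⊆ : ∀ X Y → X ⊆ Y → to f X ⊆ to f Y
  to-⊆ X Y X⊆Y x∈ = p∩q⊆q (to f X) (to f Y) (subst (_ ∈_)
    (trans (cong (to f) (arith (2 ∷ []) 0 (λ X Y → X ⊑ Y ∷ [] ⊢ X ≐ X ⋒ Y) X Y X⊆Y)) (to-∩ f X Y)) x∈)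

relabel-transversal : ∀ {m n} (f : SetIso m n) (M : Matroid n) → IsTransversal M → IsTransversal (relabel f M)
relabel-transversal f M tr with transversal⇒presented M tr
... | As , upper , lower = presented⇒transversal (relabel f M) (map (from f) As) (upper′ , lower′)
  where
  card-─ : ∀ X W → ∣ to f X ∩ ∁ (to f W) ∣ ≡ ∣ X ∩ ∁ W ∣
  card-─ X W = trans (cong ∣_∣ (trans (cong (to f X ∩_) (sym (to-∁ f W))) (sym (to-∩ f X (∁ W))))) (to-card f (X ∩ ∁ W))
  hit : ∀ W → hits (map (from f) As) W ≡ hits As (to f W)
  hit W = hits-map-cong (from f) (λ A → cong (1 ⊓_) (trans (sym (to-card f (from f A ∩ W)))
    (cong ∣_∣ (trans (to-∩ f (from f A) W) (cong (_∩ to f W) (to-from f A)))))) As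
  upper′ : ∀ X W → rk M (to f X) ≤ hits (map (from f) As) W + ∣ X ∩ ∁ W ∣
  upper′ X W = subst (rk M (to f X) ≤_) (cong₂ _+_ (sym (hit W)) (card-─ X W)) (upper (to f X) (to f W))
  lower′ : ∀ X → ∃ λ W → hits (map (from f) As) W + ∣ X ∩ ∁ W ∣ ≤ rk M (to f X)
  lower′ X = let W , le = lower (to f X) in from f W , subst (_≤ rk M (to f X))
    (cong₂ _+_ (sym (trans (hit (from f W)) (cong (hits As) (to-from f W))))
      (trans (cong (λ V → ∣ to f X ∩ ∁ V ∣) (sym (to-from f W))) (card-─ X (from f W)))) le

⊥++-⊆ : ∀ {m n} (X : Subset m) (Y : Subset n) → ⊥ ++ Y ⊆ X ++ Y
⊥++-⊆ X Y y∈ = p∩q⊆q (⊥ ++ Y) (X ++ Y) (subst (_ ∈_)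
  (sym (trans (∩-++ ⊥ X Y Y) (cong₂ _++_ (∩-zeroˡ X) (∩-idem Y)))) y∈)

[m∸o]∸[n∸o]≡m∸n : ∀ m n o → o ≤ n → (m ∸ o) ∸ (n ∸ o) ≡ m ∸ n
[m∸o]∸[n∸o]≡m∸n m n o o≤n = trans (∸-+-assoc m o (n ∸ o)) (cong (m ∸_) (m+[n∸m]≡n o≤n))

-- Contractions compose: `C` joins the set `D` that is already contracted, and the two corrections
-- by the rank of `D` cancel.
gammoid-contraction : ∀ {a b n} (f : SetIso (a + b) n) (M : Matroid n) (N : Matroid a) (C : Subset b) →
                      (∀ Y → rk N Y ≡ rk M (to f (Y ++ C)) ∸ rk M (to f (⊥ ++ C))) → IsGammoid M → IsGammoid N
gammoid-contraction {a} {b} {n} f M N C minor (m , T , D , tr , rep) =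
  b + m , relabel g T , C ++ D , relabel-transversal g T tr , λ Y → begin
    rk N Y
      ≡⟨ minor Y ⟩
    rk M (to f (Y ++ C)) ∸ rk M (to f (⊥ ++ C))
      ≡⟨ cong₂ _∸_ (rep _) (rep _) ⟩
    (rk T (to f (Y ++ C) ++ D) ∸ rk T (⊥ ++ D)) ∸ (rk T (to f (⊥ ++ C) ++ D) ∸ rk T (⊥ ++ D))
      ≡⟨ [m∸o]∸[n∸o]≡m∸n _ _ _ (rk-mono T (⊥++-⊆ (to f (⊥ ++ C)) D)) ⟩
    rk T (to f (Y ++ C) ++ D) ∸ rk T (to f (⊥ ++ C) ++ D)
      ≡⟨ sym (cong₂ (λ X Z → rk T X ∸ rk T Z) (g-++ Y) (g-++ ⊥)) ⟩
    rk T (to g (Y ++ (C ++ D))) ∸ rk T (to g (⊥ {a} ++ (C ++ D))) ∎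
  where
  open ≡-Reasoning
  g : SetIso (a + (b + m)) (n + m)
  g = symᵢ (assocᵢ a b m) ⨾ (f ⊕ᵢ idᵢ {m})
  g-++ : ∀ Y → to g (Y ++ (C ++ D)) ≡ to f (Y ++ C) ++ D
  g-++ Y = trans (cong (to (f ⊕ᵢ idᵢ {m})) (from-flip (assocᵢ a b m) (assoc-++ Y C D))) (⊕-to f (idᵢ {m}) (Y ++ C) D)

-- Replacing the contracted set by a basis of it.
gammoid-independent : ∀ {n} (N : Matroid n) → IsGammoid N →
  ∃ λ m → ∃ λ (T : Matroid (n + m)) → ∃ λ (C : Subset m) → IsTransversal T × ∀ X → rk T (X ++ C) ≡ rk N X + ∣ C ∣
gammoid-independent {n} N (m , T , K , tr , rep) with basis T (⊥ ++ K)
... | I , I⊆K , ind , spans with splitView n I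
...   | X₀ ++ᵛ C = m , T , C , tr , λ X → trans (≤-antisym (rk-mono T (mono X)) (same X)) (sym (begin
      rk N X + ∣ C ∣                                      ≡⟨ cong₂ _+_ (rep X) (sym card) ⟩
      (rk T (X ++ K) ∸ rk T (⊥ ++ K)) + rk T (⊥ ++ K)     ≡⟨ m∸n+n≡m (rk-mono T (⊥++-⊆ X K)) ⟩
      rk T (X ++ K)                                       ∎))
  where
  open ≡-Reasoning
  inter : (X₀ ∩ ⊥) ++ (C ∩ K) ≡ X₀ ++ C
  inter = trans (sym (∩-++ X₀ ⊥ C K))
    (arith (2 ∷ []) 0 (λ I K → I ⊑ K ∷ [] ⊢ I ⋒ K ≐ I) (X₀ ++ C) (⊥ ++ K) I⊆K)
  X₀≡⊥ : X₀ ≡ ⊥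
  X₀≡⊥ = trans (sym (++-injectiveˡ (X₀ ∩ ⊥) X₀ inter)) (∩-zeroʳ X₀)
  C∩K : C ∩ K ≡ C
  C∩K = ++-injectiveʳ (X₀ ∩ ⊥) X₀ inter
  mono : ∀ X → X ++ C ⊆ X ++ K
  mono X x∈ = p∩q⊆q (X ++ C) (X ++ K) (subst (_ ∈_) (sym (trans (∩-++ X X C K) (cong₂ _++_ (∩-idem X) C∩K))) x∈)
  card : rk T (⊥ ++ K) ≡ ∣ C ∣
  card = trans (sym spans) (trans ind (trans (cong (λ Z → ∣ Z ++ C ∣) X₀≡⊥)
    (trans (∣++∣ (⊥ {n}) C) (cong (_+ ∣ C ∣) (∣⊥∣≡0 n)))))
  same : ∀ X → rk T (X ++ K) ≤ rk T (X ++ C)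
  same X = arith [] 6 (λ x u i c k I → x ≲ u ∷ I ≲ i ∷ u ⊕ i ≲ c ⊕ k ∷ I ≈ k ∷ [] ⊢ x ≲ c)
    (rk T (X ++ K)) (rk T ((X ++ C) ∪ (⊥ ++ K))) (rk T ((X ++ C) ∩ (⊥ ++ K))) (rk T (X ++ C)) (rk T (⊥ ++ K)) (rk T (⊥ ++ C))
    (rk-mono T λ {x} x∈ → subst (x ∈_) (sym union) x∈)
    (rk-mono T λ {x} x∈ → subst (x ∈_) (sym meet) x∈)
    (rk-submod T (X ++ C) (⊥ ++ K))
    (trans (cong (λ Z → rk T (Z ++ C)) (sym X₀≡⊥)) spans)
    where
    union : (X ++ C) ∪ (⊥ ++ K) ≡ X ++ K
    union = trans (∪-++ X ⊥ C K) (cong₂ _++_ (∪-identityʳ X)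
      (arith (2 ∷ []) 0 (λ C K → C ⋒ K ≐ C ∷ [] ⊢ C ⋓ K ≐ K) C K C∩K))
    meet : (X ++ C) ∩ (⊥ ++ K) ≡ ⊥ ++ C
    meet = trans (∩-++ X ⊥ C K) (cong₂ _++_ (∩-zeroʳ X) C∩K)

module _ {n₁ n₂ t₁ t₂ n} (q : Quad n₁ n₂ t₁ t₂ n) (m₁ m₂ : ℕ) where

  extend-quad : Quad (n₁ + m₁) (n₂ + m₂) t₁ t₂ (n + (m₁ + m₂))
  extend-quad = quad ((idᵢ {n₁ + m₁} ⊕ᵢ rotateᵢ n₂ m₂ (t₁ + t₂)) ⨾
                      interchangeᵢ n₁ m₁ (n₂ + (t₁ + t₂)) m₂ ⨾ (iso q ⊕ᵢ idᵢ {m₁ + m₂}))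

  at-extend-quad : ∀ a b c d x y → at extend-quad (a ++ x) (b ++ y) c d ≡ at q a b c d ++ (x ++ y)
  at-extend-quad a b c d x y = begin
    F (G (to (idᵢ {n₁ + m₁} ⊕ᵢ rotateᵢ n₂ m₂ (t₁ + t₂)) ((a ++ x) ++ ((b ++ y) ++ (c ++ d)))))
      ≡⟨ cong (F ∘ G) (trans (⊕-to (idᵢ {n₁ + m₁}) (rotateᵢ n₂ m₂ (t₁ + t₂)) (a ++ x) ((b ++ y) ++ (c ++ d)))
                             (cong ((a ++ x) ++_) (rotate-++ b y (c ++ d)))) ⟩
    F (G ((a ++ x) ++ ((b ++ (c ++ d)) ++ y)))
      ≡⟨ cong F (interchange-++ a x (b ++ (c ++ d)) y) ⟩
    F (join a b c d ++ (x ++ y))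
      ≡⟨ ⊕-to (iso q) (idᵢ {m₁ + m₂}) (join a b c d) (x ++ y) ⟩
    at q a b c d ++ (x ++ y) ∎
    where
    open ≡-Reasoning
    F = to (iso q ⊕ᵢ idᵢ {m₁ + m₂})
    G = to (interchangeᵢ n₁ m₁ (n₂ + (t₁ + t₂)) m₂)

module _ {n m} (N : Matroid n) (T : Matroid (n + m)) (C : Subset m) (rep : ∀ X → rk T (X ++ C) ≡ rk N X + ∣ C ∣) where

  restrict-rk : ∀ X → rk (restrict T (⊤ ++ C)) (X ++ C) ≡ rk N X + ∣ C ∣
  restrict-rk X = trans (cong (rk T) (trans (∩-++ X ⊤ C C) (cong₂ _++_ (∩-identityʳ X) (∩-idem C)))) (rep X)

  -- The restriction matters here: points of T outside C could raise the rank of T, while the size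
  -- equations of the enlarged construction need it exactly.
  restrict-rank : rank (restrict T (⊤ ++ C)) ≡ rank N + ∣ C ∣
  restrict-rank = trans (cong (rk T) (∩-identityˡ (⊤ ++ C))) (rep ⊤)

-- If N_i is the contraction T_i / C_i of a transversal matroid by an independent
-- set, then M is the contraction by C₁ ∪ C₂ of the transversal matroid built in
-- the same way from the T_i and the sets A_i ∪ C_i.
amalgam-gammoid : ∀ {n₁ n₂ t₁ t₂ n} (q : Quad n₁ n₂ t₁ t₂ n) {k N₁ A₁ N₂ A₂} (M : Matroid n) →
                  Sizes k N₁ A₁ N₂ A₂ t₁ t₂ → IsAmalgamRk q k N₁ A₁ N₂ A₂ (rk M) →
                  IsGammoid N₁ → IsGammoid N₂ → IsGammoid M
amalgam-gammoid {n₁} {n₂} {t₁} {t₂} {n} q {k} {N₁} {A₁} {N₂} {A₂} M sizes formula gam₁ gam₂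
  with gammoid-independent N₁ gam₁ | gammoid-independent N₂ gam₂
... | m₁ , T₁ , C₁ , tr₁ , rep₁ | m₂ , T₂ , C₂ , tr₂ , rep₂ =
  m₁ + m₂ , T⁺ , C₁ ++ C₂ ,
  presented⇒transversal T⁺ family (transversalMatroid-presents family) , λ X → sym (begin
    rk T⁺ (X ++ (C₁ ++ C₂)) ∸ rk T⁺ (⊥ {n} ++ (C₁ ++ C₂)) ≡⟨ cong₂ _∸_ (T⁺-rk X) (T⁺-rk ⊥) ⟩
    (rk M X + s) ∸ (rk M ⊥ + s)                     ≡⟨ cong (λ z → (rk M X + s) ∸ (z + s)) (rk-⊥ M) ⟩
    (rk M X + s) ∸ s                                ≡⟨ m+n∸n≡m (rk M X) s ⟩
    rk M X                                          ∎)
  where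
  open ≡-Reasoning
  open Sizes sizes
  s  = ∣ C₁ ∣ + ∣ C₂ ∣
  q′ = extend-quad q m₁ m₂
  R₁ = restrict T₁ (⊤ ++ C₁)
  R₂ = restrict T₂ (⊤ ++ C₂)
  -- Each r(N_i) and each |A_i| grows by |C_i|, so k + s balances both size equations with U₁ and U₂
  -- unchanged.
  sizes′ : Sizes (k + s) R₁ (A₁ ++ C₁) R₂ (A₂ ++ C₂) t₁ t₂
  sizes′ = record
    { size₁ = arith [] 8 (λ t r c z a c′ u k → r ≈ z ⊕ c ∷ u ≈ a ⊕ c′ ∷ t ⊕ z ⊕ a ≈ k ∷ [] ⊢ t ⊕ r ⊕ u ≈ k ⊕ (c ⊕ c′))
        t₁ (rank R₁) (∣ C₁ ∣) (rank N₁) (∣ A₂ ∣) (∣ C₂ ∣) (∣ A₂ ++ C₂ ∣) k (restrict-rank N₁ T₁ C₁ rep₁) (∣++∣ A₂ C₂) size₁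
    ; size₂ = arith [] 8 (λ t r c z a c′ u k → r ≈ z ⊕ c ∷ u ≈ a ⊕ c′ ∷ t ⊕ z ⊕ a ≈ k ∷ [] ⊢ t ⊕ r ⊕ u ≈ k ⊕ (c′ ⊕ c))
        t₂ (rank R₂) (∣ C₂ ∣) (rank N₂) (∣ A₁ ∣) (∣ C₁ ∣) (∣ A₁ ++ C₁ ∣) k (restrict-rank N₂ T₂ C₂ rep₂) (∣++∣ A₁ C₁) size₂
    ; room = arith [] 15 (λ r₁ r₂ z₁ z₂ a₁ a₂ c₁ c₂ u₁ u₂ x₁ x₂ y₁ y₂ k →
        r₁ ≈ z₁ ⊕ c₁ ∷ r₂ ≈ z₂ ⊕ c₂ ∷ u₁ ≈ a₁ ⊕ c₁ ∷ u₂ ≈ a₂ ⊕ c₂ ∷ x₁ ≈ y₁ ⊕ c₁ ∷ x₂ ≈ y₂ ⊕ c₂ ∷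
        z₁ ⊕ a₁ ⊕ (z₂ ⊕ a₂) ≲ k ⊕ (y₁ ⊕ y₂) ∷ [] ⊢ r₁ ⊕ u₁ ⊕ (r₂ ⊕ u₂) ≲ k ⊕ (c₁ ⊕ c₂) ⊕ (x₁ ⊕ x₂))
        (rank R₁) (rank R₂) (rank N₁) (rank N₂) (∣ A₁ ∣) (∣ A₂ ∣) (∣ C₁ ∣) (∣ C₂ ∣) (∣ A₁ ++ C₁ ∣) (∣ A₂ ++ C₂ ∣)
        (rk R₁ (A₁ ++ C₁)) (rk R₂ (A₂ ++ C₂)) (rk N₁ A₁) (rk N₂ A₂) k
        (restrict-rank N₁ T₁ C₁ rep₁) (restrict-rank N₂ T₂ C₂ rep₂) (∣++∣ A₁ C₁) (∣++∣ A₂ C₂)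
        (restrict-rk N₁ T₁ C₁ rep₁ A₁) (restrict-rk N₂ T₂ C₂ rep₂ A₂) room
    }
  tight₁ = transversal⇒tightly-presented R₁ (restrict-transversal T₁ (⊤ ++ C₁) tr₁)
  tight₂ = transversal⇒tightly-presented R₂ (restrict-transversal T₂ (⊤ ++ C₂) tr₂)
  open Presentation q′ sizes′ (proj₁ tight₁) (proj₁ (proj₂ tight₁)) (proj₂ (proj₂ tight₁))
                              (proj₁ tight₂) (proj₁ (proj₂ tight₂)) (proj₂ (proj₂ tight₂))
  T⁺ : Matroid (n + (m₁ + m₂))
  T⁺ = transversalMatroid family
  ∪-card : ∀ {n m} (A b : Subset n) (C : Subset m) → ∣ (A ++ C) ∪ (b ++ C) ∣ ≡ ∣ A ∪ b ∣ + ∣ C ∣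
  ∪-card A b C = trans (cong ∣_∣ (∪-++ A b C C)) (trans (∣++∣ (A ∪ b) (C ∪ C)) (cong (λ Z → ∣ A ∪ b ∣ + ∣ Z ∣) (∪-idem C)))
  T⁺-rk : ∀ X → rk T⁺ (X ++ (C₁ ++ C₂)) ≡ rk M X + s
  T⁺-rk X with atView q X
  -- Every term rises by exactly s. In the third, C₁ contributes through the rank and C₂ through the
  -- union; in the fourth the roles are exchanged.
  ... | atᵛ a b c d = begin
    rk T⁺ (at q a b c d ++ (C₁ ++ C₂))
      ≡⟨ cong (rk T⁺) (sym (at-extend-quad q m₁ m₂ a b c d C₁ C₂)) ⟩
    rk T⁺ (at q′ (a ++ C₁) (b ++ C₂) c d)
      ≡⟨ presented-isAmalgam (rk T⁺) (transversalMatroid-presents family) (a ++ C₁) (b ++ C₂) c d ⟩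
    amalgamRk (k + s) R₁ (A₁ ++ C₁) R₂ (A₂ ++ C₂) (a ++ C₁) (b ++ C₂) c d
      ≡⟨ cong₂ _⊓_ (cong (_⊓ (k + s)) first) (cong₂ _⊓_ third fourth) ⟩
    min₄ (∣ a ∣ + (∣ b ∣ + (∣ c ∣ + ∣ d ∣)) + s) (k + s)
         (rk N₁ a + t₁ + ∣ A₂ ∪ b ∣ + ∣ d ∣ + s) (rk N₂ b + t₂ + ∣ A₁ ∪ a ∣ + ∣ c ∣ + s)
      ≡⟨ sym (min₄-map (_+ s) (+-monoˡ-≤ s) (∣ a ∣ + (∣ b ∣ + (∣ c ∣ + ∣ d ∣))) k
                   (rk N₁ a + t₁ + ∣ A₂ ∪ b ∣ + ∣ d ∣) (rk N₂ b + t₂ + ∣ A₁ ∪ a ∣ + ∣ c ∣)) ⟩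
    amalgamRk k N₁ A₁ N₂ A₂ a b c d + s
      ≡⟨ cong (_+ s) (sym (formula a b c d)) ⟩
    rk M (at q a b c d) + s ∎
    where
    first : ∣ a ++ C₁ ∣ + (∣ b ++ C₂ ∣ + (∣ c ∣ + ∣ d ∣)) ≡ ∣ a ∣ + (∣ b ∣ + (∣ c ∣ + ∣ d ∣)) + s
    first = arith [] 8 (λ x y a b c d c₁ c₂ → x ≈ a ⊕ c₁ ∷ y ≈ b ⊕ c₂ ∷ [] ⊢
      x ⊕ (y ⊕ (c ⊕ d)) ≈ a ⊕ (b ⊕ (c ⊕ d)) ⊕ (c₁ ⊕ c₂))
      (∣ a ++ C₁ ∣) (∣ b ++ C₂ ∣) (∣ a ∣) (∣ b ∣) (∣ c ∣) (∣ d ∣) (∣ C₁ ∣) (∣ C₂ ∣) (∣++∣ a C₁) (∣++∣ b C₂)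
    third : rk R₁ (a ++ C₁) + t₁ + ∣ (A₂ ++ C₂) ∪ (b ++ C₂) ∣ + ∣ d ∣ ≡ rk N₁ a + t₁ + ∣ A₂ ∪ b ∣ + ∣ d ∣ + s
    third = arith [] 8 (λ x r c t u v d c₂ → x ≈ r ⊕ c ∷ u ≈ v ⊕ c₂ ∷ [] ⊢ x ⊕ t ⊕ u ⊕ d ≈ r ⊕ t ⊕ v ⊕ d ⊕ (c ⊕ c₂))
      (rk R₁ (a ++ C₁)) (rk N₁ a) (∣ C₁ ∣) t₁ (∣ (A₂ ++ C₂) ∪ (b ++ C₂) ∣) (∣ A₂ ∪ b ∣) (∣ d ∣) (∣ C₂ ∣)
      (restrict-rk N₁ T₁ C₁ rep₁ a) (∪-card A₂ b C₂)
    fourth : rk R₂ (b ++ C₂) + t₂ + ∣ (A₁ ++ C₁) ∪ (a ++ C₁) ∣ + ∣ c ∣ ≡ rk N₂ b + t₂ + ∣ A₁ ∪ a ∣ + ∣ c ∣ + s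
    fourth = arith [] 8 (λ x r c t u v d c₁ → x ≈ r ⊕ c ∷ u ≈ v ⊕ c₁ ∷ [] ⊢ x ⊕ t ⊕ u ⊕ d ≈ r ⊕ t ⊕ v ⊕ d ⊕ (c₁ ⊕ c))
      (rk R₂ (b ++ C₂)) (rk N₂ b) (∣ C₂ ∣) t₂ (∣ (A₁ ++ C₁) ∪ (a ++ C₁) ∣) (∣ A₁ ∪ a ∣) (∣ c ∣) (∣ C₁ ∣)
      (restrict-rk N₂ T₂ C₂ rep₂ b) (∪-card A₁ a C₁)

module _ {n₁ n₂ t₁ t₂ n} (q : Quad n₁ n₂ t₁ t₂ n) {k N₁ A₁ N₂ A₂} (M : Matroid n)
         (sizes : Sizes k N₁ A₁ N₂ A₂ t₁ t₂) (formula : IsAmalgamRk q k N₁ A₁ N₂ A₂ (rk M)) where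

  N₁-gammoid : IsGammoid M → IsGammoid N₁
  N₁-gammoid = gammoid-contraction (iso q) M N₁ (A₂ ++ (⊤ {t₁} ++ ⊥ {t₂})) λ Y → sym (trans
    (cong₂ _∸_ (N₁-as-contraction q M sizes formula Y)
               (trans (N₁-as-contraction q M sizes formula ⊥) (cong (_+ (t₁ + ∣ A₂ ∣)) (rk-⊥ N₁))))
    (m+n∸n≡m (rk N₁ Y) (t₁ + ∣ A₂ ∣)))

  transversal⇔ : (IsTransversal N₁ × IsTransversal N₂) ⇔ IsTransversal M
  transversal⇔ = mk⇔ (λ (tr₁ , tr₂) → amalgam-transversal q M sizes formula tr₁ tr₂)
    λ tr → N₁-transversal q M sizes formula tr ,
           N₁-transversal (swap-quad q) M (swap-sizes sizes) (swap-isAmalgam q N₁ A₁ N₂ A₂ (rk M) formula) tr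

amalgam-gammoid⇔ : ∀ {n₁ n₂ t₁ t₂ n} (q : Quad n₁ n₂ t₁ t₂ n) {k N₁ A₁ N₂ A₂} (M : Matroid n) →
                   Sizes k N₁ A₁ N₂ A₂ t₁ t₂ → IsAmalgamRk q k N₁ A₁ N₂ A₂ (rk M) →
                   (IsGammoid N₁ × IsGammoid N₂) ⇔ IsGammoid M
amalgam-gammoid⇔ q {N₁ = N₁} {A₁} {N₂} {A₂} M sizes formula = mk⇔ (λ (g₁ , g₂) → amalgam-gammoid q M sizes formula g₁ g₂)
  λ g → N₁-gammoid q M sizes formula g ,
        N₁-gammoid (swap-quad q) M (swap-sizes sizes) (swap-isAmalgam q N₁ A₁ N₂ A₂ (rk M) formula) g

theorem4p5 : ∀ {n₁ n₂ t₁ t₂ : ℕ} (k : ℕ) (M₁ : Matroid n₁) (M₂ : Matroid n₂)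
    (S₁′ : Subset n₁) (S₂′ : Subset n₂) →
    0 < rank M₁ → 0 < rank M₂ →
    rank M₁ + nullity M₁ S₁′ + rank M₂ + nullity M₂ S₂′ ≤ k →
    t₁ + rank M₁ + ∣ S₂′ ∣ ≡ k →
    t₂ + rank M₂ + ∣ S₁′ ∣ ≡ k →
    (M : Matroid (n₁ + (n₂ + (t₁ + t₂)))) →
    IsMk {n₁} {n₂} {t₁} {t₂} k M₁ S₁′ M₂ S₂′ M →
    ((IsTransversal M₁ × IsTransversal M₂) ⇔ IsTransversal M)
    × ((IsCotransversal M₁ × IsCotransversal M₂) ⇔ IsCotransversal M)
    × ((IsBitransversal M₁ × IsBitransversal M₂) ⇔ IsBitransversal M)
    × ((IsGammoid M₁ × IsGammoid M₂) ⇔ IsGammoid M)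
theorem4p5 {n₁} {n₂} {t₁} {t₂} k M₁ M₂ S₁′ S₂′ _ _ nullities size₁ size₂ M isMk =
  tr , cotr ,
  mk⇔ (λ ((tr₁ , co₁) , (tr₂ , co₂)) → Equivalence.to tr (tr₁ , tr₂) , Equivalence.to cotr (co₁ , co₂))
      (λ (trM , coM) → let tr₁ , tr₂ = Equivalence.from tr trM ; co₁ , co₂ = Equivalence.from cotr coM in
                       (tr₁ , co₁) , (tr₂ , co₂)) ,
  amalgam-gammoid⇔ q M sizes formula
  where
  q : Quad n₁ n₂ t₁ t₂ (n₁ + (n₂ + (t₁ + t₂)))
  q = quad idᵢ
  sizes : Sizes k M₁ S₁′ M₂ S₂′ t₁ t₂
  sizes = record { size₁ = size₁ ; size₂ = size₂ ; room = arith [] 9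
    (λ r₁ r₂ ν₁ ν₂ a₁ a₂ x₁ x₂ k → r₁ ⊕ ν₁ ⊕ r₂ ⊕ ν₂ ≲ k ∷ ν₁ ⊕ x₁ ≈ a₁ ∷ ν₂ ⊕ x₂ ≈ a₂ ∷ [] ⊢
      r₁ ⊕ a₁ ⊕ (r₂ ⊕ a₂) ≲ k ⊕ (x₁ ⊕ x₂))
    (rank M₁) (rank M₂) (nullity M₁ S₁′) (nullity M₂ S₂′) (∣ S₁′ ∣) (∣ S₂′ ∣) (rk M₁ S₁′) (rk M₂ S₂′) k
    nullities (m∸n+n≡m (rk-bound M₁ S₁′)) (m∸n+n≡m (rk-bound M₂ S₂′)) }
  rank≡k : rank M ≡ k
  rank≡k = proj₁ (proj₂ (proj₂ isMk))
  formula : IsAmalgamRk q k M₁ S₁′ M₂ S₂′ (rk M)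
  formula = isMk⇒isAmalgam M sizes isMk
  tr : (IsTransversal M₁ × IsTransversal M₂) ⇔ IsTransversal M
  tr = transversal⇔ q M sizes formula
  -- `IsCotransversal` unfolds to `IsTransversal` of `dual`, so the equivalence for the dual
  -- matroids is already the one required.
  cotr : (IsCotransversal M₁ × IsCotransversal M₂) ⇔ IsCotransversal M
  cotr = transversal⇔ (flip-quad q) (dual M) (dual-sizes q M rank≡k sizes formula) (dual-isAmalgam q M rank≡k sizes formula)
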